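{- There exist an absolute constant $C>0$ and a deterministic online edge-coloring algorithm with the following guarantee. For all integers $n \ge 2$ and $\Delta \ge 1$, and for every $n$-vertex graph $G$ of maximum degree $\Delta$ whose edges are revealed one at a time in any order, the algorithm (given $n$ and $\Delta$ in advance) assigns every edge a color at its arrival, irrevocably, such that the result is a proper edge coloring of $G$ using at most $$\Delta + C\,\Delta^{15/16}(\ln n)^{1/16}$$ distinct colors.
   Context: Online edge coloring: an unknown graph $G=(V,E)$ with $|V|=n$ and maximum degree $\Delta$ is given to the algorithm via its vertex set $V$ and the value $\Delta$ in advance. The edges $e_1,e_2,\dots,e_{|E|}$ are then revealed one at a time; when $e_t$ is revealed the algorithm must immediately and irrevocably assign it a color, depending only on $e_1,\dots,e_t$. A coloring is proper (valid) if any two edges sharing an endpoint receive different colors. A deterministic algorithm uses no randomness, so the guarantee holds for every graph and every arrival order. -}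

module Defs where

open import Data.Nat using (ℕ; zero; suc; _+_; _≤_)
open import Data.Nat.Properties using () renaming (_≟_ to _≟ℕ_)
open import Data.Fin using (Fin)
open import Data.Fin.Properties using (_≟_)
open import Data.Product using (Σ; _×_; _,_; proj₁; proj₂)
open import Data.Sum using (_⊎_)
open import Data.List using (List; []; _∷_; _++_; [_]; length; lookup; map; deduplicate)
open import Data.Bool using (Bool; true; false; _∨_)
open import Relation.Nullary using (¬_)
open import Relation.Nullary.Decidable using (⌊_⌋)
open import Relation.Binary.PropositionalEquality using (_≡_; _≢_)

-- An edge revealed to the algorithm: an (ordered presentation of an
-- unordered) pair of vertices of V = Fin n.
Edge : ℕ → Set
Edge n = Fin n × Fin n

-- A deterministic online edge-colouring algorithm: given n and Δ in
-- advance, the list of previously revealed edges e_1..e_{t-1} and the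
-- newly revealed edge e_t, it outputs the colour (a natural number) of e_t.
-- Since it is a function of e_1..e_t only, decisions are online and
-- irrevocable (earlier colours are never changed).
OnlineAlgorithm : Set
OnlineAlgorithm = (n Δ : ℕ) → List (Edge n) → Edge n → ℕ

runFrom : (A : OnlineAlgorithm) (n Δ : ℕ) → List (Edge n) → List (Edge n) → List (Edge n × ℕ)
runFrom A n Δ hist [] = []
runFrom A n Δ hist (e ∷ es) = (e , A n Δ hist e) ∷ runFrom A n Δ (hist ++ [ e ]) es

run : (A : OnlineAlgorithm) (n Δ : ℕ) → List (Edge n) → List (Edge n × ℕ)
run A n Δ es = runFrom A n Δ [] es

SameEdge : ∀ {n} → Edge n → Edge n → Set
SameEdge (a , b) (c , d) = ((a ≡ c) × (b ≡ d)) ⊎ ((a ≡ d) × (b ≡ c))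

Adjacent : ∀ {n} → Edge n → Edge n → Set
Adjacent (a , b) (c , d) = (a ≡ c) ⊎ (a ≡ d) ⊎ (b ≡ c) ⊎ (b ≡ d)

SimpleGraph : ∀ {n} → List (Edge n) → Set
SimpleGraph es =
  (∀ i → proj₁ (lookup es i) ≢ proj₂ (lookup es i)) ×
  (∀ i j → i ≢ j → ¬ SameEdge (lookup es i) (lookup es j))

incident : ∀ {n} → Fin n → Edge n → Bool
incident v (a , b) = ⌊ v ≟ a ⌋ ∨ ⌊ v ≟ b ⌋

degree : ∀ {n} → List (Edge n) → Fin n → ℕ
degree [] v = 0
degree (e ∷ es) v with incident v e
... | true = suc (degree es v)
... | false = degree es v

MaxDegree : ∀ {n} → List (Edge n) → ℕ → Set
MaxDegree {n} es Δ = (∀ v → degree es v ≤ Δ) × Σ (Fin n) (λ v → degree es v ≡ Δ)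

ProperColouring : ∀ {n} → List (Edge n × ℕ) → Set
ProperColouring cs = ∀ i j → i ≢ j →
  Adjacent (proj₁ (lookup cs i)) (proj₁ (lookup cs j)) →
  proj₂ (lookup cs i) ≢ proj₂ (lookup cs j)

numColours : ∀ {n} → List (Edge n × ℕ) → ℕ
numColours cs = length (deduplicate _≟ℕ_ (map proj₂ cs))

-- Every vertex v keeps a weight w_v(c), initially 1, for each of Δ colours c.  An arriving edge st draws colour c with
-- probability P(c) = κ w_s(c) w_t(c), κ = (1 - ε)/Δ.  At s and t the weight of the drawn colour drops to 0 and the others
-- are divided by 1 - P(c); thus each w_v(c), and each w_u(c) w_v(c) until uv arrives, is a martingale.  An edge that draws
-- nothing gets an extra colour greedily.
--
-- Let q_u(c) be the sum of w_x(c) over the neighbours x of u, taken when the edges ux arrive.  The O(n²) sums Σ w_v,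
-- Σ w_u w_v and Σ q_u w_v over the colours concentrate.  Hence Σ w_s w_t ≈ Δ when st arrives, so that st fails to draw a
-- colour with probability O(ε) only.  Moreover Σ q_u² ≈ d_u² Δ, so q_u(c) ≈ d_u for most c by the second moment method.
-- As w_u(c) (1 - κ q_u(c)) ≤ 1, only the weights of the few other colours can exceed 2/ε, and these are abandoned.
-- The second moments make a union bound over the possible neighbourhoods, chosen adaptively, unnecessary.
--
-- The method of conditional expectations removes the randomness: if y ranges over the normalised deviations of these
-- sums, the potential Σ ((1 + y)^N + (1 - y)^N), N = 16 log n, corrected for its expected growth, does not increase in
-- the mean, so some outcome does not increase it; as long as it is at most (3/2)^N, all |y| ≤ 1/2.
module Submission where

-- The exponent 1/16 balances two errors. Write m = 1/ε. Live weights are at most 2m and can double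
-- once more, so one edge moves a tracked sum by at most A² = 16m². If the sums may deviate by H,
-- the abandoned colours cost an arriving edge O(m⁴H/Δ) by Chebyshev's inequality. This must stay
-- below ε, so H is at most about Δ/m⁵; taking H = Δ/m⁶ absorbs the constants once m is large. The
-- normalised step is then β = 8m⁸/Δ. Each sum makes at most 2Δ moves, so the accumulated
-- second-order growth, of order N²β²Δ, is O(log n) when m¹⁶ log n = O(Δ). Hence ε is of order (log
-- n / Δ)^(1/16), with O(εΔ) extra colours.
--
-- An obstacle is that the sums are not martingales throughout: Σ w_u w_v stops being one at the
-- arrival of uv, and q_u jumps when u gains a neighbour. Such steps leave `drift` unchanged, and
-- their effect is bounded separately.
--
-- Properness is independent of the analysis: a main colour used at a vertex has weight 0 there for
-- ever, hence chance 0, and only main colours of positive chance are ever drawn. So the colouring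
-- is proper even where Δ is too small for the estimates.

open import Defs

-- Rational arithmetic: inequalities, powers, finite sums.

module RationalTools where

  open import Algebra.Bundles using (CommutativeRing)
  open import Data.Fin using (Fin; zero; suc)
  open import Data.List using ([]; _∷_)
  open import Data.Nat as ℕ using (ℕ; zero; suc; s≤s; z≤n)
  import Data.Nat.Properties as ℕ
  open import Data.Rational
  open import Data.Rational.Properties
  open import Data.Sum using (inj₁; inj₂)
  open import Function using (_∘_)
  open import Level using (0ℓ)
  open import Relation.Binary.PropositionalEquality
  open import Relation.Nullary using (¬_; yes; no; contradiction)
  open import Relation.Nullary.Decidable using (dec⇒maybe)
  open import Tactic.RingSolver using (solve-∀; solve)
  open import Tactic.RingSolver.Core.AlmostCommutativeRing using (AlmostCommutativeRing; fromCommutativeRing)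
  import Algebra.Properties.Semiring.Sum (CommutativeRing.semiring +-*-commutativeRing) as Sum
  open import Algebra.Properties.CommutativeSemiring.Exp
    (CommutativeRing.commutativeSemiring +-*-commutativeRing) public
    using (_^_; ^-homo-*; ^-assocʳ; ^-distrib-*)

  ℚ-ring : AlmostCommutativeRing 0ℓ 0ℓ
  ℚ-ring = fromCommutativeRing +-*-commutativeRing (λ x → dec⇒maybe (0ℚ ≟ x))

  2ℚ 3ℚ 4ℚ : ℚ
  2ℚ = 1ℚ + 1ℚ
  3ℚ = 1ℚ + 2ℚ
  4ℚ = 2ℚ + 2ℚ

  private variable
    a b c d x y : ℚ
    k l : ℕ

  <⇒≱ : a < b → ¬ b ≤ a
  <⇒≱ a<b b≤a = <-irrefl refl (<-≤-trans a<b b≤a)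

  -- The format of most estimates below: the slack `t` is a visibly nonnegative combination of
  -- products of known gaps, and the remaining identity is left to the ring solver.
  ≤-from : ∀ t → 0ℚ ≤ t → b ≡ a + t → a ≤ b
  ≤-from {a = a} t 0≤t b≡a+t =
    subst₂ _≤_ (+-identityʳ a) (sym b≡a+t) (+-monoʳ-≤ a 0≤t)

  gap : a ≤ b → 0ℚ ≤ b - a
  gap {a} {b} a≤b = subst (_≤ b - a) (+-inverseʳ a) (+-monoˡ-≤ (- a) a≤b)

  0≤1 : 0ℚ ≤ 1ℚ
  0≤1 = nonNegative⁻¹ 1ℚ

  0≤½ : 0ℚ ≤ ½
  0≤½ = nonNegative⁻¹ ½

  0≤2 : 0ℚ ≤ 2ℚ
  0≤2 = nonNegative⁻¹ 2ℚ

  0≤+ : 0ℚ ≤ a → 0ℚ ≤ b → 0ℚ ≤ a + b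
  0≤+ = +-mono-≤

  0≤* : 0ℚ ≤ a → 0ℚ ≤ b → 0ℚ ≤ a * b
  0≤* {a} {b} 0≤a 0≤b =
    subst (_≤ a * b) (*-zeroʳ a) (*-monoˡ-≤-nonNeg a {{nonNegative 0≤a}} 0≤b)

  0<* : 0ℚ < a → 0ℚ < b → 0ℚ < a * b
  0<* {a} {b} 0<a 0<b =
    subst (_< a * b) (*-zeroʳ a) (*-monoʳ-<-pos a {{positive 0<a}} 0<b)

  0≤² : ∀ a → 0ℚ ≤ a * a
  0≤² a with ≤-total 0ℚ a
  ... | inj₁ 0≤a = 0≤* 0≤a 0≤a
  ... | inj₂ a≤0 = subst (0ℚ ≤_) (lemma a) (0≤* (gap a≤0) (gap a≤0))
    where
    lemma : ∀ a → (0ℚ - a) * (0ℚ - a) ≡ a * a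
    lemma = solve-∀ ℚ-ring

  *-mono : 0ℚ ≤ a → a ≤ b → 0ℚ ≤ c → c ≤ d → a * c ≤ b * d
  *-mono {a} {b} {c} {d} 0≤a a≤b 0≤c c≤d =
    ≤-from ((b - a) * d + a * (d - c))
      (0≤+ (0≤* (gap a≤b) (≤-trans 0≤c c≤d)) (0≤* 0≤a (gap c≤d)))
      (solve (a ∷ b ∷ c ∷ d ∷ []) ℚ-ring)

  *-monoˡ : 0ℚ ≤ a → b ≤ c → a * b ≤ a * c
  *-monoˡ {a} 0≤a b≤c = *-monoˡ-≤-nonNeg a {{nonNegative 0≤a}} b≤c

  *-monoʳ : 0ℚ ≤ a → b ≤ c → b * a ≤ c * a
  *-monoʳ {a} 0≤a b≤c = *-monoʳ-≤-nonNeg a {{nonNegative 0≤a}} b≤c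

  *-cancelˡ : 0ℚ < a → a * b ≤ a * c → b ≤ c
  *-cancelˡ {a} 0<a = *-cancelˡ-≤-pos a {{positive 0<a}}

  *-≤1 : 0ℚ ≤ a → b ≤ 1ℚ → a * b ≤ a
  *-≤1 {a} {b} 0≤a b≤1 = subst (a * b ≤_) (*-identityʳ a) (*-monoˡ 0≤a b≤1)

  -- The inverse is made total by inv 0 = 0.
  opaque
    inv : ℚ → ℚ
    inv x with x ≟ 0ℚ
    ... | yes _ = 0ℚ
    ... | no x≢0 = (1/ x) {{≢-nonZero x≢0}}

    inv-inverse : 0ℚ < x → x * inv x ≡ 1ℚ
    inv-inverse {x} 0<x with x ≟ 0ℚ
    ... | yes x≡0 = contradiction (sym x≡0) (<⇒≢ 0<x)
    ... | no x≢0 = *-inverseʳ x {{≢-nonZero x≢0}}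

    inv-nonNeg : 0ℚ < x → 0ℚ ≤ inv x
    inv-nonNeg {x} 0<x = *-cancelˡ 0<x
      (subst₂ _≤_ (sym (*-zeroʳ x)) (sym (inv-inverse 0<x)) 0≤1)

  ι : ℕ → ℚ
  ι zero = 0ℚ
  ι (suc k) = 1ℚ + ι k

  ι-nonNeg : ∀ k → 0ℚ ≤ ι k
  ι-nonNeg zero = ≤-refl
  ι-nonNeg (suc k) = 0≤+ 0≤1 (ι-nonNeg k)

  ι-mono : k ℕ.≤ l → ι k ≤ ι l
  ι-mono {l = l} z≤n = ι-nonNeg l
  ι-mono (s≤s k≤l) = +-monoʳ-≤ 1ℚ (ι-mono k≤l)

  ι-pos : 1 ℕ.≤ k → 0ℚ < ι k
  ι-pos 1≤k = <-≤-trans (positive⁻¹ 1ℚ) (ι-mono 1≤k)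

  ι-cancel : ι k ≤ ι l → k ℕ.≤ l
  ι-cancel {k} {l} ιk≤ιl with k ℕ.≤? l
  ... | yes k≤l = k≤l
  ... | no k≰l = contradiction (≤-<-trans ιk≤ιl (<-≤-trans ιl<ι1+l (ι-mono (ℕ.≰⇒> k≰l)))) (<-irrefl refl)
    where
    ιl<ι1+l : ι l < 1ℚ + ι l
    ιl<ι1+l = subst (_< 1ℚ + ι l) (+-identityˡ (ι l)) (+-monoˡ-< (ι l) (positive⁻¹ 1ℚ))

  ι-+ : ∀ k l → ι (k ℕ.+ l) ≡ ι k + ι l
  ι-+ zero l = sym (+-identityˡ (ι l))
  ι-+ (suc k) l = trans (cong (1ℚ +_) (ι-+ k l)) (sym (+-assoc 1ℚ (ι k) (ι l)))

  ι-* : ∀ k l → ι (k ℕ.* l) ≡ ι k * ι l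
  ι-* zero l = sym (*-zeroˡ (ι l))
  ι-* (suc k) l = trans (ι-+ l (k ℕ.* l)) (trans (cong (ι l +_) (ι-* k l)) (lemma (ι k) (ι l)))
    where
    lemma : ∀ x y → y + x * y ≡ (1ℚ + x) * y
    lemma = solve-∀ ℚ-ring

  ι-^ : ∀ k l → ι (k ℕ.^ l) ≡ ι k ^ l
  ι-^ k zero = refl
  ι-^ k (suc l) = trans (ι-* k (k ℕ.^ l)) (cong (ι k *_) (ι-^ k l))

  ^-nonNeg : ∀ k → 0ℚ ≤ x → 0ℚ ≤ x ^ k
  ^-nonNeg zero 0≤x = 0≤1
  ^-nonNeg (suc k) 0≤x = 0≤* 0≤x (^-nonNeg k 0≤x)

  ^-pos : ∀ k → 0ℚ < x → 0ℚ < x ^ k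
  ^-pos zero 0<x = positive⁻¹ 1ℚ
  ^-pos (suc k) 0<x = 0<* 0<x (^-pos k 0<x)

  ^-mono : ∀ k → 0ℚ ≤ x → x ≤ y → x ^ k ≤ y ^ k
  ^-mono zero 0≤x x≤y = ≤-refl
  ^-mono (suc k) 0≤x x≤y = *-mono 0≤x x≤y (^-nonNeg k 0≤x) (^-mono k 0≤x x≤y)

  ^-one : ∀ k → 1ℚ ^ k ≡ 1ℚ
  ^-one zero = refl
  ^-one (suc k) = trans (*-identityˡ (1ℚ ^ k)) (^-one k)

  1≤^ : ∀ k → 1ℚ ≤ x → 1ℚ ≤ x ^ k
  1≤^ {x} k 1≤x = subst (_≤ x ^ k) (^-one k) (^-mono k 0≤1 1≤x)

  ^-monoʳ : 1ℚ ≤ x → k ℕ.≤ l → x ^ k ≤ x ^ l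
  ^-monoʳ {x} {k} {l} 1≤x z≤n = 1≤^ l 1≤x
  ^-monoʳ 1≤x (s≤s k≤l) = *-monoˡ (≤-trans 0≤1 1≤x) (^-monoʳ 1≤x k≤l)

  ^-mono-< : ∀ k → 0ℚ ≤ x → x < y → x ^ suc k < y ^ suc k
  ^-mono-< {x} {y} k 0≤x x<y = ≤-<-trans
    (*-monoˡ 0≤x (^-mono k 0≤x (<⇒≤ x<y)))
    (*-monoˡ-<-pos (y ^ k) {{positive (^-pos k (≤-<-trans 0≤x x<y))}} x<y)

  bernoulli : ∀ k → 0ℚ ≤ x → 1ℚ + ι k * x ≤ (1ℚ + x) ^ k
  bernoulli {x} zero 0≤x = ≤-reflexive (solve (x ∷ []) ℚ-ring)
  bernoulli {x} (suc k) 0≤x = ≤-trans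
    (step (ι k) x (ι-nonNeg k))
    (*-monoˡ (0≤+ 0≤1 0≤x) (bernoulli k 0≤x))
    where
    step : ∀ j x → 0ℚ ≤ j → 1ℚ + (1ℚ + j) * x ≤ (1ℚ + x) * (1ℚ + j * x)
    step j x 0≤j = ≤-from (j * (x * x)) (0≤* 0≤j (0≤² x)) (solve (j ∷ x ∷ []) ℚ-ring)

  -- A division-free form of `(1 + x)^k ≤ 1/(1 - kx)`, which stays true when `1 - kx` is negative.
  -- It caps the growth factor accumulated over all moves.
  compound-bound : ∀ k → 0ℚ ≤ x → (1ℚ + x) ^ k * (1ℚ - ι k * x) ≤ 1ℚ
  compound-bound {x} zero 0≤x = ≤-reflexive (solve (x ∷ []) ℚ-ring)
  compound-bound {x} (suc k) 0≤x = ≤-trans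
    (step ((1ℚ + x) ^ k) (ι k) x (^-nonNeg k (0≤+ 0≤1 0≤x)) (ι-nonNeg k))
    (compound-bound k 0≤x)
    where
    step : ∀ p j x → 0ℚ ≤ p → 0ℚ ≤ j → (1ℚ + x) * p * (1ℚ - (1ℚ + j) * x) ≤ p * (1ℚ - j * x)
    step p j x 0≤p 0≤j = ≤-from (p * ((1ℚ + j) * (x * x)))
      (0≤* 0≤p (0≤* (0≤+ 0≤1 0≤j) (0≤² x)))
      (solve (p ∷ j ∷ x ∷ []) ℚ-ring)

  -- Opacity lets Agda solve equations between sums argumentwise.
  opaque
    sum : (Fin k → ℚ) → ℚ
    sum = Sum.sum

    sum-suc : (f : Fin (suc k) → ℚ) → sum f ≡ f zero + sum (f ∘ suc)
    sum-suc f = refl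

    sum-cong : {f g : Fin k → ℚ} → (∀ i → f i ≡ g i) → sum f ≡ sum g
    sum-cong = Sum.sum-cong-≗

    sum-+ : (f g : Fin k → ℚ) → sum (λ i → f i + g i) ≡ sum f + sum g
    sum-+ = Sum.∑-distrib-+

    sum-* : ∀ x (f : Fin k → ℚ) → sum (λ i → x * f i) ≡ x * sum f
    sum-* x f = sym (Sum.*-distribˡ-sum x f)

    sum-swap : (f : Fin k → Fin l → ℚ) → sum (λ i → sum (f i)) ≡ sum (λ j → sum (λ i → f i j))
    sum-swap = Sum.∑-comm

    sum-mono : {f g : Fin k → ℚ} → (∀ i → f i ≤ g i) → sum f ≤ sum g
    sum-mono {zero} f≤g = ≤-refl
    sum-mono {suc k} f≤g = +-mono-≤ (f≤g zero) (sum-mono (f≤g ∘ suc))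

    sum-nonNeg : {f : Fin k → ℚ} → (∀ i → 0ℚ ≤ f i) → 0ℚ ≤ sum f
    sum-nonNeg {zero} 0≤f = ≤-refl
    sum-nonNeg {suc k} 0≤f = 0≤+ (0≤f zero) (sum-nonNeg (0≤f ∘ suc))

    term≤sum : {f : Fin k → ℚ} → (∀ i → 0ℚ ≤ f i) → ∀ i → f i ≤ sum f
    term≤sum {suc k} {f} 0≤f zero = subst (_≤ sum f) (+-identityʳ (f zero)) (+-monoʳ-≤ (f zero) (sum-nonNeg (0≤f ∘ suc)))
    term≤sum {suc k} {f} 0≤f (suc i) = subst (_≤ sum f) (+-identityˡ (f (suc i)))
      (+-mono-≤ (0≤f zero) (term≤sum (0≤f ∘ suc) i))

    sum-const : ∀ k x → sum {k} (λ _ → x) ≡ ι k * x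
    sum-const zero x = sym (*-zeroˡ x)
    sum-const (suc k) x = trans (cong (x +_) (sum-const k x)) (lemma x (ι k))
      where
      lemma : ∀ x y → x + y * x ≡ (1ℚ + y) * x
      lemma = solve-∀ ℚ-ring

  sum-linear : ∀ x y (f g : Fin k → ℚ) → sum (λ i → x * f i + y * g i) ≡ x * sum f + y * sum g
  sum-linear x y f g = trans (sum-+ (λ i → x * f i) (λ i → y * g i)) (cong₂ _+_ (sum-* x f) (sum-* y g))

  sum-minus : (f g : Fin k → ℚ) → sum (λ i → f i - g i) ≡ sum f - sum g
  sum-minus f g = trans (sum-cong λ i → lemma (f i) (g i)) (trans (sum-linear 1ℚ (- 1ℚ) f g) (sym (lemma (sum f) (sum g))))
    where
    lemma : ∀ x y → x - y ≡ 1ℚ * x + - 1ℚ * y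
    lemma = solve-∀ ℚ-ring

  sum-zero : {f : Fin k → ℚ} → (∀ i → f i ≡ 0ℚ) → sum f ≡ 0ℚ
  sum-zero {k} f≡0 = trans (sum-cong f≡0) (trans (sum-const k 0ℚ) (*-zeroʳ (ι k)))

-- The power potential and its expected change in one step.

module Concentration where

  open import Data.Fin using (Fin; zero; suc)
  open import Data.Fin.Properties using (any?)
  open import Data.List using ([]; _∷_)
  open import Data.Nat as ℕ using (ℕ; zero; suc)
  import Data.Nat.Properties as ℕ
  open import Data.Product using (_×_; _,_; ∃; proj₁; proj₂)
  open import Data.Rational
  open import Data.Rational.Properties
  open import Data.Sum using (_⊎_; inj₁; inj₂)
  open import Function using (_∘_)
  open import Relation.Binary.PropositionalEquality
  open import Relation.Nullary using (yes; no; contradiction)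
  open import Relation.Nullary.Decidable using (_×-dec_)
  open import Tactic.RingSolver using (solve-∀; solve)
  open RationalTools

  Within : ℚ → ℚ → Set
  Within r x = - r ≤ x × x ≤ r

  ¼ 8ℚ : ℚ
  ¼ = ½ * ½
  8ℚ = 4ℚ + 4ℚ

  Within-neg : ∀ {r x} → Within r x → Within r (- x)
  Within-neg {r} {x} (l , u) = neg-antimono-≤ u , subst (- x ≤_) (lemma r) (neg-antimono-≤ l)
    where
    lemma : ∀ r → - (- r) ≡ r
    lemma = solve-∀ ℚ-ring

  -- A second-order Taylor bound with the exponent N in place of the exponential, so that no limits are needed.
  power-perturbation : ∀ {v x n β} → ½ ≤ v → 0ℚ ≤ v + x → 0ℚ ≤ n → x ≤ β → n * β ≤ ¼ → ∀ k → ι k ≤ n →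
    v * v * (v + x) ^ k ≤ v ^ k * (v * v + ι k * v * x + 2ℚ * n * ι k * (x * x))
  power-perturbation {v} {x} {n} _ _ _ _ _ zero _ = ≤-reflexive (solve (v ∷ x ∷ n ∷ []) ℚ-ring)
  power-perturbation {v} {x} {n} {β} ½≤v 0≤v+x 0≤n x≤β nβ≤¼ (suc k) 1+k≤n =
    step ((v + x) ^ k) (v ^ k) (ι k) (^-nonNeg k (≤-trans 0≤½ ½≤v)) (ι-nonNeg k) k≤n
      (power-perturbation ½≤v 0≤v+x 0≤n x≤β nβ≤¼ k k≤n)
    where
    k≤n : ι k ≤ n
    k≤n = ≤-trans (ι-mono (ℕ.n≤1+n k)) 1+k≤n

    step : ∀ p r j → 0ℚ ≤ r → 0ℚ ≤ j → j ≤ n →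
      v * v * p ≤ r * (v * v + j * v * x + 2ℚ * n * j * (x * x)) →
      v * v * ((v + x) * p) ≤ v * r * (v * v + (1ℚ + j) * v * x + 2ℚ * n * (1ℚ + j) * (x * x))
    -- Multiplying the induction hypothesis by `v + x` leaves the slack `r x² (2nv - jv - 2njx)`. It
    -- is nonnegative because `j ≤ n`, `v ≥ ½` and `nx ≤ nβ ≤ ¼`.
    step p r j 0≤r 0≤j j≤n ih = ≤-from
      ((v + x) * (r * (v * v + j * v * x + 2ℚ * n * j * (x * x)) - v * v * p)
        + r * (x * x * ((n - j) * v + n * (v - ½) + ½ * (n - j) + 2ℚ * j * ((¼ - n * β) + n * (β - x)))))
      (0≤+ (0≤* 0≤v+x (gap ih))
        (0≤* 0≤r (0≤* (0≤² x) (0≤+ (0≤+ (0≤+ (0≤* (gap j≤n) (≤-trans 0≤½ ½≤v)) (0≤* 0≤n (gap ½≤v)))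
          (0≤* 0≤½ (gap j≤n))) (0≤* (0≤* 0≤2 0≤j) (0≤+ (gap nβ≤¼) (0≤* 0≤n (gap x≤β))))))))
      (lemma v x p r j n β)
      where
      lemma : ∀ v x p r j n β → v * r * (v * v + (1ℚ + j) * v * x + 2ℚ * n * (1ℚ + j) * (x * x)) ≡
        v * v * ((v + x) * p) +
        ((v + x) * (r * (v * v + j * v * x + 2ℚ * n * j * (x * x)) - v * v * p)
        + r * (x * x * ((n - j) * v + n * (v - ½) + ½ * (n - j) + 2ℚ * j * ((¼ - n * β) + n * (β - x)))))
      lemma = solve-∀ ℚ-ring

  record Distribution {K : ℕ} (p : Fin K → ℚ) : Set where
    field
      p-nonNeg : ∀ k → 0ℚ ≤ p k
      total : sum p ≡ 1ℚ

    mean-const : ∀ x → sum (λ k → p k * x) ≡ x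
    mean-const x = trans (sum-cong λ k → *-comm (p k) x)
      (trans (sum-* x p) (trans (cong (x *_) total) (*-identityʳ x)))

    -- The mean is attained from above by an outcome of positive probability.
    below-mean : ∀ (f : Fin K → ℚ) b → sum (λ k → p k * f k) ≤ b → ∃ λ k → 0ℚ < p k × f k ≤ b
    below-mean f b mean≤b with any? (λ k → (0ℚ <? p k) ×-dec (f k ≤? b))
    ... | yes found = found
    ... | no none = contradiction likely likely-absent
      where
      excess-nonNeg : ∀ k → 0ℚ ≤ p k * (f k - b)
      excess-nonNeg k with 0ℚ <? p k
      ... | yes 0<p = 0≤* (p-nonNeg k) (gap (<⇒≤ (≰⇒> λ f≤b → none (k , 0<p , f≤b))))
      ... | no 0≮p = ≤-reflexive (sym (trans (cong (_* (f k - b)) (≤-antisym (≮⇒≥ 0≮p) (p-nonNeg k))) (*-zeroˡ (f k - b))))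

      excess-sum : sum (λ k → p k * (f k - b)) ≤ 0ℚ
      excess-sum = ≤-from (b - sum (λ k → p k * f k)) (gap mean≤b)
        (trans (solve-0 (sum λ k → p k * f k) b) (cong (_+ (b - sum (λ k → p k * f k))) (sym split)))
        where
        solve-0 : ∀ x y → 0ℚ ≡ (x - y) + (y - x)
        solve-0 = solve-∀ ℚ-ring
        distrib : ∀ x y z → x * (y - z) ≡ x * y - x * z
        distrib = solve-∀ ℚ-ring
        split : sum (λ k → p k * (f k - b)) ≡ sum (λ k → p k * f k) - b
        split = trans (sum-cong λ k → distrib (p k) (f k) b)
          (trans (sum-minus (λ k → p k * f k) (λ k → p k * b)) (cong (λ z → sum (λ k → p k * f k) - z) (mean-const b)))

      likely : ∃ λ k → 0ℚ < p k
      likely with any? (λ k → 0ℚ <? p k)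
      ... | yes k = k
      ... | no p≤0 = contradiction (subst₂ _≤_ total (sum-zero {f = λ (_ : Fin K) → 0ℚ} λ _ → refl) (sum-mono λ k → ≮⇒≥ λ 0<p → p≤0 (k , 0<p)))
                       (<⇒≱ (positive⁻¹ 1ℚ))

      likely-absent : _
      likely-absent (k , 0<p) = none (k , 0<p , ≤-from (- (f k - b)) (subst (_≤ - (f k - b)) refl (neg-antimono-≤ fk-b≤0)) (lemma (f k) b))
        where
        lemma : ∀ x y → y ≡ x + - (x - y)
        lemma = solve-∀ ℚ-ring
        fk-b≤0 : f k - b ≤ 0ℚ
        fk-b≤0 = *-cancelˡ 0<p (subst (p k * (f k - b) ≤_) (sym (*-zeroʳ (p k))) (≤-trans (term≤sum excess-nonNeg k) excess-sum))

  record Centred {K : ℕ} (p : Fin K → ℚ) (β : ℚ) (x : Fin K → ℚ) : Set where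
    field
      mean-zero : sum (λ k → p k * x k) ≡ 0ℚ
      within : ∀ k → Within β (x k)

  centred-neg : ∀ {K} {p : Fin K → ℚ} {β x} → Centred p β x → Centred p β (-_ ∘ x)
  centred-neg {p = p} {x = x} c = record
    { mean-zero = trans (sum-cong λ k → lemma (p k) (x k))
        (trans (sum-* (- 1ℚ) (λ k → p k * x k)) (trans (cong (- 1ℚ *_) (Centred.mean-zero c)) (*-zeroʳ (- 1ℚ))))
    ; within = λ k → Within-neg (Centred.within c k) }
    where
    lemma : ∀ x y → x * - y ≡ - 1ℚ * (x * y)
    lemma = solve-∀ ℚ-ring

  -- Both the mean and the values of `g` lie between 0 and `b`, so their difference is at most `b`
  -- in absolute value. The nonzero increments of all tracked quantities are brought into this
  -- shape.
  centred-average : ∀ {K} {p : Fin K → ℚ} → Distribution p → ∀ {b} {g : Fin K → ℚ} → (∀ k → 0ℚ ≤ g k) → (∀ k → g k ≤ b) →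
    Centred p b (λ k → sum (λ j → p j * g j) - g k)
  centred-average {p = p} dist {b} {g} 0≤g g≤b = record
    { mean-zero = begin-equality
        sum (λ k → p k * (mean - g k))                       ≡⟨ sum-cong (λ k → distrib (p k) mean (g k)) ⟩
        sum (λ k → p k * mean - p k * g k)                   ≡⟨ sum-minus (λ k → p k * mean) (λ k → p k * g k) ⟩
        sum (λ k → p k * mean) - sum (λ k → p k * g k)       ≡⟨ cong (_- mean) (mean-const mean) ⟩
        mean - mean                                          ≡⟨ +-inverseʳ mean ⟩
        0ℚ                                                   ∎
    ; within = λ k → lower mean (g k) 0≤mean (g≤b k) , upper mean (g k) mean≤b (0≤g k) }
    where
    open Distribution dist
    open ≤-Reasoning
    mean = sum (λ j → p j * g j)
    distrib : ∀ x y z → x * (y - z) ≡ x * y - x * z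
    distrib = solve-∀ ℚ-ring
    0≤mean : 0ℚ ≤ mean
    0≤mean = sum-nonNeg (λ j → 0≤* (p-nonNeg j) (0≤g j))
    mean≤b : mean ≤ b
    mean≤b = ≤-trans (sum-mono (λ j → *-monoˡ (p-nonNeg j) (g≤b j))) (≤-reflexive (mean-const b))
    lower : ∀ x y → 0ℚ ≤ x → y ≤ b → - b ≤ x - y
    lower x y 0≤x y≤b = ≤-from (x + (b - y)) (0≤+ 0≤x (gap y≤b)) (solve (x ∷ y ∷ b ∷ []) ℚ-ring)
    upper : ∀ x y → x ≤ b → 0ℚ ≤ y → x - y ≤ b
    upper x y x≤b 0≤y = ≤-from ((b - x) + y) (0≤+ (gap x≤b) 0≤y) (solve (x ∷ y ∷ b ∷ []) ℚ-ring)

  centred-scale : ∀ {K} {p : Fin K → ℚ} {b x} c → 0ℚ ≤ c → Centred p b x → Centred p (b * c) (λ k → c * x k)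
  centred-scale {p = p} {b} {x} c 0≤c centred = record
    { mean-zero = trans (sum-cong (λ k → swap (p k) c (x k)))
        (trans (sum-* c (λ k → p k * x k)) (trans (cong (c *_) mean-zero) (*-zeroʳ c)))
    ; within = λ k → ≤-from (c * (x k - - b)) (0≤* 0≤c (gap (proj₁ (within k)))) (lower b c (x k))
                   , ≤-from (c * (b - x k)) (0≤* 0≤c (gap (proj₂ (within k)))) (upper b c (x k)) }
    where
    open Centred centred
    swap : ∀ x y z → x * (y * z) ≡ y * (x * z)
    swap = solve-∀ ℚ-ring
    lower : ∀ b c x → c * x ≡ - (b * c) + c * (x - - b)
    lower = solve-∀ ℚ-ring
    upper : ∀ b c x → b * c ≡ c * x + c * (b - x)
    upper = solve-∀ ℚ-ring

  centred-cong : ∀ {K} {p : Fin K → ℚ} {b x y} → (∀ k → x k ≡ y k) → Centred p b x → Centred p b y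
  centred-cong {p = p} {b} x≡y c = record
    { mean-zero = trans (sum-cong (λ k → cong (p k *_) (sym (x≡y k)))) (Centred.mean-zero c)
    ; within = λ k → subst (Within b) (x≡y k) (Centred.within c k) }

  -- G pays for the second-order growth of one move, and r counts the moves still to come.
  module Weighting (N : ℕ) (G : ℚ) where
    opaque
      term : ℚ → ℕ → ℚ
      term y r = ((1ℚ + y) ^ N + (1ℚ - y) ^ N) * G ^ r

      term-zero : ∀ r → term 0ℚ r ≡ 2ℚ * G ^ r
      term-zero r = cong (_* G ^ r) (cong₂ _+_ (^-one N) (^-one N))

    Φ : ∀ {J} → (Fin J → ℚ) → (Fin J → ℕ) → ℚ
    Φ y r = sum (λ i → term (y i) (r i))

  module Potential (M : ℕ) (β G : ℚ) (0≤β : 0ℚ ≤ β) (β≤½ : β ≤ ½) (nβ≤¼ : ι (suc M ℕ.+ suc M) * β ≤ ¼)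
    (growth : 8ℚ * (ι (suc M ℕ.+ suc M) * ι (suc M ℕ.+ suc M)) * (β * β) ≤ G - 1ℚ) where

    -- Even by construction: every `x ^ N` is a square, so the terms of the potential are
    -- nonnegative and each is bounded by the total.
    N : ℕ
    N = suc M ℕ.+ suc M

    open Weighting N G

    private
      n = ι N
      0≤n = ι-nonNeg N

    1≤G : 1ℚ ≤ G
    1≤G = ≤-from (G - 1ℚ) (≤-trans (0≤* (0≤* (nonNegative⁻¹ 8ℚ) (0≤* 0≤n 0≤n)) (0≤² β)) growth) (solve (G ∷ []) ℚ-ring)

    module _ {K : ℕ} {p : Fin K → ℚ} (dist : Distribution p) where
      open Distribution dist

      -- In the second-order bound the linear term averages to 0, and relative to `v²` the quadratic
      -- term is at most `2N²β²/v² ≤ 8N²β²`, as `v ≥ ½`. This is the origin of the constant 8 in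
      -- `growth`.
      mean-power : ∀ {v x} → ½ ≤ v → Centred p β x → sum (λ k → p k * (v + x k) ^ N) ≤ v ^ N * G
      mean-power {v} {x} ½≤v c = *-cancelˡ (0<* 0<v 0<v) (begin
        v * v * sum (λ k → p k * (v + x k) ^ N)    ≡⟨ sum-* (v * v) _ ⟨
        sum (λ k → v * v * (p k * (v + x k) ^ N))   ≤⟨ sum-mono pointwise ⟩
        sum (λ k → r * (v * v * G) * p k + r * (n * v) * (p k * x k))
                                                     ≡⟨ sum-linear (r * (v * v * G)) (r * (n * v)) p _ ⟩
        r * (v * v * G) * sum p + r * (n * v) * sum (λ k → p k * x k)
                                                     ≡⟨ cong₂ (λ s t → r * (v * v * G) * s + r * (n * v) * t) total mean-zero ⟩
        r * (v * v * G) * 1ℚ + r * (n * v) * 0ℚ      ≡⟨ collect r v G n ⟩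
        v * v * (r * G)                              ∎)
        where
        open Centred c
        open ≤-Reasoning
        0<v = <-≤-trans (positive⁻¹ ½) ½≤v
        r = v ^ N
        0≤r = ^-nonNeg N (<⇒≤ 0<v)

        collect : ∀ r v G n → r * (v * v * G) * 1ℚ + r * (n * v) * 0ℚ ≡ v * v * (r * G)
        collect = solve-∀ ℚ-ring

        bound : ∀ p P r x → 0ℚ ≤ p → 0ℚ ≤ r → Within β x →
          v * v * P ≤ r * (v * v + n * v * x + 2ℚ * n * n * (x * x)) →
          v * v * (p * P) ≤ r * (v * v * G) * p + r * (n * v) * (p * x)
        bound p P r x 0≤p 0≤r (l , u) taylor = ≤-from
          (p * ((r * (v * v + n * v * x + 2ℚ * n * n * (x * x)) - v * v * P)
            + r * ((v - ½) * (v + ½) * (G - 1ℚ) + ¼ * ((G - 1ℚ) - 8ℚ * (n * n) * (β * β))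
            + 2ℚ * (n * n) * ((β - x) * (x - - β)))))
          (0≤* 0≤p (0≤+ (gap taylor) (0≤* 0≤r (0≤+ (0≤+
            (0≤* (0≤* (gap ½≤v) (0≤+ (<⇒≤ 0<v) 0≤½)) (gap 1≤G))
            (0≤* (nonNegative⁻¹ ¼) (gap growth)))
            (0≤* (0≤* 0≤2 (0≤* 0≤n 0≤n)) (0≤* (gap u) (gap l)))))))
          (lemma v p P r x n β G)
          where
          lemma : ∀ v p P r x n β G → r * (v * v * G) * p + r * (n * v) * (p * x) ≡ v * v * (p * P) +
            (p * ((r * (v * v + n * v * x + 2ℚ * n * n * (x * x)) - v * v * P)
            + r * ((v - ½) * (v + ½) * (G - 1ℚ) + ¼ * ((G - 1ℚ) - 8ℚ * (n * n) * (β * β))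
            + 2ℚ * (n * n) * ((β - x) * (x - - β)))))
          lemma = solve-∀ ℚ-ring

        pointwise : ∀ k → v * v * (p k * (v + x k) ^ N) ≤ r * (v * v * G) * p k + r * (n * v) * (p k * x k)
        pointwise k = bound (p k) ((v + x k) ^ N) r (x k) (p-nonNeg k) 0≤r (within k)
          (power-perturbation ½≤v (≤-trans (≤-from (½ - β) (gap β≤½) (half β)) (+-mono-≤ ½≤v (proj₁ (within k))))
            0≤n (proj₂ (within k)) nβ≤¼ N ≤-refl)
          where
          half : ∀ β → ½ - β ≡ 0ℚ + (½ - β)
          half = solve-∀ ℚ-ring

    private
      0≤^N : ∀ x → 0ℚ ≤ x ^ N
      0≤^N x = subst (0ℚ ≤_) (sym (^-homo-* x (suc M) (suc M))) (0≤² (x ^ suc M))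

      0≤G^ : ∀ r → 0ℚ ≤ G ^ r
      0≤G^ r = ^-nonNeg r (≤-trans 0≤1 1≤G)

    opaque
      unfolding term

      term-nonNeg : ∀ y r → 0ℚ ≤ term y r
      term-nonNeg y r = 0≤* (0≤+ (0≤^N (1ℚ + y)) (0≤^N (1ℚ - y))) (0≤G^ r)

      term-mono : ∀ y {r s} → r ℕ.≤ s → term y r ≤ term y s
      term-mono y r≤s = *-monoˡ (0≤+ (0≤^N (1ℚ + y)) (0≤^N (1ℚ - y))) (^-monoʳ 1≤G r≤s)

      term-confines : ∀ {y} r → term y r ≤ (1ℚ + ½) ^ N → Within ½ y
      term-confines {y} r small = subst (- ½ ≤_) (neg-neg y) (neg-antimono-≤ (half (- y) low)) , half y up
        where
        neg-neg : ∀ y → - (- y) ≡ y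
        neg-neg = solve-∀ ℚ-ring
        grow : ∀ a b → 0ℚ ≤ a → 0ℚ ≤ b → a ≤ (a + b) * G ^ r
        grow a b 0≤a 0≤b = ≤-from (b + (a + b) * (G ^ r - 1ℚ)) (0≤+ 0≤b (0≤* (0≤+ 0≤a 0≤b) (gap (1≤^ r 1≤G)))) (lemma a b (G ^ r))
          where
          lemma : ∀ a b g → (a + b) * g ≡ a + (b + (a + b) * (g - 1ℚ))
          lemma = solve-∀ ℚ-ring
        up : (1ℚ + y) ^ N ≤ (1ℚ + ½) ^ N
        up = ≤-trans (grow _ _ (0≤^N (1ℚ + y)) (0≤^N (1ℚ - y))) small
        low : (1ℚ - y) ^ N ≤ (1ℚ + ½) ^ N
        low = ≤-trans (grow _ _ (0≤^N (1ℚ - y)) (0≤^N (1ℚ + y)))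
          (subst (_≤ (1ℚ + ½) ^ N) (cong (_* G ^ r) (+-comm ((1ℚ + y) ^ N) ((1ℚ - y) ^ N))) small)
        half : ∀ z → (1ℚ + z) ^ N ≤ (1ℚ + ½) ^ N → z ≤ ½
        half z small with z ≤? ½
        ... | yes z≤½ = z≤½
        ... | no z≰½ = contradiction small (<⇒≱ (^-mono-< (M ℕ.+ suc M) (0≤+ 0≤1 0≤½) (+-monoʳ-< 1ℚ (≰⇒> z≰½))))

    Φ-confines : ∀ {J} {y : Fin J → ℚ} {r} → Φ y r ≤ (1ℚ + ½) ^ N → ∀ i → Within ½ (y i)
    Φ-confines {y = y} {r} small i =
      term-confines (r i) (≤-trans (term≤sum (λ j → term-nonNeg (y j) (r j)) i) small)

    -- A quantity that stands still keeps its budget or may lose some of it; a centred step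
    -- multiplies the mean by up to `G` and must use up one unit, hence the strict decrease.
    Move : ∀ {K} → (Fin K → ℚ) → (Fin K → ℚ) → ℕ → ℕ → Set
    Move p x r r′ = ((∀ k → x k ≡ 0ℚ) × r′ ℕ.≤ r) ⊎ (Centred p β x × suc r′ ℕ.≤ r)

    opaque
      unfolding term

      mean-term : ∀ {K} {p : Fin K → ℚ} → Distribution p → ∀ {y x r r′} → Within ½ y → Move p x r r′ →
        sum (λ k → p k * term (y + x k) r′) ≤ term y r
      mean-term {p = p} dist {y} {x} {r} {r′} _ (inj₁ (x≡0 , r′≤r)) = begin
        sum (λ k → p k * term (y + x k) r′)  ≡⟨ sum-cong (λ k → cong (λ z → p k * term z r′) (trans (cong (y +_) (x≡0 k)) (+-identityʳ y))) ⟩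
        sum (λ k → p k * term y r′)          ≡⟨ Distribution.mean-const dist (term y r′) ⟩
        term y r′                            ≤⟨ term-mono y r′≤r ⟩
        term y r                             ∎
        where open ≤-Reasoning
      mean-term {p = p} dist {y} {x} {r} {r′} (l , u) (inj₂ (c , r′<r)) = begin
        sum (λ k → p k * term (y + x k) r′)
          ≡⟨ sum-cong (λ k → trans (cong₂ (λ s t → p k * ((s ^ N + t ^ N) * g)) (sym (+-assoc 1ℚ y (x k))) (minus y (x k)))
               (spread (p k) ((1ℚ + y + x k) ^ N) ((1ℚ - y + - x k) ^ N) g)) ⟩
        sum (λ k → g * (p k * (1ℚ + y + x k) ^ N) + g * (p k * (1ℚ - y + - x k) ^ N))
          ≡⟨ sum-linear g g _ _ ⟩
        g * sum (λ k → p k * (1ℚ + y + x k) ^ N) + g * sum (λ k → p k * (1ℚ - y + - x k) ^ N)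
          ≤⟨ +-mono-≤ (*-monoˡ (0≤G^ r′) (mean-power dist (≤-from (y - - ½) (gap l) (half₁ y)) c))
                      (*-monoˡ (0≤G^ r′) (mean-power dist (≤-from (½ - y) (gap u) (half₂ y)) (centred-neg c))) ⟩
        g * ((1ℚ + y) ^ N * G) + g * ((1ℚ - y) ^ N * G)
          ≡⟨ collect g G ((1ℚ + y) ^ N) ((1ℚ - y) ^ N) ⟩
        term y (suc r′)
          ≤⟨ term-mono y r′<r ⟩
        term y r ∎
        where
        open ≤-Reasoning
        g : ℚ
        g = G ^ r′
        minus : ∀ y x → 1ℚ - (y + x) ≡ 1ℚ - y + - x
        minus = solve-∀ ℚ-ring
        spread : ∀ p a b g → p * ((a + b) * g) ≡ g * (p * a) + g * (p * b)
        spread = solve-∀ ℚ-ring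
        half₁ : ∀ y → 1ℚ + y ≡ ½ + (y - - ½)
        half₁ = solve-∀ ℚ-ring
        half₂ : ∀ y → 1ℚ - y ≡ ½ + (½ - y)
        half₂ = solve-∀ ℚ-ring
        collect : ∀ g G a b → g * (a * G) + g * (b * G) ≡ (a + b) * (G * g)
        collect = solve-∀ ℚ-ring

    descent : ∀ {J K} {p : Fin K → ℚ} → Distribution p →
      {y : Fin J → ℚ} {x : Fin J → Fin K → ℚ} {r r′ : Fin J → ℕ} →
      (∀ i → Within ½ (y i)) → (∀ i → Move p (x i) (r i) (r′ i)) →
      ∃ λ k → 0ℚ < p k × Φ (λ i → y i + x i k) r′ ≤ Φ y r
    descent {p = p} dist {y} {x} {r} {r′} small move = Distribution.below-mean dist _ _ (begin
      sum (λ k → p k * Φ (λ i → y i + x i k) r′)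
        ≡⟨ sum-cong (λ k → sym (sum-* (p k) (λ i → term (y i + x i k) (r′ i)))) ⟩
      sum (λ k → sum (λ i → p k * term (y i + x i k) (r′ i)))
        ≡⟨ sum-swap (λ k i → p k * term (y i + x i k) (r′ i)) ⟩
      sum (λ i → sum (λ k → p k * term (y i + x i k) (r′ i)))
        ≤⟨ sum-mono (λ i → mean-term dist (small i) (move i)) ⟩
      Φ y r ∎)
      where open ≤-Reasoning

-- Scalar estimates: single weights, abandoned colours, probability of failure.

module Bounds where

  open import Data.List using ([]; _∷_)
  open import Data.Rational
  open import Data.Rational.Properties
  open import Data.Sum using ([_,_]′)
  open import Relation.Binary.PropositionalEquality
  open import Tactic.RingSolver using (solve-∀; solve)
  open RationalTools
  open Concentration using (8ℚ)

  -- Lets an equation enter a slack for `≤-from`, with a multiplier of either sign.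
  null : ∀ {a b} → a ≡ b → ∀ c → 0ℚ ≤ c * (a - b)
  null {a} refl c = ≤-reflexive (sym (trans (cong (c *_) (+-inverseʳ a)) (*-zeroʳ c)))

  -- In `1152ℚ` two factors 4 come from the weight bound `4m` at the two endpoints, the third from
  -- the Chebyshev factor `4m²δ²`, the 2 from adding the deviations of both endpoints, and `9ℚ` from
  -- the bound `9Δ²H` on each of them.
  9ℚ 1152ℚ : ℚ
  9ℚ = 8ℚ + 1ℚ
  1152ℚ = 4ℚ * 4ℚ * 4ℚ * 2ℚ * 9ℚ

  -- Here `e` and `δ` are the inverses of `m` and `Δ`, given by equations to avoid division.
  -- `sparse` keeps the chance of a live colour at most ½; `tight` says that abandoned colours and a
  -- deviation `H` together cost at most `e`.
  module Estimates (m e Δ δ κ H : ℚ) (2≤m : 2ℚ ≤ m) (0≤δ : 0ℚ ≤ δ) (0≤κ : 0ℚ ≤ κ) (κ≤δ : κ ≤ δ) (0≤Δ : 0ℚ ≤ Δ) (0≤H : 0ℚ ≤ H)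
    (Δδ≡1 : Δ * δ ≡ 1ℚ) (em≡1 : e * m ≡ 1ℚ) (κΔ≡1-e : κ * Δ ≡ 1ℚ - e)
    (sparse : 8ℚ * (m * m) * δ ≤ 1ℚ) (tight : 1152ℚ * (m * m * (m * m) * H * δ) + H * δ ≤ e) where

    0≤m : 0ℚ ≤ m
    0≤m = ≤-trans 0≤2 2≤m

    module _ {a b : ℚ} (0≤a : 0ℚ ≤ a) (0≤b : 0ℚ ≤ b) where
      κab≤½ : a ≤ 2ℚ * m → b ≤ 2ℚ * m → κ * (a * b) ≤ ½
      κab≤½ a≤2m b≤2m = ≤-from
        (½ * (1ℚ - 8ℚ * (m * m) * δ) + (δ - κ) * (a * b) + δ * (2ℚ * m * (2ℚ * m) - a * b))
        (0≤+ (0≤+ (0≤* 0≤½ (gap sparse)) (0≤* (gap κ≤δ) (0≤* 0≤a 0≤b)))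
          (0≤* 0≤δ (gap (*-mono 0≤a a≤2m 0≤b b≤2m))))
        (solve (m ∷ δ ∷ κ ∷ a ∷ b ∷ []) ℚ-ring)

    module _ {p : ℚ} (p≤½ : p ≤ ½) where
      0<1-p : 0ℚ < 1ℚ - p
      0<1-p = <-≤-trans (positive⁻¹ ½) (≤-from (½ - p) (gap p≤½) (solve (p ∷ []) ℚ-ring))

      bump-inverse : ∀ a → a * inv (1ℚ - p) * (1ℚ - p) ≡ a
      bump-inverse a = trans (lemma a (inv (1ℚ - p)) (1ℚ - p)) (trans (cong (a *_) (inv-inverse 0<1-p)) (*-identityʳ a))
        where
        lemma : ∀ a b c → a * b * c ≡ a * (c * b)
        lemma = solve-∀ ℚ-ring

      bump-bound : ∀ a b → a ≤ (1ℚ - p) * b → a * inv (1ℚ - p) ≤ b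
      bump-bound a b a≤ = *-cancelˡ 0<1-p (subst (_≤ (1ℚ - p) * b)
        (trans (sym (bump-inverse a)) (*-comm (a * inv (1ℚ - p)) (1ℚ - p))) a≤)

      bump-≥ : ∀ {a} → 0ℚ ≤ a → 0ℚ ≤ a * inv (1ℚ - p)
      bump-≥ 0≤a = 0≤* 0≤a (inv-nonNeg 0<1-p)

      -- Equality holds here as long as colours stay alive: then w = 1 / (1 - κ q) until the colour is used.
      bump-balance : ∀ {a b q} → p ≤ κ * (a * b) → a * (1ℚ - κ * q) ≤ 1ℚ → a * inv (1ℚ - p) * (1ℚ - κ * (q + b)) ≤ 1ℚ
      bump-balance {a} {b} {q} p≤ balance = subst (_≤ 1ℚ) (swap a (inv (1ℚ - p)) (1ℚ - κ * (q + b)))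
        (bump-bound (a * (1ℚ - κ * (q + b))) 1ℚ (≤-from ((1ℚ - a * (1ℚ - κ * q)) + (κ * (a * b) - p)) (0≤+ (gap balance) (gap p≤))
          (solve (a ∷ b ∷ q ∷ p ∷ κ ∷ []) ℚ-ring)))
        where
        swap : ∀ x y z → x * z * y ≡ x * y * z
        swap = solve-∀ ℚ-ring

      -- Since `p ≤ ½`, one step at most doubles a weight. A weight above `2m` has chance 0 from
      -- then on and is never enlarged again, so `4m` bounds all weights for good.
      bump-alive : ∀ {a} → a ≤ 2ℚ * m → a * inv (1ℚ - p) ≤ 4ℚ * m
      bump-alive {a} a≤2m = bump-bound a (4ℚ * m) (≤-from ((2ℚ * m - a) + 4ℚ * m * (½ - p)) (0≤+ (gap a≤2m) (0≤* (0≤* (0≤+ 0≤2 0≤2) 0≤m) (gap p≤½)))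
        (solve (a ∷ m ∷ p ∷ []) ℚ-ring))

    -- A weight above 2m forces q to exceed its typical value d by Δ/(2m).
    dead-deviation : ∀ {a q d} → 2ℚ * m < a → d ≤ Δ → a * (1ℚ - κ * q) ≤ 1ℚ →
      1ℚ ≤ 4ℚ * (m * m) * (δ * δ) * ((q - d) * (q - d))
    dead-deviation {a} {q} {d} 2m<a d≤Δ balance = ≤-from
      ((y - 1ℚ) * (y - 1ℚ) + 2ℚ * (y - 1ℚ)) (0≤+ (0≤² (y - 1ℚ)) (0≤* 0≤2 (gap 1≤y))) (square m δ q d)
      where
      y = 2ℚ * m * δ * (q - d)

      square : ∀ m δ q d → 4ℚ * (m * m) * (δ * δ) * ((q - d) * (q - d)) ≡
        1ℚ + ((2ℚ * m * δ * (q - d) - 1ℚ) * (2ℚ * m * δ * (q - d) - 1ℚ) + 2ℚ * (2ℚ * m * δ * (q - d) - 1ℚ))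
      square = solve-∀ ℚ-ring

      z≤ : 2ℚ * m * (1ℚ - κ * q) ≤ 1ℚ
      z≤ = [ (λ 0≤z → ≤-trans (*-monoʳ 0≤z (<⇒≤ 2m<a)) balance)
           , (λ z≤0 → ≤-trans (subst (2ℚ * m * (1ℚ - κ * q) ≤_) (*-zeroʳ (2ℚ * m)) (*-monoˡ (0≤* 0≤2 0≤m) z≤0)) 0≤1)
           ]′ (≤-total 0ℚ (1ℚ - κ * q))

      -- Rearranged, `2m(q - Δ) ≥ 2q - Δ`. As `m > 1`, this already forces `q ≥ Δ`; then the right
      -- side is at least `Δ`, so `q` exceeds even the largest possible `d` by `Δ/(2m)`.
      shortfall : 2ℚ * m * Δ - 2ℚ * m * q + 2ℚ * q ≤ Δ
      shortfall = ≤-from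
        (Δ * (1ℚ - 2ℚ * m * (1ℚ - κ * q)) + - 2ℚ * m * q * (κ * Δ - (1ℚ - e)) + - 2ℚ * q * (1ℚ - e * m))
        (0≤+ (0≤+ (0≤* 0≤Δ (gap z≤)) (null κΔ≡1-e (- 2ℚ * m * q))) (null (sym em≡1) (- 2ℚ * q)))
        (solve (m ∷ e ∷ Δ ∷ κ ∷ q ∷ []) ℚ-ring)

      Δ≤q : Δ ≤ q
      Δ≤q = *-cancelˡ 0<m-1 (≤-from (½ * ((Δ - (2ℚ * m * Δ - 2ℚ * m * q + 2ℚ * q)) + Δ)) (0≤* 0≤½ (0≤+ (gap shortfall) 0≤Δ))
        (solve (m ∷ Δ ∷ q ∷ []) ℚ-ring))
        where
        0<m-1 : 0ℚ < m - 1ℚ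
        0<m-1 = <-≤-trans (positive⁻¹ 1ℚ) (≤-from (m - 2ℚ) (gap 2≤m) (solve (m ∷ []) ℚ-ring))

      1≤y : 1ℚ ≤ y
      1≤y = ≤-from
        (δ * ((Δ - (2ℚ * m * Δ - 2ℚ * m * q + 2ℚ * q)) + 2ℚ * m * (Δ - d) + 2ℚ * (q - Δ)) + 1ℚ * (Δ * δ - 1ℚ))
        (0≤+ (0≤* 0≤δ (0≤+ (0≤+ (gap shortfall) (0≤* (0≤* 0≤2 0≤m) (gap d≤Δ))) (0≤* 0≤2 (gap Δ≤q)))) (null Δδ≡1 1ℚ))
        (lemma m Δ δ q d)
        where
        lemma : ∀ m Δ δ q d → 2ℚ * m * δ * (q - d) ≡
          1ℚ + (δ * ((Δ - (2ℚ * m * Δ - 2ℚ * m * q + 2ℚ * q)) + 2ℚ * m * (Δ - d) + 2ℚ * (q - Δ)) + 1ℚ * (Δ * δ - 1ℚ))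
        lemma = solve-∀ ℚ-ring

    -- Chebyshev's inequality as a coefficient: `κ(4m)²` is the most that one colour can contribute,
    -- and `4m²δ²` times the squared deviation dominates the indicator of being abandoned.
    lossRate : ℚ
    lossRate = κ * (4ℚ * m * (4ℚ * m)) * (4ℚ * (m * m) * (δ * δ))

    0≤lossRate : 0ℚ ≤ lossRate
    0≤lossRate = 0≤* (0≤* 0≤κ (0≤² (4ℚ * m))) (0≤* (0≤* (0≤+ 0≤2 0≤2) (0≤² m)) (0≤² δ))

    dead-loss : ∀ {a b} x y → 0ℚ ≤ a → 0ℚ ≤ b → a ≤ 4ℚ * m → b ≤ 4ℚ * m → 0ℚ ≤ y →
      1ℚ ≤ 4ℚ * (m * m) * (δ * δ) * x → κ * (a * b) ≤ lossRate * (x + y)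
    dead-loss {a} {b} x y 0≤a 0≤b a≤A b≤A 0≤y 1≤ = ≤-from
      (κ * (4ℚ * m * (4ℚ * m) - a * b) + κ * (4ℚ * m * (4ℚ * m)) * (4ℚ * (m * m) * (δ * δ) * x - 1ℚ) + lossRate * y)
      (0≤+ (0≤+ (0≤* 0≤κ (gap (*-mono 0≤a a≤A 0≤b b≤A))) (0≤* (0≤* 0≤κ (0≤² (4ℚ * m))) (gap 1≤))) (0≤* 0≤lossRate 0≤y))
      (lemma κ m δ a b x y)
      where
      lemma : ∀ κ m δ a b x y → κ * (4ℚ * m * (4ℚ * m)) * (4ℚ * (m * m) * (δ * δ)) * (x + y) ≡ κ * (a * b) +
        (κ * (4ℚ * m * (4ℚ * m) - a * b) + κ * (4ℚ * m * (4ℚ * m)) * (4ℚ * (m * m) * (δ * δ) * x - 1ℚ)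
          + κ * (4ℚ * m * (4ℚ * m)) * (4ℚ * (m * m) * (δ * δ)) * y)
      lemma = solve-∀ ℚ-ring

    0≤1152 : 0ℚ ≤ 1152ℚ
    0≤1152 = nonNegative⁻¹ 1152ℚ

    Hδ≤e : H * δ ≤ e
    Hδ≤e = ≤-trans (≤-from (1152ℚ * (m * m * (m * m) * H * δ))
      (0≤* 0≤1152 (0≤* (0≤* (0≤* (0≤² m) (0≤² m)) 0≤H) 0≤δ)) (+-comm (1152ℚ * (m * m * (m * m) * H * δ)) (H * δ))) tight

    H≤eΔ : H ≤ e * Δ
    H≤eΔ = ≤-from (Δ * (e - H * δ) + H * (Δ * δ - 1ℚ)) (0≤+ (0≤* 0≤Δ (gap Hδ≤e)) (null Δδ≡1 H))
      (solve (e ∷ Δ ∷ δ ∷ H ∷ []) ℚ-ring)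

    -- This is what the factor `1 - e` in `κ` buys: even if the sum of products exceeds `Δ` by `H`,
    -- the chances of the main colours add up to at most 1, because `Hδ ≤ e`.
    total≤1 : ∀ {x} → x ≤ Δ + H → κ * x ≤ 1ℚ
    total≤1 {x} x≤ = ≤-from
      (κ * (Δ + H - x) + (δ - κ) * H + (e - H * δ) + - 1ℚ * (κ * Δ - (1ℚ - e)))
      (0≤+ (0≤+ (0≤+ (0≤* 0≤κ (gap x≤)) (0≤* (gap κ≤δ) 0≤H)) (gap Hδ≤e)) (null κΔ≡1-e (- 1ℚ)))
      (solve (e ∷ Δ ∷ δ ∷ κ ∷ H ∷ x ∷ []) ℚ-ring)

    loss-bound : ∀ {v v′} → v ≤ 9ℚ * (Δ * Δ * H) → v′ ≤ 9ℚ * (Δ * Δ * H) →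
      lossRate * (v + v′) ≤ 1152ℚ * (κ * (m * m * (m * m) * H))
    loss-bound v≤ v′≤ = ≤-trans (*-monoˡ 0≤lossRate (+-mono-≤ v≤ v′≤)) (≤-reflexive
      (trans (lemma 4ℚ 9ℚ κ m δ Δ H) (trans (cong (λ x → 1152ℚ * (κ * (m * m * (m * m) * H)) * (x * x)) Δδ≡1)
        (*-identityʳ (1152ℚ * (κ * (m * m * (m * m) * H)))))))
      where
      lemma : ∀ f n κ m δ Δ H → κ * (f * m * (f * m)) * (f * (m * m) * (δ * δ)) * (n * (Δ * Δ * H) + n * (Δ * Δ * H)) ≡
        f * f * f * 2ℚ * n * (κ * (m * m * (m * m) * H)) * (Δ * δ * (Δ * δ))
      lemma = solve-∀ ℚ-ring

    -- One `e` is the deliberate deficit `1 - κΔ`; the other covers, by `tight`, the deviation `H`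
    -- of the sum and the abandoned colours at both endpoints.
    total≥ : ∀ {S x v v′} → Δ - H ≤ x → v ≤ 9ℚ * (Δ * Δ * H) → v′ ≤ 9ℚ * (Δ * Δ * H) →
      κ * x ≤ S + lossRate * (v + v′) → 1ℚ - S ≤ 2ℚ * e
    total≥ {S} {x} {v} {v′} x≥ v≤ v′≤ S≥ = combine (m * m * (m * m) * H) (lossRate * (v + v′))
      (0≤* (0≤* (0≤² m) (0≤² m)) 0≤H) tight (loss-bound v≤ v′≤) S≥
      where
      combine : ∀ z l → 0ℚ ≤ z → 1152ℚ * (z * δ) + H * δ ≤ e → l ≤ 1152ℚ * (κ * z) → κ * x ≤ S + l → 1ℚ - S ≤ 2ℚ * e
      combine z l 0≤z tight l≤ S≥ = ≤-from
        ((e - (1152ℚ * (z * δ) + H * δ)) + (δ - κ) * (1152ℚ * z + H) + (1152ℚ * (κ * z) - l)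
          + (S + l - κ * x) + κ * (x - (Δ - H)) + 1ℚ * (κ * Δ - (1ℚ - e)))
        (0≤+ (0≤+ (0≤+ (0≤+ (0≤+ (gap tight) (0≤* (gap κ≤δ) (0≤+ (0≤* 0≤1152 0≤z) 0≤H))) (gap l≤)) (gap S≥))
          (0≤* 0≤κ (gap x≥))) (null κΔ≡1-e 1ℚ))
        (lemma 1152ℚ e Δ δ κ H S x z l)
        where
        lemma : ∀ c e Δ δ κ H S x z l → 2ℚ * e ≡ 1ℚ - S +
          ((e - (c * (z * δ) + H * δ)) + (δ - κ) * (c * z + H) + (c * (κ * z) - l)
          + (S + l - κ * x) + κ * (x - (Δ - H)) + 1ℚ * (κ * Δ - (1ℚ - e)))
        lemma = solve-∀ ℚ-ring

-- The colouring process and its properness.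

module Colouring where

  open import Data.Bool using (if_then_else_; _∧_)
  open import Data.Fin as Fin using (Fin; zero; suc; toℕ; remQuot)
  open import Data.Fin.Patterns using (0F; 1F; 2F; 3F)
  import Data.Fin.Properties as Fin
  open import Data.List as List using (List; []; _∷_; _++_; length; foldl; lookup)
  open import Data.List.Membership.Propositional using (_∈_; _∉_)
  open import Data.List.Membership.Propositional.Properties using (∈-++⁺ˡ; ∈-++⁺ʳ; ∈-lookup)
  import Data.List.Membership.DecPropositional as Membership
  open import Data.List.Properties using (foldl-++)
  open import Data.List.Relation.Unary.All as All using (All; []; _∷_)
  open import Data.List.Relation.Unary.AllPairs using (AllPairs; []; _∷_)
  open import Data.List.Relation.Unary.Any using (here; there; index)
  open import Data.List.Relation.Unary.Any.Properties using (lookup-index)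
  open import Data.Maybe using (Maybe; just; nothing; maybe′)
  open import Data.Nat as ℕ using (ℕ; zero; suc)
  import Data.Nat.Properties as ℕ
  open import Data.Product using (_×_; _,_; ∃; proj₁; proj₂)
  open import Data.Rational
  open import Data.Rational.Properties
  open import Data.Sum using (_⊎_; inj₁; inj₂)
  open import Relation.Binary.PropositionalEquality
  open import Relation.Nullary using (Dec; yes; no; does; contradiction; ¬?)
  open import Relation.Nullary.Decidable using (_×-dec_; decidable-stable)
  open RationalTools
  open Concentration

  open Membership ℕ._≟_ using (_∈?_)

  unused : (F : List ℕ) → ∃ λ (i : Fin (suc (length F))) → toℕ i ∉ F
  unused F with Fin.any? (λ i → ¬? (toℕ i ∈? F))
  ... | yes found = found
  ... | no none = contradiction (cong toℕ i≡j) (ℕ.<⇒≢ i<j)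
    where
    all∈ : ∀ i → toℕ i ∈ F
    all∈ i = decidable-stable (toℕ i ∈? F) (λ i∉F → none (i , i∉F))
    collision = Fin.pigeonhole (ℕ.n<1+n (length F)) (λ i → index (all∈ i))
    i = proj₁ collision
    j = proj₁ (proj₂ collision)
    i<j = proj₁ (proj₂ (proj₂ collision))
    i≡j : i ≡ j
    i≡j = Fin.toℕ-injective (trans (lookup-index (all∈ i))
      (trans (cong (lookup F) (proj₂ (proj₂ (proj₂ collision)))) (sym (lookup-index (all∈ j)))))

  opaque
    fresh : List ℕ → ℕ
    fresh F = toℕ (proj₁ (unused F))

    fresh∉ : ∀ F → fresh F ∉ F
    fresh∉ F = proj₂ (unused F)

    fresh≤length : ∀ F → fresh F ℕ.≤ length F
    fresh≤length F = ℕ.s≤s⁻¹ (Fin.toℕ<n (proj₁ (unused F)))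

  module _ {k} {P : Fin (suc k) → Set} (P? : ∀ i → Dec (P i)) where

    select : Fin (suc k)
    select with Fin.any? P?
    ... | yes (i , _) = i
    ... | no _ = zero

    select-sound : ∃ P → P select
    select-sound found with Fin.any? P?
    ... | yes (_ , Pi) = Pi
    ... | no none = contradiction found none

    -- The default of `select` is `zero`, the outcome that takes a fresh extra colour. So a main
    -- colour comes out only if it passed the test, whether or not an acceptable outcome exists, and
    -- properness needs no estimate.
    select-suc : ∀ {i} → select ≡ suc i → P (suc i)
    select-suc eq with Fin.any? P?
    select-suc refl | yes (_ , Pi) = Pi

  _∈ₑ_ : ∀ {n} → Fin n → Edge n → Set
  x ∈ₑ (s , t) = x ≡ s ⊎ x ≡ t

  opaque
    mate : ∀ {n} → Edge n → Fin n → Maybe (Fin n)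
    mate (s , t) x with x Fin.≟ s | x Fin.≟ t
    ... | yes _ | _ = just t
    ... | no _ | yes _ = just s
    ... | no _ | no _ = nothing

    mate-∈ : ∀ {n} {e : Edge n} {x} → x ∈ₑ e → ∃ λ y → mate e x ≡ just y
    mate-∈ {e = s , t} {x} x∈e with x Fin.≟ s | x Fin.≟ t | x∈e
    ... | yes _ | _ | _ = t , refl
    ... | no _ | yes _ | _ = s , refl
    ... | no x≢s | no _ | inj₁ x≡s = contradiction x≡s x≢s
    ... | no _ | no x≢t | inj₂ x≡t = contradiction x≡t x≢t

    mate-just : ∀ {n} {e : Edge n} {x y} → mate e x ≡ just y → (x ≡ proj₁ e × y ≡ proj₂ e) ⊎ (x ≡ proj₂ e × y ≡ proj₁ e)
    mate-just {e = s , t} {x} eq with x Fin.≟ s | x Fin.≟ t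
    mate-just {e = s , t} {x} refl | yes x≡s | _ = inj₁ (x≡s , refl)
    mate-just {e = s , t} {x} refl | no _ | yes x≡t = inj₂ (x≡t , refl)

    -- Phrased with the accumulated degree so that it can be iterated along the arrival sequence.
    mate-degree : ∀ {n} (e : Edge n) es x d →
      maybe′ (λ _ → suc d) d (mate e x) ℕ.+ degree es x ≡ d ℕ.+ degree (e ∷ es) x
    mate-degree (s , t) es x d with x Fin.≟ s | x Fin.≟ t
    ... | yes _ | _ = sym (ℕ.+-suc d (degree es x))
    ... | no _ | yes _ = sym (ℕ.+-suc d (degree es x))
    ... | no _ | no _ = refl

  -- The main colours are 0, …, K - 1; an edge that draws none of them gets an extra colour K + i.  A colour whose weight
  -- at a vertex exceeds B is abandoned there.
  module Process (n K N : ℕ) (κ B δ scale G : ℚ) where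

    open Weighting N G

    V C Outcome : Set
    V = Fin n
    C = Fin K
    Outcome = Fin (suc K)

    -- q x c adds up w y c over the edges xy, each taken just before its arrival.  drift accumulates the martingale parts
    -- of Σ w_v, Σ w_u w_v, Σ q_u w_v / Δ and (negated) of the number of extra colours at v; it only serves to define the
    -- potential that steers the choices.
    record State : Set where
      field
        w q : V → C → ℚ
        drift : Fin 4 → V → V → ℚ
        deg : V → ℕ
        extras : V → List ℕ
    open State

    opaque
      alive? : ∀ x → Dec (x ≤ B)
      alive? x = x ≤? B

    chance : ℚ → ℚ → ℚ
    chance x y = if does (alive? x) ∧ does (alive? y) then κ * (x * y) else 0ℚ

    survive : Outcome → C → ℚ → ℚ
    survive zero c z = z
    survive (suc c′) c z = if does (c′ Fin.≟ c) then 0ℚ else z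

    isNone : Outcome → ℚ
    isNone zero = 1ℚ
    isNone (suc _) = 0ℚ

    module Arrival (st : State) (e : Edge n) where
      P : C → ℚ
      P c = chance (w st (proj₁ e) c) (w st (proj₂ e) c)

      prob : Outcome → ℚ
      prob zero = 1ℚ - sum P
      prob (suc c) = P c

      bumped : V → C → ℚ
      bumped x c = w st x c * inv (1ℚ - P c)

      w′ : Outcome → V → C → ℚ
      w′ k x c = maybe′ (λ _ → survive k c (bumped x c)) (w st x c) (mate e x)

      q′ : V → C → ℚ
      q′ x c = maybe′ (λ y → q st x c + w st y c) (q st x c) (mate e x)

      -- Only changes of mean zero are recorded. The value is 0 where the sum itself is biased or
      -- grows deterministically: in kind 1 when both vertices are endpoints of the edge, in kind 2
      -- when `u` is one, so that `q u` grows. The factor `δ` in kind 2 brings the coefficients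
      -- `q u c ≤ AΔ` down to the size of a weight.
      increment : Outcome → Fin 4 → V → V → ℚ
      increment k 0F u v = sum (λ c → w′ k v c - w st v c)
      increment k 1F u v = maybe′ (λ _ → maybe′ (λ _ → 0ℚ) change (mate e v)) change (mate e u)
        where change = sum (λ c → w′ k u c * w′ k v c - w st u c * w st v c)
      increment k 2F u v = maybe′ (λ _ → 0ℚ) (sum (λ c → δ * q st u c * (w′ k v c - w st v c))) (mate e u)
      increment k 3F u v = maybe′ (λ _ → prob zero - isNone k) 0ℚ (mate e v)

      deg′ : V → ℕ
      deg′ x = maybe′ (λ _ → suc (deg st x)) (deg st x) (mate e x)

      extra : ℕ
      extra = fresh (extras st (proj₁ e) ++ extras st (proj₂ e))

      extras′ : Outcome → V → List ℕ
      extras′ zero x = maybe′ (λ _ → extra ∷ extras st x) (extras st x) (mate e x)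
      extras′ (suc _) x = extras st x

      next : Outcome → State
      next k = record
        { w = w′ k
        ; q = q′
        ; drift = λ τ u v → drift st τ u v + increment k τ u v
        ; deg = deg′
        ; extras = extras′ k
        }

      colour : Outcome → ℕ
      colour zero = K ℕ.+ extra
      colour (suc c) = toℕ c

    Object : Set
    Object = Fin (4 ℕ.* (n ℕ.* n))

    kind : Object → Fin 4
    kind i = proj₁ (remQuot {4} (n ℕ.* n) i)

    left right : Object → V
    left i = proj₁ (remQuot {n} n (proj₂ (remQuot {4} (n ℕ.* n) i)))
    right i = proj₂ (remQuot {n} n (proj₂ (remQuot {4} (n ℕ.* n) i)))

    level : State → Object → ℚ
    level st i = scale * drift st (kind i) (left i) (right i)

    -- A tracked quantity moves only at edges that touch `left i` or `right i`, and a vertex of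
    -- degree `d` receives at most `K - d` more edges.
    remaining : (V → ℕ) → Object → ℕ
    remaining d i = (K ℕ.∸ d (left i)) ℕ.+ (K ℕ.∸ d (right i))

    potential : State → ℚ
    potential st = Φ (level st) (remaining (deg st))

    module _ (st : State) (e : Edge n) where
      open Arrival st e

      -- Positive probability is demanded for properness: a main colour already used at an endpoint
      -- has weight 0 there, hence chance 0.
      Acceptable : Outcome → Set
      Acceptable k = 0ℚ < prob k × potential (next k) ≤ potential st

      acceptable? : ∀ k → Dec (Acceptable k)
      acceptable? k = (0ℚ <? prob k) ×-dec (potential (next k) ≤? potential st)

      opaque
        choose : Outcome
        choose = select acceptable?

        choose-acceptable : ∃ Acceptable → Acceptable choose
        choose-acceptable = select-sound acceptable?

        choose-likely : ∀ c → choose ≡ suc c → 0ℚ < P c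
        choose-likely c chosen = proj₁ (select-suc acceptable? chosen)

      step : State
      step = next choose

      colourOf : ℕ
      colourOf = colour choose

    initial : State
    initial = record
      { w = λ _ _ → 1ℚ ; q = λ _ _ → 0ℚ ; drift = λ _ _ _ → 0ℚ ; deg = λ _ → 0 ; extras = λ _ → [] }

    state : List (Edge n) → State
    state = foldl step initial

    state-snoc : ∀ h e → state (h ++ e ∷ []) ≡ step (state h) e
    state-snoc h e = foldl-++ step initial h (e ∷ [])

    -- The trace that a coloured edge leaves at its endpoints. It is permanent, as zero weights stay
    -- zero and the lists only grow, and it suffices to exclude the colour from every later adjacent
    -- edge.
    Recorded : State → Edge n → ℕ → Set
    Recorded st f d =
      (∃ λ c → d ≡ toℕ c × (∀ x → x ∈ₑ f → w st x c ≡ 0ℚ)) ⊎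
      (∃ λ i → d ≡ K ℕ.+ i × (∀ x → x ∈ₑ f → i ∈ extras st x))

    chance-zeroˡ : ∀ {x} y → x ≡ 0ℚ → chance x y ≡ 0ℚ
    chance-zeroˡ {x} y x≡0 with alive? x | alive? y
    ... | yes _ | yes _ = trans (cong (λ z → κ * (z * y)) x≡0) (trans (cong (κ *_) (*-zeroˡ y)) (*-zeroʳ κ))
    ... | yes _ | no _ = refl
    ... | no _ | _ = refl

    chance-comm : ∀ x y → chance x y ≡ chance y x
    chance-comm x y with alive? x | alive? y
    ... | yes _ | yes _ = cong (κ *_) (*-comm x y)
    ... | yes _ | no _ = refl
    ... | no _ | yes _ = refl
    ... | no _ | no _ = refl

    survive-zero : ∀ k c {z} → z ≡ 0ℚ → survive k c z ≡ 0ℚ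
    survive-zero zero c z≡0 = z≡0
    survive-zero (suc c′) c z≡0 with c′ Fin.≟ c
    ... | yes _ = refl
    ... | no _ = z≡0

    module _ (st : State) (e : Edge n) where
      open Arrival st e

      P-zero : ∀ {x c} → x ∈ₑ e → w st x c ≡ 0ℚ → P c ≡ 0ℚ
      P-zero {c = c} (inj₁ refl) wx≡0 = chance-zeroˡ (w st (proj₂ e) c) wx≡0
      P-zero {c = c} (inj₂ refl) wx≡0 =
        trans (chance-comm (w st (proj₁ e) c) (w st (proj₂ e) c)) (chance-zeroˡ (w st (proj₁ e) c) wx≡0)

      w′-zero : ∀ k {x c} → w st x c ≡ 0ℚ → w′ k x c ≡ 0ℚ
      w′-zero k {x} {c} wx≡0 with mate e x
      ... | nothing = wx≡0
      ... | just _ = survive-zero k c (trans (cong (_* inv (1ℚ - P c)) wx≡0) (*-zeroˡ (inv (1ℚ - P c))))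

      w′-hit : ∀ {x} c → x ∈ₑ e → w′ (suc c) x c ≡ 0ℚ
      w′-hit {x} c x∈e rewrite proj₂ (mate-∈ {e = e} x∈e) with c Fin.≟ c
      ... | yes _ = refl
      ... | no ≢ = contradiction refl ≢

      extras-grow : ∀ k {i x} → i ∈ extras st x → i ∈ extras′ k x
      extras-grow zero {i} {x} i∈ with mate e x
      ... | nothing = i∈
      ... | just _ = there i∈
      extras-grow (suc _) i∈ = i∈

      extra-added : ∀ {x} → x ∈ₑ e → extra ∈ extras′ zero x
      extra-added x∈e rewrite proj₂ (mate-∈ {e = e} x∈e) = here refl

      recorded-next : ∀ k {f d} → Recorded st f d → Recorded (next k) f d
      recorded-next k (inj₁ (c , d≡c , zeros)) = inj₁ (c , d≡c , λ x x∈f → w′-zero k (zeros x x∈f))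
      recorded-next k (inj₂ (i , d≡i , members)) = inj₂ (i , d≡i , λ x x∈f → extras-grow k (members x x∈f))

      recorded-new : ∀ k → Recorded (next k) e (colour k)
      recorded-new zero = inj₂ (extra , refl , λ x x∈e → extra-added x∈e)
      recorded-new (suc c) = inj₁ (c , refl , λ x x∈e → w′-hit c x∈e)

      shared : ∀ {f} → Adjacent f e → ∃ λ x → x ∈ₑ f × x ∈ₑ e
      shared {a , b} (inj₁ a≡s) = a , inj₁ refl , inj₁ a≡s
      shared {a , b} (inj₂ (inj₁ a≡t)) = a , inj₁ refl , inj₂ a≡t
      shared {a , b} (inj₂ (inj₂ (inj₁ b≡s))) = b , inj₂ refl , inj₁ b≡s
      shared {a , b} (inj₂ (inj₂ (inj₂ b≡t))) = b , inj₂ refl , inj₂ b≡t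

      recorded-avoided : ∀ {f d} → Recorded st f d → Adjacent f e → d ≢ colourOf st e
      recorded-avoided rec adj with choose st e in chosen | rec | shared adj
      ... | zero | inj₁ (c , refl , _) | _ = ℕ.<⇒≢ (ℕ.<-≤-trans (Fin.toℕ<n c) (ℕ.m≤m+n K extra))
      ... | zero | inj₂ (i , refl , members) | x , x∈f , x∈e = λ eq →
        fresh∉ (extras st (proj₁ e) ++ extras st (proj₂ e)) (subst (_∈ _) (ℕ.+-cancelˡ-≡ K i extra eq) (locate x∈e (members x x∈f)))
        where
        locate : ∀ {x i} → x ∈ₑ e → i ∈ extras st x → i ∈ extras st (proj₁ e) ++ extras st (proj₂ e)
        locate (inj₁ refl) i∈ = ∈-++⁺ˡ i∈
        locate (inj₂ refl) i∈ = ∈-++⁺ʳ (extras st (proj₁ e)) i∈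
      ... | suc c | inj₁ (c′ , refl , zeros) | x , x∈f , x∈e = λ eq →
        <-irrefl (sym (P-zero x∈e (subst (λ c → w st x c ≡ 0ℚ) (Fin.toℕ-injective eq) (zeros x x∈f)))) (choose-likely st e c chosen)
      ... | suc c | inj₂ (i , refl , _) | _ = λ eq → ℕ.<⇒≢ (ℕ.<-≤-trans (Fin.toℕ<n c) (ℕ.m≤m+n K i)) (sym eq)

    module Run (A : OnlineAlgorithm) (A-spec : ∀ h e → A n K h e ≡ colourOf (state h) e) where

      Distinct : Edge n × ℕ → Edge n × ℕ → Set
      Distinct (f , d) (e , c) = Adjacent f e → d ≢ c

      later-distinct : ∀ h es {f d} → Recorded (state h) f d → All (Distinct (f , d)) (runFrom A n K h es)
      later-distinct h [] rec = []
      later-distinct h (e ∷ es) {f} {d} rec =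
        (λ adj d≡ → recorded-avoided (state h) e rec adj (trans d≡ (A-spec h e)))
        ∷ later-distinct (h ++ e ∷ []) es
            (subst (λ st → Recorded st f d) (sym (state-snoc h e)) (recorded-next (state h) e (choose (state h) e) rec))

      all-distinct : ∀ h es → AllPairs Distinct (runFrom A n K h es)
      all-distinct h [] = []
      all-distinct h (e ∷ es) =
        later-distinct (h ++ e ∷ []) es
          (subst₂ (λ st c → Recorded st e c) (sym (state-snoc h e)) (sym (A-spec h e)) (recorded-new (state h) e (choose (state h) e)))
        ∷ all-distinct (h ++ e ∷ []) es

      Adjacent-sym : {e f : Edge n} → Adjacent e f → Adjacent f e
      Adjacent-sym (inj₁ p) = inj₁ (sym p)
      Adjacent-sym (inj₂ (inj₁ p)) = inj₂ (inj₂ (inj₁ (sym p)))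
      Adjacent-sym (inj₂ (inj₂ (inj₁ p))) = inj₂ (inj₁ (sym p))
      Adjacent-sym (inj₂ (inj₂ (inj₂ p))) = inj₂ (inj₂ (inj₂ (sym p)))

      distinct⇒proper : ∀ {cs} → AllPairs Distinct cs → ProperColouring cs
      distinct⇒proper (_ ∷ _) zero zero i≢j = contradiction refl i≢j
      distinct⇒proper {_ ∷ cs} (xs ∷ _) zero (suc j) _ adj = All.lookup xs (∈-lookup {xs = cs} j) adj
      distinct⇒proper {_ ∷ cs} (xs ∷ _) (suc i) zero _ adj = ≢-sym (All.lookup xs (∈-lookup {xs = cs} i) (Adjacent-sym adj))
      distinct⇒proper (_ ∷ rest) (suc i) (suc j) i≢j = distinct⇒proper rest i j (λ i≡j → i≢j (cong suc i≡j))

      proper : ∀ es → ProperColouring (run A n K es)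
      proper es = distinct⇒proper (all-distinct [] es)

-- Invariants of the process for large Δ.

module Invariants where

  open import Data.Bool using (if_then_else_)
  open import Data.Fin as Fin using (Fin; zero; suc; remQuot; combine)
  open import Data.Fin.Patterns using (0F; 1F; 2F; 3F)
  import Data.Fin.Properties as Fin
  open import Data.List using (List; []; _∷_; _++_; length)
  open import Data.List.Relation.Unary.Any as Any using (Any; here)
  open import Data.List.Relation.Unary.Any.Properties using (++⁺ˡ; ++⁺ʳ)
  open import Data.Maybe using (just; nothing)
  open import Data.Nat as ℕ using (ℕ; zero; suc)
  import Data.Nat.Properties as ℕ
  open import Data.Product using (_×_; _,_; ∃; proj₁; proj₂)
  open import Data.Rational
  open import Data.Rational.Properties
  open import Data.Sum using (_⊎_; inj₁; inj₂)
  open import Relation.Binary.PropositionalEquality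
  open import Relation.Nullary using (¬_; yes; no; contradiction; does)
  open import Tactic.RingSolver using (solve-∀)
  open RationalTools
  open Concentration
  open Bounds
  open Colouring

  Joined : ∀ {n} → List (Edge n) → Fin n → Fin n → Set
  Joined h u v = Any (SameEdge (u , v)) h

  sameEdge-swap : ∀ {n} {u v : Fin n} {e} → SameEdge (u , v) e → SameEdge (v , u) e
  sameEdge-swap (inj₁ (p , q)) = inj₂ (q , p)
  sameEdge-swap (inj₂ (p , q)) = inj₁ (q , p)

  joined-sym : ∀ {n} {h : List (Edge n)} {u v} → Joined h u v → Joined h v u
  joined-sym = Any.map (λ {e} → sameEdge-swap {e = e})

  sum-pick : ∀ {K} (f : Fin K → ℚ) j → sum (λ c → f c - (if does (j Fin.≟ c) then 0ℚ else f c)) ≡ f j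
  sum-pick {suc K} f zero = trans (sum-suc _) (trans (cong ((f zero - 0ℚ) +_) (sum-zero (λ c → +-inverseʳ (f (suc c))))) (lemma (f zero)))
    where
    lemma : ∀ x → x - 0ℚ + 0ℚ ≡ x
    lemma = solve-∀ ℚ-ring
  sum-pick {suc K} f (suc j) = trans (sum-suc _)
    (trans (cong₂ _+_ (+-inverseʳ (f zero)) (sum-pick (λ c → f (suc c)) j)) (+-identityˡ (f (suc j))))

  sum-shift : ∀ {K} (f g : Fin K → ℚ) → sum g ≡ sum f + sum (λ c → g c - f c)
  sum-shift f g = trans (lemma (sum f) (sum g)) (cong (sum f +_) (sym (sum-minus g f)))
    where
    lemma : ∀ x y → y ≡ x + (y - x)
    lemma = solve-∀ ℚ-ring

  -- The numerical requirements of the analysis, free of division. `4m(4m)` is the largest possible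
  -- increment, so `4m(4m)·scale` is the step size of the potential; `2Hs≡1` turns a scaled
  -- deviation of at most ½ into a deviation of at most `H`; `bulk` hides lower-order corrections of
  -- size `A²` under `H`.
  record Setup : Set where
    field
      n K M : ℕ
      m e₀ δ κ H scale G : ℚ
      2≤m : 2ℚ ≤ m
      0≤e : 0ℚ ≤ e₀
      0≤δ : 0ℚ ≤ δ
      0≤κ : 0ℚ ≤ κ
      κ≤δ : κ ≤ δ
      0≤H : 0ℚ ≤ H
      0≤scale : 0ℚ ≤ scale
      Δδ≡1 : ι K * δ ≡ 1ℚ
      em≡1 : e₀ * m ≡ 1ℚ
      κΔ≡1-e : κ * ι K ≡ 1ℚ - e₀
      2Hs≡1 : 2ℚ * H * scale ≡ 1ℚ
      sparse : 8ℚ * (m * m) * δ ≤ 1ℚ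
      tight : 1152ℚ * (m * m * (m * m) * H * δ) + H * δ ≤ e₀
      bulk : 2ℚ * (4ℚ * m * (4ℚ * m)) ≤ H
      β≤½ : 4ℚ * m * (4ℚ * m) * scale ≤ ½
      nβ≤¼ : ι (suc M ℕ.+ suc M) * (4ℚ * m * (4ℚ * m) * scale) ≤ ¼
      growth : 8ℚ * (ι (suc M ℕ.+ suc M) * ι (suc M ℕ.+ suc M)) * (4ℚ * m * (4ℚ * m) * scale * (4ℚ * m * (4ℚ * m) * scale)) ≤ G - 1ℚ

  module Analysis (S : Setup) where

    open Setup S

    Δ A A² : ℚ
    Δ = ι K
    A = 4ℚ * m
    A² = A * A

    0≤Δ : 0ℚ ≤ Δ
    0≤Δ = ι-nonNeg K

    open Bounds.Estimates m e₀ Δ δ κ H 2≤m 0≤δ 0≤κ κ≤δ 0≤Δ 0≤H Δδ≡1 em≡1 κΔ≡1-e sparse tight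
    open Weighting (suc M ℕ.+ suc M) G using (term; Φ)
    open Potential M (A² * scale) G (0≤* (0≤² A) 0≤scale) β≤½ nβ≤¼ growth
    open Colouring.Process n K N κ (2ℚ * m) δ scale G
    open State

    0≤A : 0ℚ ≤ A
    0≤A = 0≤* (0≤+ 0≤2 0≤2) 0≤m

    1≤A : 1ℚ ≤ 4ℚ * m
    1≤A = ≤-from (4ℚ * (m - 2ℚ) + (4ℚ + 3ℚ)) (0≤+ (0≤* (0≤+ 0≤2 0≤2) (gap 2≤m)) (nonNegative⁻¹ (4ℚ + 3ℚ))) (lemma m)
      where
      lemma : ∀ m → 4ℚ * m ≡ 1ℚ + (4ℚ * (m - 2ℚ) + (4ℚ + 3ℚ))
      lemma = solve-∀ ℚ-ring

    1≤A² : 1ℚ ≤ A²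
    1≤A² = ≤-trans 1≤A (subst (_≤ A²) (*-identityʳ A) (*-monoˡ 0≤A 1≤A))

    module _ {a b : ℚ} (0≤a : 0ℚ ≤ a) (0≤b : 0ℚ ≤ b) where

      0≤κab : 0ℚ ≤ κ * (a * b)
      0≤κab = 0≤* 0≤κ (0≤* 0≤a 0≤b)

      chance-nonNeg : 0ℚ ≤ chance a b
      chance-nonNeg with alive? a | alive? b
      ... | yes _ | yes _ = 0≤κab
      ... | yes _ | no _ = ≤-refl
      ... | no _ | _ = ≤-refl

      chance≤ : chance a b ≤ κ * (a * b)
      chance≤ with alive? a | alive? b
      ... | yes _ | yes _ = ≤-refl
      ... | yes _ | no _ = 0≤κab
      ... | no _ | _ = 0≤κab

      chance≤½ : chance a b ≤ ½
      chance≤½ with alive? a | alive? b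
      ... | yes a≤ | yes b≤ = κab≤½ 0≤a 0≤b a≤ b≤
      ... | yes _ | no _ = 0≤½
      ... | no _ | _ = 0≤½

      bump-chance : a ≤ A → a * inv (1ℚ - chance a b) ≤ A
      bump-chance a≤A with alive? a | alive? b
      ... | yes a≤ | yes b≤ = bump-alive (κab≤½ 0≤a 0≤b a≤ b≤) a≤
      ... | yes _ | no _ = bump-bound 0≤½ a A (subst (a ≤_) (sym (*-identityˡ A)) a≤A)
      ... | no _ | _ = bump-bound 0≤½ a A (subst (a ≤_) (sym (*-identityˡ A)) a≤A)

      chance-loss : ∀ {q q′ d d′} → a ≤ A → b ≤ A → d ≤ Δ → d′ ≤ Δ → a * (1ℚ - κ * q) ≤ 1ℚ → b * (1ℚ - κ * q′) ≤ 1ℚ →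
        κ * (a * b) ≤ chance a b + lossRate * ((q - d) * (q - d) + (q′ - d′) * (q′ - d′))
      chance-loss {q} {q′} {d} {d′} a≤A b≤A d≤Δ d′≤Δ bal bal′ with alive? a | alive? b
      ... | yes _ | yes _ = ≤-from (lossRate * ((q - d) * (q - d) + (q′ - d′) * (q′ - d′)))
                              (0≤* 0≤lossRate (0≤+ (0≤² (q - d)) (0≤² (q′ - d′)))) refl
      ... | yes _ | no b≰ = subst (κ * (a * b) ≤_) (trans (cong (lossRate *_) (+-comm ((q′ - d′) * (q′ - d′)) ((q - d) * (q - d))))
                              (sym (+-identityˡ (lossRate * ((q - d) * (q - d) + (q′ - d′) * (q′ - d′))))))
                              (dead-loss ((q′ - d′) * (q′ - d′)) ((q - d) * (q - d)) 0≤a 0≤b a≤A b≤A (0≤² (q - d))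
                                (dead-deviation (≰⇒> b≰) d′≤Δ bal′))
      ... | no a≰ | _ = subst (κ * (a * b) ≤_) (sym (+-identityˡ (lossRate * ((q - d) * (q - d) + (q′ - d′) * (q′ - d′)))))
                              (dead-loss ((q - d) * (q - d)) ((q′ - d′) * (q′ - d′)) 0≤a 0≤b a≤A b≤A (0≤² (q′ - d′))
                                (dead-deviation (≰⇒> a≰) d≤Δ bal))

    survive-cases : ∀ k c z → survive k c z ≡ 0ℚ ⊎ survive k c z ≡ z
    survive-cases zero c z = inj₂ refl
    survive-cases (suc c′) c z with c′ Fin.≟ c
    ... | yes _ = inj₁ refl
    ... | no _ = inj₂ refl

    survive-nonNeg : ∀ k c {z} → 0ℚ ≤ z → 0ℚ ≤ survive k c z
    survive-nonNeg k c {z} 0≤z with survive k c z | survive-cases k c z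
    ... | _ | inj₁ refl = ≤-refl
    ... | _ | inj₂ refl = 0≤z

    survive-≤ : ∀ k c {z} → 0ℚ ≤ z → survive k c z ≤ z
    survive-≤ k c {z} 0≤z with survive k c z | survive-cases k c z
    ... | _ | inj₁ refl = 0≤z
    ... | _ | inj₂ refl = ≤-refl

    survive-*≤1 : ∀ k c {z} y → z * y ≤ 1ℚ → survive k c z * y ≤ 1ℚ
    survive-*≤1 k c {z} y zy≤1 with survive k c z | survive-cases k c z
    ... | _ | inj₁ refl = subst (_≤ 1ℚ) (sym (*-zeroˡ y)) 0≤1
    ... | _ | inj₂ refl = zy≤1

    survive-distrib : ∀ k c a z → a * survive k c z ≡ survive k c (a * z)
    survive-distrib zero c a z = refl
    survive-distrib (suc c′) c a z with c′ Fin.≟ c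
    ... | yes _ = *-zeroʳ a
    ... | no _ = refl

    gain : (C → ℚ) → Outcome → ℚ
    gain f zero = 0ℚ
    gain f (suc c) = f c

    sum-survive : ∀ f k → sum (λ c → f c - survive k c (f c)) ≡ gain f k
    sum-survive f zero = sum-zero (λ c → +-inverseʳ (f c))
    sum-survive f (suc j) = sum-pick f j

    objectOf : Fin 4 → V → V → Object
    objectOf τ u v = combine τ (combine u v)

    level-objectOf : ∀ st τ u v → level st (objectOf τ u v) ≡ scale * drift st τ u v
    level-objectOf st τ u v = trans
      (cong (λ r → scale * drift st (proj₁ r) (proj₁ (remQuot {n} n (proj₂ r))) (proj₂ (remQuot {n} n (proj₂ r))))
        (Fin.remQuot-combine {4} {n ℕ.* n} τ (combine u v)))
      (cong (λ uv → scale * drift st τ (proj₁ uv) (proj₂ uv)) (Fin.remQuot-combine {n} {n} u v))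

    -- The sums are expressed through `drift`, and `small` confines every drift to `Within H`.
    -- Nothing else about the random-like choices is remembered, so no union bound over
    -- neighbourhoods arises.
    record Inv (h : List (Edge n)) (st : State) : Set where
      field
        w-nonNeg : ∀ x c → 0ℚ ≤ w st x c
        w≤A : ∀ x c → w st x c ≤ A
        balance : ∀ x c → w st x c * (1ℚ - κ * q st x c) ≤ 1ℚ
        q-nonNeg : ∀ x c → 0ℚ ≤ q st x c
        q≤ : ∀ x c → q st x c ≤ A * ι (deg st x)
        deg≤K : ∀ x → deg st x ℕ.≤ K
        sum-w : ∀ u v → sum (w st v) ≡ Δ + drift st 0F u v
        sum-ww : ∀ {u v} → u ≢ v → ¬ Joined h u v → sum (λ c → w st u c * w st v c) ≡ Δ + drift st 1F u v
        -- Unlike `sum-ww`, this covers joined pairs. It is needed when `u` gains a neighbour `y`: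
        -- then `sum-qw` grows by Σ w_y w_v, and `y` may already be joined to `v`. The arrival of
        -- the edge uv costs `2A²`, once, since edges do not repeat.
        sum-ww≤ : ∀ {u v} → u ≢ v → sum (λ c → w st u c * w st v c) ≤ Δ + drift st 1F u v + 2ℚ * A²
        -- Each neighbour of `u` contributes `Δ` plus two errors of size `H`: the drift of its
        -- product sum with `v`, and the correction `2A² ≤ H` for a joined pair.
        sum-qw : ∀ {u v} → u ≢ v → ¬ Joined h u v →
          sum (λ c → q st u c * w st v c) ≤ Δ * drift st 2F u v + ι (deg st u) * (Δ + 2ℚ * H)
        -- The constant 7 collects the errors of one new neighbour: `4dH` and `2ΔH` from twice the
        -- cross term, and `ΔA² ≤ ΔH/2` from the squares of the added weights.
        sum-qq : ∀ x → sum (λ c → q st x c * q st x c) ≤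
          ι (deg st x) * ι (deg st x) * Δ + (4ℚ + 3ℚ) * (ι (deg st x) * Δ * H)
        sum-q : ∀ x → ι (deg st x) * (Δ - H) ≤ sum (q st x)
        extras≤ : ∀ u v → ι (length (extras st v)) ≤ 2ℚ * e₀ * ι (deg st v) - drift st 3F u v
        small : potential st ≤ (1ℚ + ½) ^ N

      drift-within : ∀ τ u v → Within H (drift st τ u v)
      drift-within τ u v = ≤-from (2ℚ * H * (scale * y - - ½) + y * (1ℚ - 2ℚ * H * scale))
                             (0≤+ (0≤* (0≤* 0≤2 0≤H) (gap (proj₁ close))) (null (sym 2Hs≡1) y)) (lower H scale y)
                         , ≤-from (2ℚ * H * (½ - scale * y) + - y * (1ℚ - 2ℚ * H * scale))
                             (0≤+ (0≤* (0≤* 0≤2 0≤H) (gap (proj₂ close))) (null (sym 2Hs≡1) (- y))) (upper H scale y)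
        where
        y = drift st τ u v
        close : Within ½ (scale * y)
        close = subst (Within ½) (level-objectOf st τ u v) (Φ-confines {y = level st} {r = remaining (deg st)} small (objectOf τ u v))
        lower : ∀ H s y → y ≡ - H + (2ℚ * H * (s * y - - ½) + y * (1ℚ - 2ℚ * H * s))
        lower = solve-∀ ℚ-ring
        upper : ∀ H s y → H ≡ y + (2ℚ * H * (½ - s * y) + - y * (1ℚ - 2ℚ * H * s))
        upper = solve-∀ ℚ-ring

      d≤Δ : ∀ x → ι (deg st x) ≤ Δ
      d≤Δ x = ι-mono (deg≤K x)

      deviation : V → C → ℚ
      deviation x c = (q st x c - ι (deg st x)) * (q st x c - ι (deg st x))

      -- Upper second moment against lower first moment: after expanding the square the terms `d²Δ`
      -- cancel, leaving `7dΔH` from `sum-qq` and `2d²H` from `sum-q`, with `d ≤ Δ`.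
      sum-deviation : ∀ x → sum (deviation x) ≤ 9ℚ * (Δ * Δ * H)
      sum-deviation x = ≤-trans (≤-reflexive (begin-equality
        sum (deviation x)
          ≡⟨ sum-cong (λ c → expand (q st x c) d) ⟩
        sum (λ c → (1ℚ * (q st x c * q st x c) + - (2ℚ * d) * q st x c) + d * d)
          ≡⟨ sum-+ (λ c → 1ℚ * (q st x c * q st x c) + - (2ℚ * d) * q st x c) (λ _ → d * d) ⟩
        sum (λ c → 1ℚ * (q st x c * q st x c) + - (2ℚ * d) * q st x c) + sum {K} (λ _ → d * d)
          ≡⟨ cong₂ _+_ (sum-linear 1ℚ (- (2ℚ * d)) (λ c → q st x c * q st x c) (q st x)) (sum-const K (d * d)) ⟩
        1ℚ * sum (λ c → q st x c * q st x c) + - (2ℚ * d) * sum (q st x) + Δ * (d * d) ∎))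
        (bound (sum (λ c → q st x c * q st x c)) (sum (q st x)) (sum-qq x) (sum-q x))
        where
        open ≤-Reasoning
        d = ι (deg st x)
        expand : ∀ q d → (q - d) * (q - d) ≡ (1ℚ * (q * q) + - (2ℚ * d) * q) + d * d
        expand = solve-∀ ℚ-ring
        bound : ∀ T Q → T ≤ d * d * Δ + (4ℚ + 3ℚ) * (d * Δ * H) → d * (Δ - H) ≤ Q →
          1ℚ * T + - (2ℚ * d) * Q + Δ * (d * d) ≤ 9ℚ * (Δ * Δ * H)
        bound T Q T≤ Q≥ = ≤-from
          ((d * d * Δ + (4ℚ + 3ℚ) * (d * Δ * H) - T) + 2ℚ * d * (Q - d * (Δ - H))
            + (4ℚ + 3ℚ) * (Δ * H * (Δ - d)) + 2ℚ * (H * ((Δ - d) * (Δ + d))))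
          (0≤+ (0≤+ (0≤+ (gap T≤) (0≤* (0≤* 0≤2 0≤d) (gap Q≥)))
            (0≤* (nonNegative⁻¹ (4ℚ + 3ℚ)) (0≤* (0≤* 0≤Δ 0≤H) (gap (d≤Δ x)))))
            (0≤* 0≤2 (0≤* 0≤H (0≤* (gap (d≤Δ x)) (0≤+ 0≤Δ 0≤d)))))
          (lemma d Δ H T Q)
          where
          0≤d = ι-nonNeg (deg st x)
          lemma : ∀ d Δ H T Q → 9ℚ * (Δ * Δ * H) ≡ 1ℚ * T + - (2ℚ * d) * Q + Δ * (d * d) +
            ((d * d * Δ + (4ℚ + 3ℚ) * (d * Δ * H) - T) + 2ℚ * d * (Q - d * (Δ - H))
            + (4ℚ + 3ℚ) * (Δ * H * (Δ - d)) + 2ℚ * (H * ((Δ - d) * (Δ + d))))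
          lemma = solve-∀ ℚ-ring

    -- Preservation of the invariants by one arriving edge.

    module Advance {h : List (Edge n)} {st : State} (I : Inv h st) (s t : V) (s≢t : s ≢ t) (new : ¬ Joined h s t)
      (room : ∀ x → x ∈ₑ (s , t) → suc (deg st x) ℕ.≤ K) where

      open Inv I
      e : Edge n
      e = s , t
      open Arrival st e

      mate-∈ˡ : ∀ {x y} → mate e x ≡ just y → x ∈ₑ e
      mate-∈ˡ eq with mate-just {e = e} eq
      ... | inj₁ (x≡s , _) = inj₁ x≡s
      ... | inj₂ (x≡t , _) = inj₂ x≡t

      mate-≢ : ∀ {x y} → mate e x ≡ just y → x ≢ y
      mate-≢ eq x≡y with mate-just {e = e} eq
      ... | inj₁ (refl , refl) = s≢t x≡y
      ... | inj₂ (refl , refl) = s≢t (sym x≡y)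

      mate-new : ∀ {x y} → mate e x ≡ just y → ¬ Joined h x y
      mate-new eq joined with mate-just {e = e} eq
      ... | inj₁ (refl , refl) = new joined
      ... | inj₂ (refl , refl) = new (joined-sym joined)

      mate-other : ∀ {x y v} → mate e x ≡ just y → v ∈ₑ e → x ≢ v → y ≡ v
      mate-other eq v∈e x≢v with mate-just {e = e} eq | v∈e
      ... | inj₁ (x≡s , _) | inj₁ v≡s = contradiction (trans x≡s (sym v≡s)) x≢v
      ... | inj₁ (_ , y≡t) | inj₂ v≡t = trans y≡t (sym v≡t)
      ... | inj₂ (_ , y≡s) | inj₁ v≡s = trans y≡s (sym v≡s)
      ... | inj₂ (x≡t , _) | inj₂ v≡t = contradiction (trans x≡t (sym v≡t)) x≢v

      P-mate : ∀ {x y} c → mate e x ≡ just y → P c ≡ chance (w st x c) (w st y c)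
      P-mate c eq with mate-just {e = e} eq
      ... | inj₁ (refl , refl) = refl
      ... | inj₂ (refl , refl) = chance-comm (w st s c) (w st t c)

      P-nonNeg : ∀ c → 0ℚ ≤ P c
      P-nonNeg c = chance-nonNeg (w-nonNeg s c) (w-nonNeg t c)

      P≤½ : ∀ c → P c ≤ ½
      P≤½ c = chance≤½ (w-nonNeg s c) (w-nonNeg t c)

      bumped-nonNeg : ∀ x c → 0ℚ ≤ bumped x c
      bumped-nonNeg x c = bump-≥ (P≤½ c) (w-nonNeg x c)

      bumped≤A : ∀ {x y} c → mate e x ≡ just y → bumped x c ≤ A
      bumped≤A {x} {y} c eq = subst (λ p → w st x c * inv (1ℚ - p) ≤ A) (sym (P-mate c eq))
        (bump-chance (w-nonNeg x c) (w-nonNeg y c) (w≤A x c))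

      pair : ℚ
      pair = sum (λ c → w st s c * w st t c)

      pair≡ : pair ≡ Δ + drift st 1F s t
      pair≡ = sum-ww s≢t new

      S≤1 : sum P ≤ 1ℚ
      S≤1 = begin
        sum P                                       ≤⟨ sum-mono (λ c → chance≤ (w-nonNeg s c) (w-nonNeg t c)) ⟩
        sum (λ c → κ * (w st s c * w st t c))       ≡⟨ sum-* κ (λ c → w st s c * w st t c) ⟩
        κ * pair                                    ≤⟨ total≤1 (≤-trans (≤-reflexive pair≡) (+-monoʳ-≤ Δ (proj₂ (drift-within 1F s t)))) ⟩
        1ℚ                                          ∎
        where open ≤-Reasoning

      none≤ : prob zero ≤ 2ℚ * e₀
      none≤ = total≥ {S = sum P} (≤-trans (+-monoʳ-≤ Δ (proj₁ (drift-within 1F s t))) (≤-reflexive (sym pair≡)))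
        (sum-deviation s) (sum-deviation t) (begin
          κ * pair                                  ≡⟨ sum-* κ (λ c → w st s c * w st t c) ⟨
          sum (λ c → κ * (w st s c * w st t c))
            ≤⟨ sum-mono (λ c → chance-loss (w-nonNeg s c) (w-nonNeg t c) (w≤A s c) (w≤A t c) (d≤Δ s) (d≤Δ t) (balance s c) (balance t c)) ⟩
          sum (λ c → P c + lossRate * (deviation s c + deviation t c))
            ≡⟨ sum-+ P (λ c → lossRate * (deviation s c + deviation t c)) ⟩
          sum P + sum (λ c → lossRate * (deviation s c + deviation t c))
            ≡⟨ cong (sum P +_) (trans (sum-* lossRate (λ c → deviation s c + deviation t c))
                 (cong (lossRate *_) (sum-+ (deviation s) (deviation t)))) ⟩
          sum P + lossRate * (sum (deviation s) + sum (deviation t)) ∎)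
        where open ≤-Reasoning

      dist : Distribution prob
      dist = record
        { p-nonNeg = λ { zero → gap S≤1 ; (suc c) → P-nonNeg c }
        ; total = trans (sum-suc prob) (lemma (sum P)) }
        where
        lemma : ∀ x → 1ℚ - x + x ≡ 1ℚ
        lemma = solve-∀ ℚ-ring

      -- The common source of the three weight martingales: a change that is linear in the weights
      -- of one endpoint, with coefficients fixed during the step. Since `w = bumped · (1 - P)`,
      -- rescaling gains Σ P(c) f(c) in total, and drawing a colour loses exactly its own `f`, so
      -- the mean vanishes.
      linear-increment : ∀ {x y} (a : C → ℚ) → mate e x ≡ just y → (∀ c → 0ℚ ≤ a c) → (∀ c → a c ≤ A) →
        Centred prob A² (λ k → sum (λ c → a c * (survive k c (bumped x c) - w st x c)))
      linear-increment {x} a eq 0≤a a≤A = centred-cong (λ k → sym (shape k)) (centred-average dist gain-nonNeg gain≤)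
        where
        f : C → ℚ
        f c = a c * bumped x c
        gain-nonNeg : ∀ k → 0ℚ ≤ gain f k
        gain-nonNeg zero = ≤-refl
        gain-nonNeg (suc c) = 0≤* (0≤a c) (bumped-nonNeg x c)
        gain≤ : ∀ k → gain f k ≤ A²
        gain≤ zero = ≤-trans 0≤1 1≤A²
        gain≤ (suc c) = *-mono (0≤a c) (a≤A c) (bumped-nonNeg x c) (bumped≤A c eq)
        pointwise : ∀ k c → a c * (survive k c (bumped x c) - w st x c) ≡ P c * f c - (f c - survive k c (f c))
        pointwise k c = trans (cong (λ z → a c * (survive k c (bumped x c) - z)) (sym (bump-inverse (P≤½ c) (w st x c))))
          (trans (lemma (a c) (survive k c (bumped x c)) (bumped x c) (P c))
            (cong (λ z → P c * f c - (f c - z)) (survive-distrib k c (a c) (bumped x c))))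
          where
          lemma : ∀ a s b p → a * (s - b * (1ℚ - p)) ≡ p * (a * b) - (a * b - a * s)
          lemma = solve-∀ ℚ-ring
        shape : ∀ k → sum (λ c → a c * (survive k c (bumped x c) - w st x c)) ≡ sum (λ j → prob j * gain f j) - gain f k
        shape k = begin
          sum (λ c → a c * (survive k c (bumped x c) - w st x c))  ≡⟨ sum-cong (pointwise k) ⟩
          sum (λ c → P c * f c - (f c - survive k c (f c)))        ≡⟨ sum-minus (λ c → P c * f c) (λ c → f c - survive k c (f c)) ⟩
          sum (λ c → P c * f c) - sum (λ c → f c - survive k c (f c))
            ≡⟨ cong₂ _-_ (sym (trans (sum-suc (λ j → prob j * gain f j)) (trans (cong (_+ sum (λ c → P c * f c)) (*-zeroʳ (prob zero)))
                 (+-identityˡ (sum (λ c → P c * f c)))))) (sum-survive f k) ⟩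
          sum (λ j → prob j * gain f j) - gain f k                 ∎
          where open ≡-Reasoning

      mate-view : ∀ x → (∃ λ y → mate e x ≡ just y) ⊎ mate e x ≡ nothing
      mate-view x with mate e x
      ... | just y = inj₁ (y , refl)
      ... | nothing = inj₂ refl

      Touched : V → V → Set
      Touched u v = u ∈ₑ e ⊎ v ∈ₑ e

      Movement : Fin 4 → V → V → Set
      Movement τ u v = (∀ k → increment k τ u v ≡ 0ℚ) ⊎ (Centred prob A² (λ k → increment k τ u v) × Touched u v)

      δq-nonNeg : ∀ u c → 0ℚ ≤ δ * q st u c
      δq-nonNeg u c = 0≤* 0≤δ (q-nonNeg u c)

      δq≤A : ∀ u c → δ * q st u c ≤ A
      δq≤A u c = bound (q st u c) (ι (deg st u)) A 0≤A (q≤ u c) (d≤Δ u)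
        where
        bound : ∀ q d A → 0ℚ ≤ A → q ≤ A * d → d ≤ Δ → δ * q ≤ A
        bound q d A 0≤A q≤ d≤ = ≤-from (δ * (A * d - q) + A * (δ * (Δ - d)) + A * (1ℚ - Δ * δ))
          (0≤+ (0≤+ (0≤* 0≤δ (gap q≤)) (0≤* 0≤A (0≤* 0≤δ (gap d≤)))) (null (sym Δδ≡1) A))
          (lemma Δ δ q d A)
          where
          lemma : ∀ Δ δ q d A → A ≡ δ * q + (δ * (A * d - q) + A * (δ * (Δ - d)) + A * (1ℚ - Δ * δ))
          lemma = solve-∀ ℚ-ring

      movement : ∀ τ u v → Movement τ u v
      movement 0F u v with mate e v in eq
      ... | nothing = inj₁ λ k → sum-zero (λ c → +-inverseʳ (w st v c))
      ... | just _ = inj₂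
        ( centred-cong (λ k → sum-cong (λ c → *-identityˡ (survive k c (bumped v c) - w st v c)))
            (linear-increment (λ _ → 1ℚ) eq (λ _ → 0≤1) (λ _ → 1≤A))
        , inj₂ (mate-∈ˡ eq))
      movement 1F u v with mate e u in equ | mate e v in eqv
      ... | just _ | just _ = inj₁ λ k → refl
      ... | nothing | nothing = inj₁ λ k → sum-zero (λ c → +-inverseʳ (w st u c * w st v c))
      ... | just _ | nothing = inj₂
        ( centred-cong (λ k → sum-cong (λ c → lemma (survive k c (bumped u c)) (w st u c) (w st v c)))
            (linear-increment (w st v) equ (w-nonNeg v) (w≤A v))
        , inj₁ (mate-∈ˡ equ))
        where
        lemma : ∀ x y a → a * (x - y) ≡ x * a - y * a
        lemma = solve-∀ ℚ-ring
      ... | nothing | just _ = inj₂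
        ( centred-cong (λ k → sum-cong (λ c → lemma (survive k c (bumped v c)) (w st v c) (w st u c)))
            (linear-increment (w st u) eqv (w-nonNeg u) (w≤A u))
        , inj₂ (mate-∈ˡ eqv))
        where
        lemma : ∀ x y a → a * (x - y) ≡ a * x - a * y
        lemma = solve-∀ ℚ-ring
      movement 2F u v with mate e u | mate e v in eqv
      ... | just _ | _ = inj₁ λ k → refl
      ... | nothing | nothing = inj₁ λ k → sum-zero (λ c → trans (cong (δ * q st u c *_) (+-inverseʳ (w st v c))) (*-zeroʳ (δ * q st u c)))
      ... | nothing | just _ = inj₂ (linear-increment (λ c → δ * q st u c) eqv (δq-nonNeg u) (δq≤A u) , inj₂ (mate-∈ˡ eqv))
      movement 3F u v with mate e v in eqv
      ... | nothing = inj₁ λ k → refl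
      ... | just _ = inj₂
        ( centred-cong (λ k → cong (_- isNone k) none-mean)
            (centred-average dist (λ { zero → 0≤1 ; (suc _) → ≤-refl }) (λ { zero → 1≤A² ; (suc _) → ≤-trans 0≤1 1≤A² }))
        , inj₂ (mate-∈ˡ eqv))
        where
        none-mean : sum (λ k → prob k * isNone k) ≡ prob zero
        none-mean = trans (sum-suc (λ k → prob k * isNone k))
          (trans (cong₂ _+_ (*-identityʳ (prob zero)) (sum-zero (λ c → *-zeroʳ (P c)))) (+-identityʳ (prob zero)))

      deg′-just : ∀ {x y} → mate e x ≡ just y → deg′ x ≡ suc (deg st x)
      deg′-just eq rewrite eq = refl

      deg′-nothing : ∀ {x} → mate e x ≡ nothing → deg′ x ≡ deg st x
      deg′-nothing eq rewrite eq = refl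

      deg≤deg′ : ∀ x → deg st x ℕ.≤ deg′ x
      deg≤deg′ x with mate e x
      ... | nothing = ℕ.≤-refl
      ... | just _ = ℕ.n≤1+n (deg st x)

      room-drops : ∀ {x} → x ∈ₑ e → suc (K ℕ.∸ deg′ x) ℕ.≤ K ℕ.∸ deg st x
      room-drops {x} x∈e rewrite deg′-just (proj₂ (mate-∈ {e = e} x∈e)) = ℕ.≤-reflexive (sym (ℕ.+-∸-assoc 1 (room x x∈e)))

      touched-drops : ∀ {u v} → Touched u v → suc ((K ℕ.∸ deg′ u) ℕ.+ (K ℕ.∸ deg′ v)) ℕ.≤ (K ℕ.∸ deg st u) ℕ.+ (K ℕ.∸ deg st v)
      touched-drops {u} {v} (inj₁ u∈e) = ℕ.+-mono-≤ (room-drops u∈e) (ℕ.∸-monoʳ-≤ K (deg≤deg′ v))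
      touched-drops {u} {v} (inj₂ v∈e) = ℕ.≤-trans (ℕ.≤-reflexive (sym (ℕ.+-suc (K ℕ.∸ deg′ u) (K ℕ.∸ deg′ v))))
        (ℕ.+-mono-≤ (ℕ.∸-monoʳ-≤ K (deg≤deg′ u)) (room-drops v∈e))

      move : ∀ i → Move prob (λ k → scale * increment k (kind i) (left i) (right i)) (remaining (deg st) i) (remaining deg′ i)
      move i with movement (kind i) (left i) (right i)
      ... | inj₁ still = inj₁ ((λ k → trans (cong (scale *_) (still k)) (*-zeroʳ scale))
                              , ℕ.+-mono-≤ (ℕ.∸-monoʳ-≤ K (deg≤deg′ (left i))) (ℕ.∸-monoʳ-≤ K (deg≤deg′ (right i))))
      ... | inj₂ (centred , touched) = inj₂ (centred-scale scale 0≤scale centred , touched-drops touched)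

      next-potential : ∀ k → potential (next k) ≡
        Φ (λ i → level st i + scale * increment k (kind i) (left i) (right i)) (remaining deg′)
      next-potential k = sum-cong λ i → cong (λ y → term y (remaining deg′ i))
        (*-distribˡ-+ scale (drift st (kind i) (left i) (right i)) (increment k (kind i) (left i) (right i)))

      acceptable : ∃ (Acceptable st e)
      acceptable = proj₁ found , proj₁ (proj₂ found) , ≤-trans (≤-reflexive (next-potential (proj₁ found))) (proj₂ (proj₂ found))
        where
        found = descent dist {y = level st} {x = λ i k → scale * increment k (kind i) (left i) (right i)}
          {r = remaining (deg st)} {r′ = remaining deg′} (Φ-confines {y = level st} {r = remaining (deg st)} small) move

      step-small : potential (step st e) ≤ (1ℚ + ½) ^ N
      step-small = ≤-trans (proj₂ (choose-acceptable st e acceptable)) small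

      w′-nothing : ∀ k x c → mate e x ≡ nothing → w′ k x c ≡ w st x c
      w′-nothing k x c eq rewrite eq = refl

      w′-just : ∀ k x c {y} → mate e x ≡ just y → w′ k x c ≡ survive k c (bumped x c)
      w′-just k x c eq rewrite eq = refl

      q′-nothing : ∀ x c → mate e x ≡ nothing → q′ x c ≡ q st x c
      q′-nothing x c eq rewrite eq = refl

      q′-just : ∀ x c {y} → mate e x ≡ just y → q′ x c ≡ q st x c + w st y c
      q′-just x c eq rewrite eq = refl

      by-mate : ∀ x {R : Set} → (∀ y → mate e x ≡ just y → R) → (mate e x ≡ nothing → R) → R
      by-mate x matched free with mate-view x
      ... | inj₁ (y , eq) = matched y eq
      ... | inj₂ eq = free eq

      w′-nonNeg : ∀ k x c → 0ℚ ≤ w′ k x c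
      w′-nonNeg k x c = by-mate x
        (λ y eq → subst (0ℚ ≤_) (sym (w′-just k x c eq)) (survive-nonNeg k c (bumped-nonNeg x c)))
        (λ eq → subst (0ℚ ≤_) (sym (w′-nothing k x c eq)) (w-nonNeg x c))

      w′≤bumped : ∀ {k x y} c → mate e x ≡ just y → w′ k x c ≤ bumped x c
      w′≤bumped {k} {x} c eq = subst (_≤ bumped x c) (sym (w′-just k x c eq)) (survive-≤ k c (bumped-nonNeg x c))

      w′≤A : ∀ k x c → w′ k x c ≤ A
      w′≤A k x c = by-mate x
        (λ y eq → ≤-trans (w′≤bumped {k} c eq) (bumped≤A c eq))
        (λ eq → subst (_≤ A) (sym (w′-nothing k x c eq)) (w≤A x c))

      balance′ : ∀ k x c → w′ k x c * (1ℚ - κ * q′ x c) ≤ 1ℚ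
      balance′ k x c = by-mate x
        (λ y eq → subst₂ (λ a b → a * (1ℚ - κ * b) ≤ 1ℚ) (sym (w′-just k x c eq)) (sym (q′-just x c eq))
          (survive-*≤1 k c (1ℚ - κ * (q st x c + w st y c))
            (bump-balance (P≤½ c) {w st x c} {w st y c} {q st x c} (subst (_≤ κ * (w st x c * w st y c)) (sym (P-mate c eq)) (chance≤ (w-nonNeg x c) (w-nonNeg y c)))
              (balance x c))))
        (λ eq → subst₂ (λ a b → a * (1ℚ - κ * b) ≤ 1ℚ) (sym (w′-nothing k x c eq)) (sym (q′-nothing x c eq)) (balance x c))

      q′-nonNeg : ∀ x c → 0ℚ ≤ q′ x c
      q′-nonNeg x c = by-mate x
        (λ y eq → subst (0ℚ ≤_) (sym (q′-just x c eq)) (0≤+ (q-nonNeg x c) (w-nonNeg y c)))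
        (λ eq → subst (0ℚ ≤_) (sym (q′-nothing x c eq)) (q-nonNeg x c))

      q′≤ : ∀ x c → q′ x c ≤ A * ι (deg′ x)
      q′≤ x c = by-mate x
        (λ y eq → subst₂ (λ a d → a ≤ A * ι d) (sym (q′-just x c eq)) (sym (deg′-just eq))
          (subst (q st x c + w st y c ≤_) (lemma A (ι (deg st x))) (+-mono-≤ (q≤ x c) (w≤A y c))))
        (λ eq → subst₂ (λ a d → a ≤ A * ι d) (sym (q′-nothing x c eq)) (sym (deg′-nothing eq)) (q≤ x c))
        where
        lemma : ∀ A d → A * d + A ≡ A * (1ℚ + d)
        lemma = solve-∀ ℚ-ring

      deg′≤K : ∀ x → deg′ x ℕ.≤ K
      deg′≤K x = by-mate x
        (λ y eq → subst (ℕ._≤ K) (sym (deg′-just eq)) (room x (mate-∈ˡ eq)))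
        (λ eq → subst (ℕ._≤ K) (sym (deg′-nothing eq)) (deg≤K x))

      sum-w′ : ∀ k u v → sum (w′ k v) ≡ Δ + (drift st 0F u v + increment k 0F u v)
      sum-w′ k u v = trans (sum-shift (w st v) (w′ k v))
        (trans (cong (_+ increment k 0F u v) (sum-w u v)) (+-assoc Δ (drift st 0F u v) (increment k 0F u v)))

      still-joined : ∀ {u v} → Joined h u v → Joined (h ++ e ∷ []) u v
      still-joined = ++⁺ˡ

      now-joined : ∀ {u v} → mate e u ≡ just v → Joined (h ++ e ∷ []) u v
      now-joined eq = ++⁺ʳ h (here (mate-just eq))

      increment-ww : ∀ k u v → mate e u ≡ nothing ⊎ mate e v ≡ nothing →
        increment k 1F u v ≡ sum (λ c → w′ k u c * w′ k v c - w st u c * w st v c)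
      increment-ww k u v (inj₁ eq) rewrite eq = refl
      increment-ww k u v (inj₂ eq) rewrite eq with mate e u
      ... | just _ = refl
      ... | nothing = refl

      increment-ww-matched : ∀ k {u v y z} → mate e u ≡ just y → mate e v ≡ just z → increment k 1F u v ≡ 0ℚ
      increment-ww-matched k equ eqv rewrite equ | eqv = refl

      Apart : V → V → Set
      Apart u v = mate e u ≡ nothing ⊎ mate e v ≡ nothing

      matched-or-apart : ∀ {u v} → u ≢ v → (mate e u ≡ just v × ∃ λ z → mate e v ≡ just z) ⊎ Apart u v
      matched-or-apart {u} {v} u≢v = by-mate u
        (λ y equ → by-mate v
          (λ z eqv → inj₁ (trans equ (cong just (mate-other equ (mate-∈ˡ eqv) u≢v)) , z , eqv))
          (λ eqv → inj₂ (inj₂ eqv)))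
        (λ equ → inj₂ (inj₁ equ))

      ww-shift : ∀ k {u v} → Apart u v → sum (λ c → w′ k u c * w′ k v c) ≡ sum (λ c → w st u c * w st v c) + increment k 1F u v
      ww-shift k {u} {v} apart = trans (sum-shift (λ c → w st u c * w st v c) (λ c → w′ k u c * w′ k v c))
        (cong (sum (λ c → w st u c * w st v c) +_) (sym (increment-ww k u v apart)))

      sum-ww′ : ∀ k {u v} → u ≢ v → ¬ Joined (h ++ e ∷ []) u v →
        sum (λ c → w′ k u c * w′ k v c) ≡ Δ + (drift st 1F u v + increment k 1F u v)
      sum-ww′ k {u} {v} u≢v unjoined with matched-or-apart u≢v
      ... | inj₁ (matched , _) = contradiction (now-joined matched) unjoined
      ... | inj₂ apart = trans (ww-shift k apart)
        (trans (cong (_+ increment k 1F u v) (sum-ww u≢v (λ j → unjoined (still-joined j))))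
          (+-assoc Δ (drift st 1F u v) (increment k 1F u v)))

      sum-ww≤′ : ∀ k {u v} → u ≢ v →
        sum (λ c → w′ k u c * w′ k v c) ≤ Δ + (drift st 1F u v + increment k 1F u v) + 2ℚ * A²
      sum-ww≤′ k {u} {v} u≢v with matched-or-apart u≢v
      ... | inj₂ apart = subst₂ _≤_ (sym (ww-shift k apart)) (lemma Δ (drift st 1F u v) (2ℚ * A²) (increment k 1F u v))
        (+-monoˡ-≤ (increment k 1F u v) (sum-ww≤ u≢v))
        where
        lemma : ∀ Δ d a i → Δ + d + a + i ≡ Δ + (d + i) + a
        lemma = solve-∀ ℚ-ring
      -- The edge uv itself arrives and both weights are rescaled. Even without a loss, the product
      -- for colour `c` grows by at most `2A² P(c)`, and the chances add up to at most 1.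
      ... | inj₁ (equ , z , eqv) = begin
        sum (λ c → w′ k u c * w′ k v c)
          ≤⟨ sum-mono pointwise ⟩
        sum (λ c → w st u c * w st v c + 2ℚ * A² * P c)
          ≡⟨ trans (sum-+ (λ c → w st u c * w st v c) (λ c → 2ℚ * A² * P c)) (cong₂ _+_ (sum-ww u≢v (mate-new equ)) (sum-* (2ℚ * A²) P)) ⟩
        Δ + drift st 1F u v + 2ℚ * A² * sum P
          ≤⟨ +-monoʳ-≤ (Δ + drift st 1F u v) (*-≤1 (0≤* 0≤2 (0≤² A)) S≤1) ⟩
        Δ + drift st 1F u v + 2ℚ * A²
          ≡⟨ cong (λ x → Δ + x + 2ℚ * A²) (sym (trans (cong (drift st 1F u v +_) (increment-ww-matched k equ eqv)) (+-identityʳ (drift st 1F u v)))) ⟩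
        Δ + (drift st 1F u v + increment k 1F u v) + 2ℚ * A² ∎
        where
        open ≤-Reasoning
        bound : ∀ a b p x y → 0ℚ ≤ p → 0ℚ ≤ a → 0ℚ ≤ b → a ≤ A → b ≤ A → x ≡ a * (1ℚ - p) → y ≡ b * (1ℚ - p) →
          a * b ≤ x * y + 2ℚ * A² * p
        bound a b p x y 0≤p 0≤a 0≤b a≤A b≤A refl refl = ≤-from
          (a * b * (p * p) + 2ℚ * p * (A² - a * b))
          (0≤+ (0≤* (0≤* 0≤a 0≤b) (0≤² p)) (0≤* (0≤* 0≤2 0≤p) (gap (*-mono 0≤a a≤A 0≤b b≤A))))
          (lemma a b p A²)
          where
          lemma : ∀ a b p A² → a * (1ℚ - p) * (b * (1ℚ - p)) + 2ℚ * A² * p ≡ a * b + (a * b * (p * p) + 2ℚ * p * (A² - a * b))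
          lemma = solve-∀ ℚ-ring
        pointwise : ∀ c → w′ k u c * w′ k v c ≤ w st u c * w st v c + 2ℚ * A² * P c
        pointwise c = ≤-trans
          (*-mono (w′-nonNeg k u c) (w′≤bumped {k} c equ) (w′-nonNeg k v c) (w′≤bumped {k} c eqv))
          (bound (bumped u c) (bumped v c) (P c) (w st u c) (w st v c) (P-nonNeg c) (bumped-nonNeg u c) (bumped-nonNeg v c)
            (bumped≤A c equ) (bumped≤A c eqv) (sym (bump-inverse (P≤½ c) (w st u c))) (sym (bump-inverse (P≤½ c) (w st v c))))

      increment-qw-matched : ∀ k {u v y} → mate e u ≡ just y → increment k 2F u v ≡ 0ℚ
      increment-qw-matched k equ rewrite equ = refl

      increment-qw : ∀ k {u v} → mate e u ≡ nothing → increment k 2F u v ≡ sum (λ c → δ * q st u c * (w′ k v c - w st v c))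
      increment-qw k equ rewrite equ = refl

      qw-shift : ∀ k {u v} → mate e u ≡ nothing →
        sum (λ c → q′ u c * w′ k v c) ≡ sum (λ c → q st u c * w st v c) + Δ * increment k 2F u v
      qw-shift k {u} {v} equ = begin
        sum (λ c → q′ u c * w′ k v c)     ≡⟨ sum-cong (λ c → cong (_* w′ k v c) (q′-nothing u c equ)) ⟩
        sum (λ c → q st u c * w′ k v c)   ≡⟨ sum-shift (λ c → q st u c * w st v c) (λ c → q st u c * w′ k v c) ⟩
        R + sum (λ c → q st u c * w′ k v c - q st u c * w st v c)
          ≡⟨ cong (R +_) (sum-cong λ c → trans (one (q st u c * w′ k v c - q st u c * w st v c))
               (trans (cong (_* (q st u c * w′ k v c - q st u c * w st v c)) (sym Δδ≡1)) (lemma Δ δ (q st u c) (w′ k v c) (w st v c)))) ⟩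
        R + sum (λ c → Δ * (δ * q st u c * (w′ k v c - w st v c)))
          ≡⟨ cong (R +_) (trans (sum-* Δ (λ c → δ * q st u c * (w′ k v c - w st v c))) (cong (Δ *_) (sym (increment-qw k equ)))) ⟩
        R + Δ * increment k 2F u v ∎
        where
        open ≡-Reasoning
        R = sum (λ c → q st u c * w st v c)
        one : ∀ x → x ≡ 1ℚ * x
        one = solve-∀ ℚ-ring
        lemma : ∀ Δ δ q w′ w → Δ * δ * (q * w′ - q * w) ≡ Δ * (δ * q * (w′ - w))
        lemma = solve-∀ ℚ-ring

      sum-qw′ : ∀ k {u v} → u ≢ v → ¬ Joined (h ++ e ∷ []) u v →
        sum (λ c → q′ u c * w′ k v c) ≤ Δ * (drift st 2F u v + increment k 2F u v) + ι (deg′ u) * (Δ + 2ℚ * H)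
      sum-qw′ k {u} {v} u≢v unjoined = by-mate u matched free
        where
        open ≤-Reasoning
        old = sum-qw u≢v (λ j → unjoined (still-joined j))
        D = drift st 2F u v
        free : mate e u ≡ nothing → _
        free equ = begin
          sum (λ c → q′ u c * w′ k v c)                                        ≡⟨ qw-shift k equ ⟩
          sum (λ c → q st u c * w st v c) + Δ * increment k 2F u v             ≤⟨ +-monoˡ-≤ (Δ * increment k 2F u v) old ⟩
          Δ * D + ι (deg st u) * (Δ + 2ℚ * H) + Δ * increment k 2F u v         ≡⟨ lemma Δ D (ι (deg st u) * (Δ + 2ℚ * H)) (increment k 2F u v) ⟩
          Δ * (D + increment k 2F u v) + ι (deg st u) * (Δ + 2ℚ * H)           ≡⟨ cong (λ d → Δ * (D + increment k 2F u v) + ι d * (Δ + 2ℚ * H)) (deg′-nothing equ) ⟨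
          Δ * (D + increment k 2F u v) + ι (deg′ u) * (Δ + 2ℚ * H)             ∎
          where
          lemma : ∀ Δ D r i → Δ * D + r + Δ * i ≡ Δ * (D + i) + r
          lemma = solve-∀ ℚ-ring
        matched : ∀ y → mate e u ≡ just y → _
        -- The new neighbour `y` differs from `v`, as otherwise uv would now be joined. So the edge
        -- misses `v`: its weights stay fixed and only `q u` grows.
        matched y equ = begin
          sum (λ c → q′ u c * w′ k v c)
            ≡⟨ sum-cong (λ c → trans (cong₂ _*_ (q′-just u c equ) (w′-nothing k v c eqv)) (*-distribʳ-+ (w st v c) (q st u c) (w st y c))) ⟩
          sum (λ c → q st u c * w st v c + w st y c * w st v c)
            ≡⟨ sum-+ (λ c → q st u c * w st v c) (λ c → w st y c * w st v c) ⟩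
          sum (λ c → q st u c * w st v c) + sum (λ c → w st y c * w st v c)
            ≤⟨ +-mono-≤ old (≤-trans (sum-ww≤ y≢v) (+-mono-≤ (+-monoʳ-≤ Δ (proj₂ (drift-within 1F y v))) bulk)) ⟩
          Δ * D + ι (deg st u) * (Δ + 2ℚ * H) + (Δ + H + H)
            ≡⟨ lemma Δ D H (ι (deg st u)) ⟩
          Δ * (D + 0ℚ) + (1ℚ + ι (deg st u)) * (Δ + 2ℚ * H)
            ≡⟨ cong₂ (λ i d → Δ * (D + i) + ι d * (Δ + 2ℚ * H)) (increment-qw-matched k {u} {v} equ) (deg′-just equ) ⟨
          Δ * (D + increment k 2F u v) + ι (deg′ u) * (Δ + 2ℚ * H) ∎
          where
          y≢v : y ≢ v
          y≢v refl = unjoined (now-joined equ)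
          eqv : mate e v ≡ nothing
          eqv = by-mate v (λ z eq → contradiction (mate-other equ (mate-∈ˡ eq) u≢v) y≢v) (λ eq → eq)
          lemma : ∀ Δ D H d → Δ * D + d * (Δ + 2ℚ * H) + (Δ + H + H) ≡ Δ * (D + 0ℚ) + (1ℚ + d) * (Δ + 2ℚ * H)
          lemma = solve-∀ ℚ-ring

      sum-qq′ : ∀ x → sum (λ c → q′ x c * q′ x c) ≤ ι (deg′ x) * ι (deg′ x) * Δ + (4ℚ + 3ℚ) * (ι (deg′ x) * Δ * H)
      sum-qq′ x = by-mate x matched
        (λ eq → subst₂ (λ l d → l ≤ ι d * ι d * Δ + (4ℚ + 3ℚ) * (ι d * Δ * H))
          (sum-cong (λ c → sym (cong₂ _*_ (q′-nothing x c eq) (q′-nothing x c eq)))) (sym (deg′-nothing eq)) (sum-qq x))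
        where
        open ≤-Reasoning
        d = ι (deg st x)
        matched : ∀ y → mate e x ≡ just y → _
        matched y eq = begin
          sum (λ c → q′ x c * q′ x c)
            ≡⟨ sum-cong (λ c → trans (cong₂ _*_ (q′-just x c eq) (q′-just x c eq)) (square (q st x c) (w st y c))) ⟩
          sum (λ c → (1ℚ * (q st x c * q st x c) + 2ℚ * (q st x c * w st y c)) + w st y c * w st y c)
            ≡⟨ trans (sum-+ (λ c → 1ℚ * (q st x c * q st x c) + 2ℚ * (q st x c * w st y c)) (λ c → w st y c * w st y c))
                 (cong (_+ sum (λ c → w st y c * w st y c)) (sum-linear 1ℚ 2ℚ (λ c → q st x c * q st x c) (λ c → q st x c * w st y c))) ⟩
          1ℚ * sum (λ c → q st x c * q st x c) + 2ℚ * sum (λ c → q st x c * w st y c) + sum (λ c → w st y c * w st y c)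
            -- The cross term is `sum-qw` for the very pair `x`, `y` that is being joined; it may be
            -- used because it refers to the moment before the arrival. For the squares of the new
            -- weights the crude bound `A²` is enough.
            ≤⟨ +-mono-≤ (+-mono-≤ (*-monoˡ 0≤1 (sum-qq x)) (*-monoˡ 0≤2 (sum-qw (mate-≢ eq) (mate-new eq))))
                 (≤-trans (sum-mono (λ c → *-mono (w-nonNeg y c) (w≤A y c) (w-nonNeg y c) (w≤A y c))) (≤-reflexive (sum-const K A²))) ⟩
          1ℚ * (d * d * Δ + (4ℚ + 3ℚ) * (d * Δ * H)) + 2ℚ * (Δ * drift st 2F x y + d * (Δ + 2ℚ * H)) + Δ * A²
            ≤⟨ bound A² (drift st 2F x y) (0≤² A) bulk (proj₂ (drift-within 2F x y)) ⟩
          (1ℚ + d) * (1ℚ + d) * Δ + (4ℚ + 3ℚ) * ((1ℚ + d) * Δ * H)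
            ≡⟨ cong (λ d → ι d * ι d * Δ + (4ℚ + 3ℚ) * (ι d * Δ * H)) (deg′-just eq) ⟨
          ι (deg′ x) * ι (deg′ x) * Δ + (4ℚ + 3ℚ) * (ι (deg′ x) * Δ * H) ∎
          where
          square : ∀ q w → (q + w) * (q + w) ≡ (1ℚ * (q * q) + 2ℚ * (q * w)) + w * w
          square = solve-∀ ℚ-ring
          bound : ∀ a r → 0ℚ ≤ a → 2ℚ * a ≤ H → r ≤ H →
            1ℚ * (d * d * Δ + (4ℚ + 3ℚ) * (d * Δ * H)) + 2ℚ * (Δ * r + d * (Δ + 2ℚ * H)) + Δ * a
              ≤ (1ℚ + d) * (1ℚ + d) * Δ + (4ℚ + 3ℚ) * ((1ℚ + d) * Δ * H)
          bound a r 0≤a 2a≤H r≤H = ≤-from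
            (Δ + 2ℚ * (Δ * (H - r)) + 4ℚ * (H * (Δ - d)) + Δ * ((H - 2ℚ * a) + a))
            (0≤+ (0≤+ (0≤+ 0≤Δ (0≤* 0≤2 (0≤* 0≤Δ (gap r≤H)))) (0≤* (0≤+ 0≤2 0≤2) (0≤* 0≤H (gap (d≤Δ x)))))
              (0≤* 0≤Δ (0≤+ (gap 2a≤H) 0≤a)))
            (lemma Δ H d a r)
            where
            lemma : ∀ Δ H d a r → (1ℚ + d) * (1ℚ + d) * Δ + (4ℚ + 3ℚ) * ((1ℚ + d) * Δ * H) ≡
              1ℚ * (d * d * Δ + (4ℚ + 3ℚ) * (d * Δ * H)) + 2ℚ * (Δ * r + d * (Δ + 2ℚ * H)) + Δ * a +
              (Δ + 2ℚ * (Δ * (H - r)) + 4ℚ * (H * (Δ - d)) + Δ * ((H - 2ℚ * a) + a))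
            lemma = solve-∀ ℚ-ring

      sum-q′ : ∀ x → ι (deg′ x) * (Δ - H) ≤ sum (q′ x)
      sum-q′ x = by-mate x
        (λ y eq → subst₂ (λ d r → ι d * (Δ - H) ≤ r) (sym (deg′-just eq))
          (trans (sym (sum-+ (q st x) (w st y))) (sum-cong (λ c → sym (q′-just x c eq))))
          (≤-trans (≤-reflexive (lemma (ι (deg st x)) Δ H))
            (+-mono-≤ (sum-q x) (≤-trans (+-monoʳ-≤ Δ (proj₁ (drift-within 0F x y))) (≤-reflexive (sym (sum-w x y)))))))
        (λ eq → subst₂ (λ d r → ι d * (Δ - H) ≤ r) (sym (deg′-nothing eq)) (sum-cong (λ c → sym (q′-nothing x c eq))) (sum-q x))
        where
        lemma : ∀ d Δ H → (1ℚ + d) * (Δ - H) ≡ d * (Δ - H) + (Δ - H)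
        lemma = solve-∀ ℚ-ring

      extras-just : ∀ k {x y} → mate e x ≡ just y → ι (length (extras′ k x)) ≡ ι (length (extras st x)) + isNone k
      extras-just zero {x} eq rewrite eq = +-comm 1ℚ (ι (length (extras st x)))
      extras-just (suc _) {x} eq = sym (+-identityʳ (ι (length (extras st x))))

      extras-nothing : ∀ k {x} → mate e x ≡ nothing → length (extras′ k x) ≡ length (extras st x)
      extras-nothing zero eq rewrite eq = refl
      extras-nothing (suc _) eq = refl

      increment-none-just : ∀ k {u x y} → mate e x ≡ just y → increment k 3F u x ≡ prob zero - isNone k
      increment-none-just k eq rewrite eq = refl

      increment-none-nothing : ∀ k {u x} → mate e x ≡ nothing → increment k 3F u x ≡ 0ℚ
      increment-none-nothing k eq rewrite eq = refl

      extras≤′ : ∀ k u v → ι (length (extras′ k v)) ≤ 2ℚ * e₀ * ι (deg′ v) - (drift st 3F u v + increment k 3F u v)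
      extras≤′ k u v = by-mate v
        (λ y eq → subst₂ _≤_ (sym (extras-just k eq))
          (cong₂ (λ d i → 2ℚ * e₀ * ι d - (drift st 3F u v + i)) (sym (deg′-just eq)) (sym (increment-none-just k {u} eq)))
          (bound (ι (length (extras st v))) (isNone k) (drift st 3F u v) (ι (deg st v)) (prob zero) (extras≤ u v) none≤))
        (λ eq → subst₂ _≤_ (cong ι (sym (extras-nothing k eq)))
          (cong₂ (λ d i → 2ℚ * e₀ * ι d - i) (sym (deg′-nothing eq))
            (sym (trans (cong (drift st 3F u v +_) (increment-none-nothing k {u} eq)) (+-identityʳ (drift st 3F u v)))))
          (extras≤ u v))
        where
        bound : ∀ l o r d p → l ≤ 2ℚ * e₀ * d - r → p ≤ 2ℚ * e₀ → l + o ≤ 2ℚ * e₀ * (1ℚ + d) - (r + (p - o))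
        bound l o r d p l≤ p≤ = ≤-from ((2ℚ * e₀ * d - r - l) + (2ℚ * e₀ - p)) (0≤+ (gap l≤) (gap p≤))
          (lemma e₀ l o r d p)
          where
          lemma : ∀ e l o r d p → 2ℚ * e * (1ℚ + d) - (r + (p - o)) ≡ l + o + ((2ℚ * e * d - r - l) + (2ℚ * e - p))
          lemma = solve-∀ ℚ-ring

      inv-step : Inv (h ++ e ∷ []) (step st e)
      inv-step = record
        { w-nonNeg = w′-nonNeg k
        ; w≤A = w′≤A k
        ; balance = balance′ k
        ; q-nonNeg = q′-nonNeg
        ; q≤ = q′≤
        ; deg≤K = deg′≤K
        ; sum-w = sum-w′ k
        ; sum-ww = sum-ww′ k
        ; sum-ww≤ = sum-ww≤′ k
        ; sum-qw = sum-qw′ k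
        ; sum-qq = sum-qq′
        ; sum-q = sum-q′
        ; extras≤ = extras≤′ k
        ; small = step-small
        }
        where k = choose st e

    initial-inv : potential initial ≤ (1ℚ + ½) ^ N → Inv [] initial
    initial-inv small = record
      { w-nonNeg = λ _ _ → 0≤1
      ; w≤A = λ _ _ → 1≤A
      ; balance = λ _ _ → ≤-reflexive (lemma₁ κ)
      ; q-nonNeg = λ _ _ → ≤-refl
      ; q≤ = λ _ _ → ≤-reflexive (sym (*-zeroʳ A))
      ; deg≤K = λ _ → ℕ.z≤n
      ; sum-w = λ _ _ → sum-ones
      ; sum-ww = λ _ _ → trans (sum-cong (λ _ → *-identityˡ 1ℚ)) sum-ones
      ; sum-ww≤ = λ _ → ≤-trans (≤-reflexive (trans (sum-cong (λ _ → *-identityˡ 1ℚ)) sum-ones))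
          (≤-from (2ℚ * A²) (0≤* 0≤2 (0≤² A)) refl)
      ; sum-qw = λ _ _ → ≤-reflexive (trans (sum-zero (λ _ → *-zeroˡ 1ℚ)) (lemma₂ Δ H))
      ; sum-qq = λ _ → ≤-reflexive (trans (sum-zero (λ _ → *-zeroˡ 0ℚ)) (lemma₃ Δ H))
      ; sum-q = λ _ → ≤-reflexive (trans (*-zeroˡ (Δ - H)) (sym (sum-zero (λ _ → refl))))
      ; extras≤ = λ _ _ → ≤-reflexive (lemma₄ e₀)
      ; small = small
      }
      where
      sum-ones : sum {K} (λ _ → 1ℚ) ≡ Δ + 0ℚ
      sum-ones = trans (sum-const K 1ℚ) (trans (*-identityʳ Δ) (sym (+-identityʳ Δ)))
      lemma₁ : ∀ κ → 1ℚ * (1ℚ - κ * 0ℚ) ≡ 1ℚ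
      lemma₁ = solve-∀ ℚ-ring
      lemma₂ : ∀ Δ H → 0ℚ ≡ Δ * 0ℚ + 0ℚ * (Δ + 2ℚ * H)
      lemma₂ = solve-∀ ℚ-ring
      lemma₃ : ∀ Δ H → 0ℚ ≡ 0ℚ * 0ℚ * Δ + (4ℚ + 3ℚ) * (0ℚ * Δ * H)
      lemma₃ = solve-∀ ℚ-ring
      lemma₄ : ∀ e → 0ℚ ≡ 2ℚ * e * 0ℚ - 0ℚ
      lemma₄ = solve-∀ ℚ-ring

    -- At most `2εΔ` extra colours from the accumulated failure probabilities, plus a deviation
    -- `H ≤ εΔ`; multiplying by `m` makes this a statement about integers.
    extras-bound : ∀ {h st} → Inv h st → ∀ x → ι (length (extras st x)) * m ≤ 3ℚ * Δ
    extras-bound {st = st} I x = bound (ι (length (extras st x))) (drift st 3F x x) (ι (deg st x)) (extras≤ x x) (proj₁ (drift-within 3F x x)) (d≤Δ x)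
      where
      open Inv I
      bound : ∀ l r d → l ≤ 2ℚ * e₀ * d - r → - H ≤ r → d ≤ Δ → l * m ≤ 3ℚ * Δ
      bound l r d l≤ -H≤r d≤ = ≤-from
        (m * ((2ℚ * e₀ * d - r - l) + (r - - H) + (e₀ * Δ - H) + 2ℚ * e₀ * (Δ - d)) + 3ℚ * Δ * (1ℚ - e₀ * m))
        (0≤+ (0≤* 0≤m (0≤+ (0≤+ (0≤+ (gap l≤) (gap -H≤r)) (gap H≤eΔ)) (0≤* (0≤* 0≤2 0≤e) (gap d≤)))) (null (sym em≡1) (3ℚ * Δ)))
        (lemma m e₀ Δ H l r d)
        where
        lemma : ∀ m e Δ H l r d → 3ℚ * Δ ≡ l * m +
          (m * ((2ℚ * e * d - r - l) + (r - - H) + (e * Δ - H) + 2ℚ * e * (Δ - d)) + 3ℚ * Δ * (1ℚ - e * m))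
        lemma = solve-∀ ℚ-ring

-- Counting colours along a run.

module Runs where

  open import Data.Fin as Fin using (Fin; zero; suc; toℕ; fromℕ<)
  import Data.Fin.Properties as Fin
  open import Data.List using (List; []; _∷_; _++_; length; lookup; map)
  open import Data.List.Membership.Propositional using (_∈_; find)
  open import Data.List.Membership.Propositional.Properties using (∈-++⁻; ∈-lookup)
  open import Data.List.Properties using (length-++)
  open import Data.List.Relation.Unary.All as All using (All; []; _∷_)
  import Data.List.Relation.Unary.All.Properties as All
  open import Data.List.Relation.Unary.AllPairs using (AllPairs; []; _∷_)
  open import Data.List.Relation.Unary.Any using (here; there)
  open import Data.List.Relation.Unary.Unique.DecPropositional.Properties using (deduplicate-!)
  open import Data.Maybe using (just; nothing; maybe′)
  open import Data.Nat using (ℕ; zero; suc; _+_; _≤_; _<_; s≤s)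
  open import Data.Nat.Properties
  open import Data.Product using (_×_; _,_; proj₁; proj₂)
  open import Data.Sum using (inj₁; inj₂)
  open import Relation.Binary.PropositionalEquality
  open import Relation.Nullary using (¬_; yes; no; contradiction)
  open import Data.Rational using (ℚ)
  open Colouring
  open Invariants

  sameEdge-sym : ∀ {n} {e f : Edge n} → SameEdge e f → SameEdge f e
  sameEdge-sym (inj₁ (p , q)) = inj₁ (sym p , sym q)
  sameEdge-sym (inj₂ (p , q)) = inj₂ (sym q , sym p)

  lookups⇒All : ∀ {A : Set} {P : A → Set} (xs : List A) → (∀ i → P (lookup xs i)) → All P xs
  lookups⇒All [] p = []
  lookups⇒All (x ∷ xs) p = p zero ∷ lookups⇒All xs (λ i → p (suc i))

  lookups⇒AllPairs : ∀ {A : Set} {R : A → A → Set} (xs : List A) →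
    (∀ i j → i ≢ j → R (lookup xs i) (lookup xs j)) → AllPairs R xs
  lookups⇒AllPairs [] r = []
  lookups⇒AllPairs (x ∷ xs) r =
    lookups⇒All xs (λ j → r zero (suc j) λ ()) ∷ lookups⇒AllPairs xs (λ i j i≢j → r (suc i) (suc j) (λ eq → i≢j (Fin.suc-injective eq)))

  AllPairs⇒lookup : ∀ {A : Set} {R : A → A → Set} {xs : List A} → AllPairs R xs →
    ∀ i j → i Fin.< j → R (lookup xs i) (lookup xs j)
  AllPairs⇒lookup (r ∷ _) zero (suc j) _ = All.lookup r (∈-lookup j)
  AllPairs⇒lookup (_ ∷ rs) (suc i) (suc j) (s≤s i<j) = AllPairs⇒lookup rs i j i<j

  distinct-length : ∀ {b} {xs : List ℕ} → AllPairs _≢_ xs → All (_< b) xs → length xs ≤ b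
  distinct-length {b} {xs} distinct bounded with length xs ≤? b
  ... | yes fits = fits
  ... | no overflow = contradiction
    (trans (sym (Fin.toℕ-fromℕ< (small i))) (trans (cong toℕ same) (Fin.toℕ-fromℕ< (small j))))
    (AllPairs⇒lookup distinct i j i<j)
    where
    small : ∀ i → lookup xs i < b
    small i = All.lookup bounded (∈-lookup i)
    collision = Fin.pigeonhole (≰⇒> overflow) (λ i → fromℕ< (small i))
    i = proj₁ collision
    j = proj₁ (proj₂ collision)
    i<j = proj₁ (proj₂ (proj₂ collision))
    same = proj₂ (proj₂ (proj₂ collision))

  numColours-bound : ∀ {n b} (cs : List (Edge n × ℕ)) → All (λ ec → proj₂ ec < b) cs → numColours cs ≤ b
  numColours-bound cs bounded = distinct-length (deduplicate-! _≟_ (map proj₂ cs))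
    (All.deduplicate⁺ _≟_ (All.map⁺ bounded))

  module Colours (n K N : ℕ) (κ B δ scale G : ℚ) where
    open Colouring.Process n K N κ B δ scale G
    open State

    record Arrives (h : List (Edge n)) (e : Edge n) : Set where
      field
        loopless : proj₁ e ≢ proj₂ e
        new : ¬ Joined h (proj₁ e) (proj₂ e)
        room : ∀ x → x ∈ₑ e → suc (deg (state h) x) ≤ K

    data Arrivals : List (Edge n) → List (Edge n) → Set where
      [] : ∀ {h} → Arrivals h []
      _∷_ : ∀ {h e es} → Arrives h e → Arrivals (h ++ e ∷ []) es → Arrivals h (e ∷ es)

    arrivals-from : ∀ h es → All (λ e → proj₁ e ≢ proj₂ e) es → AllPairs (λ e f → ¬ SameEdge e f) es →
      (∀ {f e} → f ∈ h → e ∈ es → ¬ SameEdge f e) → (∀ x → deg (state h) x + degree es x ≤ K) → Arrivals h es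
    arrivals-from h [] _ _ _ _ = []
    arrivals-from h (e ∷ es) (loopless ∷ loopless′) (differ ∷ differ′) cross space = record
        { loopless = loopless
        ; new = λ joined → let f , f∈h , same = find joined in cross f∈h (here refl) (sameEdge-sym same)
        ; room = λ x x∈e → ≤-trans (≤-trans (≤-reflexive (sym (grown x x∈e))) (m≤m+n _ (degree es x))) (space′ x)
        }
      ∷ arrivals-from (h ++ e ∷ []) es loopless′ differ′ cross′
          (λ x → subst (λ st → deg st x + degree es x ≤ K) (sym (state-snoc h e)) (space′ x))
      where
      open Arrival (state h) e using (deg′)
      space′ : ∀ x → deg′ x + degree es x ≤ K
      space′ x = subst (_≤ K) (sym (mate-degree e es x (deg (state h) x))) (space x)
      grown : ∀ x → x ∈ₑ e → deg′ x ≡ suc (deg (state h) x)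
      grown x x∈e = cong (maybe′ (λ _ → suc (deg (state h) x)) (deg (state h) x)) (proj₂ (mate-∈ {e = e} x∈e))
      cross′ : ∀ {f g} → f ∈ h ++ e ∷ [] → g ∈ es → ¬ SameEdge f g
      cross′ f∈ g∈ with ∈-++⁻ h f∈
      ... | inj₁ f∈h = cross f∈h (there g∈)
      ... | inj₂ (here refl) = All.lookup differ g∈

    arrivals : ∀ {es} → SimpleGraph es → MaxDegree es K → Arrivals [] es
    arrivals {es} (loopless , simple) (deg≤ , _) =
      arrivals-from [] es (lookups⇒All es loopless) (lookups⇒AllPairs es simple) (λ ()) deg≤

    -- All that is guaranteed about the extra colours when Δ is too small for the randomised choice to concentrate.
    Trivial : List (Edge n) → State → Set
    Trivial h st = ∀ x → length (extras st x) ≤ deg st x × deg st x ≤ K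

    trivial-advance : ∀ {h e} → Trivial h (state h) → Arrives h e → Trivial (h ++ e ∷ []) (step (state h) e)
    trivial-advance {h} {e} trivial arrives x = extras≤deg (choose (state h) e) , deg≤K
      where
      st = state h
      open Arrival st e using (extras′; deg′)
      extras≤deg : ∀ k → length (extras′ k x) ≤ deg′ x
      extras≤deg zero with mate e x
      ... | just _ = s≤s (proj₁ (trivial x))
      ... | nothing = proj₁ (trivial x)
      extras≤deg (suc _) with mate e x
      ... | just _ = m≤n⇒m≤1+n (proj₁ (trivial x))
      ... | nothing = proj₁ (trivial x)
      deg≤K : deg′ x ≤ K
      deg≤K with mate e x in eq
      ... | nothing = proj₂ (trivial x)
      ... | just _ with mate-just {e = e} eq
      ... | inj₁ (x≡s , _) = Arrives.room arrives x (inj₁ x≡s)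
      ... | inj₂ (x≡t , _) = Arrives.room arrives x (inj₂ x≡t)

    -- `Good` abstracts from the two regimes: it becomes `Inv` when Δ is large and `Trivial`
    -- otherwise.
    module _ (A : OnlineAlgorithm) (A-spec : ∀ h e → A n K h e ≡ colourOf (state h) e) {u : ℕ}
      (Good : List (Edge n) → State → Set)
      (extras-small : ∀ {h st} → Good h st → ∀ x → length (extras st x) ≤ u)
      (advance : ∀ {h e} → Good h (state h) → Arrives h e → Good (h ++ e ∷ []) (step (state h) e)) where

      -- The bound `u` is assumed after the step. When an extra colour is taken, the lists at both
      -- endpoints have just grown, so before the step both were shorter than `u`; this gives the
      -- strict inequality.
      colour-bound : ∀ st e → (∀ x → length (extras (step st e) x) ≤ u) → colourOf st e < K + (u + u)
      colour-bound st e small with choose st e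
      ... | suc c = <-≤-trans (Fin.toℕ<n c) (m≤m+n K (u + u))
      ... | zero = +-monoʳ-< K (begin-strict
        fresh (extras st s ++ extras st t)               ≤⟨ fresh≤length (extras st s ++ extras st t) ⟩
        length (extras st s ++ extras st t)              ≡⟨ length-++ (extras st s) ⟩
        length (extras st s) + length (extras st t)      <⟨ +-mono-< (room (inj₁ refl)) (room (inj₂ refl)) ⟩
        u + u                                            ∎)
        where
        open ≤-Reasoning
        s = proj₁ e
        t = proj₂ e
        room : ∀ {x} → x ∈ₑ e → length (extras st x) < u
        room {x} x∈e = subst (λ y → length (maybe′ (λ _ → Arrival.extra st e ∷ extras st x) (extras st x) y) ≤ u)
          (proj₂ (mate-∈ {e = e} x∈e)) (small x)

      colours-bounded : ∀ {h es} → Arrivals h es → Good h (state h) → All (λ ec → proj₂ ec < K + (u + u)) (runFrom A n K h es)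
      colours-bounded [] _ = []
      colours-bounded {h} {e ∷ es} (arrives ∷ later) good =
        subst (_< K + (u + u)) (sym (A-spec h e)) (colour-bound (state h) e (extras-small good′))
        ∷ colours-bounded later (subst (Good (h ++ e ∷ [])) (sym (state-snoc h e)) good′)
        where good′ = advance good arrives

-- Choice of the resolution m, an integer substitute for a sixteenth root.

module Scales where

  open import Data.Nat
  open import Data.Nat.Logarithm using (⌊log₂_⌋; ⌊log₂⌋-mono-≤; ⌊log₂[2^n]⌋≡n)
  open import Data.Nat.Properties
  open import Data.Nat.Tactic.RingSolver using (solve-∀)
  open import Data.Product using (_×_; _,_; ∃)
  open import Data.Sum using (_⊎_; inj₁; inj₂)
  open import Relation.Binary.PropositionalEquality
  open import Relation.Nullary using (¬_; Dec; yes; no; contradiction)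

  <2^log : ∀ n → n < 2 ^ suc ⌊log₂ n ⌋
  <2^log n = ≰⇒> λ 2^≤n → 1+n≰n (subst (_≤ ⌊log₂ n ⌋) (⌊log₂[2^n]⌋≡n (suc ⌊log₂ n ⌋)) (⌊log₂⌋-mono-≤ 2^≤n))

  1≤log : ∀ {n} → 2 ≤ n → 1 ≤ ⌊log₂ n ⌋
  1≤log {n} 2≤n = subst (_≤ ⌊log₂ n ⌋) (⌊log₂[2^n]⌋≡n 1) (⌊log₂⌋-mono-≤ 2≤n)

  -- Linear search with fuel `f`; no monotonicity of `P` is assumed, since a crossing from true to
  -- false is all that is used.
  last-true : ∀ {P : ℕ → Set} → (∀ m → Dec (P m)) → ∀ f a → P a → ¬ P (f + a) → ∃ λ m → a ≤ m × P m × ¬ P (suc m)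
  last-true P? zero a Pa ¬P = contradiction Pa ¬P
  last-true {P} P? (suc f) a Pa ¬P with P? (suc a)
  ... | no ¬P′ = a , ≤-refl , Pa , ¬P′
  ... | yes P′ with last-true P? f (suc a) P′ (subst (λ z → ¬ P z) (sym (+-suc f a)) ¬P)
  ... | m , a<m , Pm , ¬Pm = m , <⇒≤ a<m , Pm , ¬Pm

  -- `m` is close to the root of order `k + 1` of `K/(cL)`, or 1 when that root is below the
  -- threshold `T`. Writing `T * m` in `coarse` covers both cases, being `T` in the second and at
  -- least `m + 1` in the first. The premise `1 ≤ L` is there because the algorithm is defined for
  -- every `n`, also where the logarithm is 0.
  record Resolution (c T k K L : ℕ) : Set where
    field
      m : ℕ
      1≤m : 1 ≤ m
      coarse : 1 ≤ L → K ≤ c * (L * (T * m) ^ suc k)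
      regime : m ≡ 1 ⊎ (T ≤ m × c * (L * m ^ suc k) ≤ K)

  module _ (c T k K L : ℕ) (1≤c : 1 ≤ c) (2≤T : 2 ≤ T) where

    private
      1≤T : 1 ≤ T
      1≤T = ≤-trans (s≤s z≤n) 2≤T

    beyond : 1 ≤ L → K < c * (L * (K + T) ^ suc k)
    beyond 1≤L = begin-strict
      K                             <⟨ m<m+n K 1≤T ⟩
      K + T                         ≤⟨ m≤m*n (K + T) ((K + T) ^ k) {{m^n≢0 (K + T) k {{>-nonZero (≤-trans 1≤T (m≤n+m T K))}}}} ⟩
      (K + T) ^ suc k               ≤⟨ m≤n*m ((K + T) ^ suc k) L {{>-nonZero 1≤L}} ⟩
      L * (K + T) ^ suc k           ≤⟨ m≤n*m (L * (K + T) ^ suc k) c {{>-nonZero 1≤c}} ⟩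
      c * (L * (K + T) ^ suc k)     ∎
      where open ≤-Reasoning

    unresolved : (1 ≤ L → K ≤ c * (L * T ^ suc k)) → Resolution c T k K L
    unresolved coarse = record
      { m = 1 ; 1≤m = ≤-refl
      ; coarse = λ 1≤L → subst (λ z → K ≤ c * (L * z ^ suc k)) (sym (*-identityʳ T)) (coarse 1≤L)
      ; regime = inj₁ refl }

    resolved : (∃ λ m → T ≤ m × c * (L * m ^ suc k) ≤ K × ¬ c * (L * suc m ^ suc k) ≤ K) → Resolution c T k K L
    resolved (m , T≤m , fine , coarser) = record
      { m = m
      ; 1≤m = ≤-trans 1≤T T≤m
      ; coarse = λ _ → ≤-trans (<⇒≤ (≰⇒> coarser)) (*-monoʳ-≤ c (*-monoʳ-≤ L (^-monoˡ-≤ (suc k) 1+m≤Tm)))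
      ; regime = inj₂ (T≤m , fine) }
      where
      1+m≤Tm : suc m ≤ T * m
      1+m≤Tm = ≤-trans (≤-trans (+-monoˡ-≤ m (≤-trans 1≤T T≤m)) (≤-reflexive (cong (m +_) (sym (+-identityʳ m))))) (*-monoˡ-≤ m 2≤T)

    opaque
      resolution : Resolution c T k K L
      resolution with 1 ≤? L | c * (L * T ^ suc k) ≤? K
      ... | no L<1 | _ = unresolved (λ 1≤L → contradiction 1≤L L<1)
      ... | yes _ | no sparse = unresolved (λ _ → <⇒≤ (≰⇒> sparse))
      ... | yes 1≤L | yes dense = resolved (last-true (λ m → c * (L * m ^ suc k) ≤? K) K T dense (<⇒≱ (beyond 1≤L)))

  ^-distribʳ : ∀ x y k → (x * y) ^ k ≡ x ^ k * y ^ k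
  ^-distribʳ x y zero = refl
  ^-distribʳ x y (suc k) = trans (cong (x * y *_) (^-distribʳ x y k)) (lemma x y (x ^ k) (y ^ k))
    where
    lemma : ∀ x y a b → x * y * (a * b) ≡ x * a * (y * b)
    lemma = solve-∀

  opaque
    factor : (k a c t : ℕ) → ℕ
    factor k a c t = a ^ suc k * (c * t ^ suc k)

    -- In `(zm)^(k+1) ≤ (aK)^(k+1)` a single factor `K` on the right is replaced by `cL(tm)^(k+1)`;
    -- then `m^(k+1)` cancels. This is where `Δ^15 log n` arises.
    excess-power : ∀ k {a c t z m K L} → 1 ≤ m → z * m ≤ a * K → K ≤ c * (L * (t * m) ^ suc k) →
      z ^ suc k ≤ factor k a c t * K ^ k * L
    excess-power k {a} {c} {t} {z} {m} {K} {L} 1≤m zm≤aK K≤ =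
      *-cancelʳ-≤ _ _ (m ^ suc k) {{m^n≢0 m (suc k) {{>-nonZero 1≤m}}}} (begin
        z ^ suc k * m ^ suc k                                     ≡⟨ ^-distribʳ z m (suc k) ⟨
        (z * m) ^ suc k                                           ≤⟨ ^-monoˡ-≤ (suc k) zm≤aK ⟩
        (a * K) ^ suc k                                           ≡⟨ ^-distribʳ a K (suc k) ⟩
        a ^ suc k * (K * K ^ k)                                   ≤⟨ *-monoʳ-≤ (a ^ suc k) (*-monoˡ-≤ (K ^ k) K≤) ⟩
        a ^ suc k * (c * (L * (t * m) ^ suc k) * K ^ k)           ≡⟨ cong (λ y → a ^ suc k * (c * (L * y) * K ^ k)) (^-distribʳ t m (suc k)) ⟩
        a ^ suc k * (c * (L * (t ^ suc k * m ^ suc k)) * K ^ k)   ≡⟨ lemma (a ^ suc k) c (t ^ suc k) (m ^ suc k) (K ^ k) L ⟩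
        a ^ suc k * (c * t ^ suc k) * K ^ k * L * m ^ suc k       ∎)
      where
      open ≤-Reasoning
      lemma : ∀ a c t m k L → a * (c * (L * (t * m)) * k) ≡ a * (c * t) * k * L * m
      lemma = solve-∀

-- Verification of the numerical requirements for dense instances.

module Settings where

  open import Data.Nat as ℕ using (ℕ; suc)
  import Data.Nat.Properties as ℕ
  open import Data.Rational
  open import Data.Rational.Properties
  open import Relation.Binary.PropositionalEquality
  open import Relation.Nullary.Decidable using (from-yes)
  open import Tactic.RingSolver using (solve-∀)
  open RationalTools
  open Concentration
  open Bounds
  open Colouring
  open Invariants

  16ℚ 512ℚ 2¹⁹ : ℚ
  16ℚ = 8ℚ + 8ℚ
  512ℚ = 8ℚ * 8ℚ * 8ℚ
  2¹⁹ = 2ℚ ^ 19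

  -- ε = 1/m.  H = Δ/m⁶ is the deviation allowed in every tracked sum, and scale = 1/(2H).  With L = ⌊log₂ n⌋ the exponent
  -- N = 16 L makes (3/2)^N exceed the initial potential.
  module Parameters (n K L m : ℕ) where
    M N : ℕ
    M = ℕ.pred (8 ℕ.* L)
    N = suc M ℕ.+ suc M

    ε δ κ B H scale η G : ℚ
    ε = inv (ι m)
    δ = inv (ι K)
    κ = (1ℚ - ε) * δ
    B = 2ℚ * ι m
    H = ι K * (ε * ε * (ε * ε) * (ε * ε))
    scale = ½ * (ι m * ι m * (ι m * ι m) * (ι m * ι m)) * δ
    η = ¼ * δ
    G = (1ℚ + η) ^ L

    open Colouring.Process n K N κ B δ scale G public

  module Regime (n K L m : ℕ) (1≤K : 1 ℕ.≤ K) (1≤L : 1 ℕ.≤ L) (n<2^ : n ℕ.< 2 ℕ.^ suc L) (2¹¹≤x : 2ℚ ^ 11 ≤ ι m)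
    (dense : 2¹⁹ * ι (L ℕ.* m ℕ.^ 16) ≤ ι K) where

    open Parameters n K L m

    private
      Δ x l : ℚ
      Δ = ι K
      x = ι m
      l = ι L

    1≤l : 1ℚ ≤ l
    1≤l = ι-mono 1≤L

    1152+1≤x : 1152ℚ + 1ℚ ≤ x
    1152+1≤x = ≤-trans (from-yes (1152ℚ + 1ℚ ≤? 2ℚ ^ 11)) 2¹¹≤x

    1≤x : 1ℚ ≤ x
    1≤x = ≤-trans (from-yes (1ℚ ≤? 1152ℚ + 1ℚ)) 1152+1≤x

    0<x : 0ℚ < x
    0<x = <-≤-trans (positive⁻¹ 1ℚ) 1≤x

    1≤* : ∀ {a b} → 1ℚ ≤ a → 1ℚ ≤ b → 1ℚ ≤ a * b
    1≤* {a} {b} 1≤a 1≤b = ≤-trans 1≤a (subst (_≤ a * b) (*-identityʳ a) (*-monoˡ (≤-trans 0≤1 1≤a) 1≤b))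

    -- The powers `m⁶ = Δ/H` and `m⁸`. The potential makes steps of size `β = 8pδ`, and its growth
    -- involves `p²`, the power in `dense`.
    c p : ℚ
    c = x * x * (x * x) * (x * x)
    p = x * x * c

    1≤x² : 1ℚ ≤ x * x
    1≤x² = 1≤* 1≤x 1≤x

    1≤c : 1ℚ ≤ c
    1≤c = 1≤* (1≤* 1≤x² 1≤x²) 1≤x²

    x²≤p : x * x ≤ p
    x²≤p = subst (_≤ p) (*-identityʳ (x * x)) (*-monoˡ (≤-trans 0≤1 1≤x²) 1≤c)

    1≤p : 1ℚ ≤ p
    1≤p = 1≤* 1≤x² 1≤c

    0<Δ : 0ℚ < Δ
    0<Δ = ι-pos 1≤K

    0≤Δ : 0ℚ ≤ Δ
    0≤Δ = <⇒≤ 0<Δ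

    0≤δ : 0ℚ ≤ δ
    0≤δ = inv-nonNeg 0<Δ

    0≤e : 0ℚ ≤ ε
    0≤e = inv-nonNeg 0<x

    Δδ≡1 : Δ * δ ≡ 1ℚ
    Δδ≡1 = inv-inverse 0<Δ

    xe≡1 : x * ε ≡ 1ℚ
    xe≡1 = inv-inverse 0<x

    em≡1 : ε * x ≡ 1ℚ
    em≡1 = trans (*-comm ε x) xe≡1

    e≤1 : ε ≤ 1ℚ
    e≤1 = subst₂ _≤_ (*-identityˡ ε) xe≡1 (*-monoʳ 0≤e 1≤x)

    dense-ℚ : 2¹⁹ * (l * (p * p)) * δ ≤ 1ℚ
    dense-ℚ = subst (2¹⁹ * (l * (p * p)) * δ ≤_) Δδ≡1 (*-monoʳ 0≤δ (subst (_≤ Δ) cast dense))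
      where
      sixteen : ∀ x → x * (x * (x * (x * (x * (x * (x * (x * (x * (x * (x * (x * (x * (x * (x * (x * 1ℚ))))))))))))))) ≡
        x * x * (x * x * (x * x) * (x * x)) * (x * x * (x * x * (x * x) * (x * x)))
      sixteen = solve-∀ ℚ-ring
      cast : 2¹⁹ * ι (L ℕ.* m ℕ.^ 16) ≡ 2¹⁹ * (l * (p * p))
      cast = cong (2¹⁹ *_) (trans (ι-* L (m ℕ.^ 16)) (cong (l *_) (trans (ι-^ m 16) (sixteen x))))

    0≤l : 0ℚ ≤ l
    0≤l = ≤-trans 0≤1 1≤l

    0≤p : 0ℚ ≤ p
    0≤p = ≤-trans 0≤1 1≤p

    0≤512 : 0ℚ ≤ 512ℚ
    0≤512 = from-yes (0ℚ ≤? 512ℚ)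

    p≤lp : p ≤ l * p
    p≤lp = subst (_≤ l * p) (*-identityˡ p) (*-monoʳ 0≤p 1≤l)

    roomy : 512ℚ * (l * p) * δ ≤ 1ℚ
    roomy = ≤-trans (*-monoʳ 0≤δ (*-mono 0≤512 (from-yes (512ℚ ≤? 2¹⁹)) (0≤* 0≤l 0≤p)
      (*-monoˡ 0≤l (subst (_≤ p * p) (*-identityʳ p) (*-monoˡ 0≤p 1≤p))))) dense-ℚ

    N≡ : ι N ≡ 16ℚ * l
    N≡ = trans (cong ι (cong₂ ℕ._+_ 8L 8L)) (trans (ι-+ (8 ℕ.* L) (8 ℕ.* L))
      (trans (cong₂ _+_ (ι-* 8 L) (ι-* 8 L)) (sym (*-distribʳ-+ l 8ℚ 8ℚ))))
      where
      8L : suc M ≡ 8 ℕ.* L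
      8L = ℕ.suc-pred (8 ℕ.* L) {{ℕ.>-nonZero (ℕ.≤-trans 1≤L (ℕ.m≤n*m L 8))}}

    β≡ : 4ℚ * x * (4ℚ * x) * scale ≡ 8ℚ * p * δ
    β≡ = lemma x δ
      where
      lemma : ∀ x δ → 4ℚ * x * (4ℚ * x) * (½ * (x * x * (x * x) * (x * x)) * δ) ≡ 8ℚ * (x * x * (x * x * (x * x) * (x * x))) * δ
      lemma = solve-∀ ℚ-ring

    β≤½ : 4ℚ * x * (4ℚ * x) * scale ≤ ½
    β≤½ = subst (_≤ ½) (sym β≡) (bound p δ (l * p) 0≤p 0≤δ p≤lp roomy)
      where
      bound : ∀ p δ y → 0ℚ ≤ p → 0ℚ ≤ δ → p ≤ y → 512ℚ * y * δ ≤ 1ℚ → 8ℚ * p * δ ≤ ½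
      bound p δ y 0≤p 0≤δ p≤y roomy = ≤-trans (≤-trans (*-monoʳ 0≤δ (*-mono (nonNegative⁻¹ 8ℚ) (from-yes (8ℚ ≤? ½ * 512ℚ)) 0≤p p≤y))
        (≤-reflexive (lemma 512ℚ y δ))) (*-monoˡ 0≤½ roomy)
        where
        lemma : ∀ f y δ → ½ * f * y * δ ≡ ½ * (f * y * δ)
        lemma = solve-∀ ℚ-ring

    nβ≤¼ : ι N * (4ℚ * x * (4ℚ * x) * scale) ≤ ¼
    nβ≤¼ = subst (_≤ ¼) (sym (trans (cong₂ _*_ N≡ β≡) (lemma l p δ))) (*-monoˡ (nonNegative⁻¹ ¼) roomy)
      where
      lemma : ∀ l p δ → 16ℚ * l * (8ℚ * p * δ) ≡ ¼ * (512ℚ * (l * p) * δ)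
      lemma = solve-∀ ℚ-ring

    -- With `N = 16L` and `β = 8pδ` the left side is `L · (δ/4) · (4·8·16²·8² · L p² δ)`. The number
    -- in the last bracket is `2¹⁹`, so the bracket is at most 1 by `dense`, and Bernoulli's
    -- inequality gives `Lη ≤ G - 1`.
    growth : 8ℚ * (ι N * ι N) * (4ℚ * x * (4ℚ * x) * scale * (4ℚ * x * (4ℚ * x) * scale)) ≤ G - 1ℚ
    growth = ≤-trans (subst₂ _≤_
      (sym (trans (cong₂ (λ a b → 8ℚ * (a * a) * (b * b)) N≡ β≡) (lemma 16ℚ 8ℚ l p δ)))
      (*-identityʳ (l * η)) (*-monoˡ (0≤* 0≤l 0≤η) dense-ℚ))
      (≤-from (G - (1ℚ + l * η)) (gap (bernoulli L 0≤η)) (rearrange G (l * η)))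
      where
      0≤η : 0ℚ ≤ η
      0≤η = 0≤* (nonNegative⁻¹ ¼) 0≤δ
      rearrange : ∀ G y → G - 1ℚ ≡ y + (G - (1ℚ + y))
      rearrange = solve-∀ ℚ-ring
      lemma : ∀ s f l p δ → f * (s * l * (s * l)) * (f * p * δ * (f * p * δ)) ≡ l * (¼ * δ) * (4ℚ * f * (s * s) * (f * f) * (l * (p * p)) * δ)
      lemma = solve-∀ ℚ-ring

    sparse : 8ℚ * (x * x) * δ ≤ 1ℚ
    sparse = ≤-trans (*-monoʳ 0≤δ (*-mono (nonNegative⁻¹ 8ℚ) (from-yes (8ℚ ≤? 512ℚ)) (≤-trans 0≤1 1≤x²) (≤-trans x²≤p p≤lp))) roomy

    r : ℚ
    r = ε * ε * (ε * ε) * (ε * ε)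

    0≤r : 0ℚ ≤ r
    0≤r = 0≤* (0≤* (0≤² ε) (0≤² ε)) (0≤² ε)

    cancel : ∀ {a b} → a ≡ 1ℚ → ∀ z → b ≡ z * a → b ≡ z
    cancel refl z b≡ = trans b≡ (*-identityʳ z)

    xe⁶≡1 : x * ε * (x * ε) * (x * ε * (x * ε)) * (x * ε * (x * ε)) ≡ 1ℚ
    xe⁶≡1 = cong (λ y → y * y * (y * y) * (y * y)) xe≡1

    bulk : 2ℚ * (4ℚ * x * (4ℚ * x)) ≤ H
    bulk = ≤-trans
      (≤-reflexive (sym (cancel xe⁶≡1 _ (lemma x ε))))
      (*-monoʳ 0≤r (≤-trans (*-mono (0≤+ (nonNegative⁻¹ 16ℚ) (nonNegative⁻¹ 16ℚ)) (from-yes (16ℚ + 16ℚ ≤? 512ℚ)) 0≤p p≤lp) room))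
      where
      lemma : ∀ x ε → (16ℚ + 16ℚ) * (x * x * (x * x * (x * x) * (x * x))) * (ε * ε * (ε * ε) * (ε * ε)) ≡
        2ℚ * (4ℚ * x * (4ℚ * x)) * (x * ε * (x * ε) * (x * ε * (x * ε)) * (x * ε * (x * ε)))
      lemma = solve-∀ ℚ-ring
      room : 512ℚ * (l * p) ≤ Δ
      room = subst₂ _≤_ (cancel Δδ≡1 (512ℚ * (l * p)) (swap (512ℚ * (l * p)) δ Δ)) (*-identityʳ Δ)
        (*-monoˡ 0≤Δ roomy)
        where
        swap : ∀ y δ Δ → Δ * (y * δ) ≡ y * (Δ * δ)
        swap = solve-∀ ℚ-ring

    Hδ≡r : H * δ ≡ r
    Hδ≡r = cancel Δδ≡1 r (swap Δ r δ)
      where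
      swap : ∀ Δ r δ → Δ * r * δ ≡ r * (Δ * δ)
      swap = solve-∀ ℚ-ring

    -- As `Hδ = ε⁶`, the left side is `1152ε² + ε⁶ ≤ 1153ε²`, at most `ε` once `m ≥ 1153`; the
    -- threshold `2¹¹` is chosen above this.
    tight : 1152ℚ * (x * x * (x * x) * H * δ) + H * δ ≤ ε
    tight = ≤-trans (≤-reflexive (cong₂ _+_ (cong (1152ℚ *_) (trans (*-assoc (x * x * (x * x)) H δ) (trans (cong (x * x * (x * x) *_) Hδ≡r)
        (cancel (cong (λ y → y * y * (y * y)) xe≡1) (ε * ε) (fourth x ε))))) Hδ≡r))
      (≤-trans (+-monoʳ-≤ (1152ℚ * (ε * ε)) r≤e²) (subst₂ _≤_ (lemma 1152ℚ ε) (trans (sym (*-assoc x ε ε)) (trans (cong (_* ε) xe≡1) (*-identityˡ ε)))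
        (*-monoʳ (0≤² ε) 1152+1≤x)))
      where
      fourth : ∀ x ε → x * x * (x * x) * (ε * ε * (ε * ε) * (ε * ε)) ≡ ε * ε * (x * ε * (x * ε) * (x * ε * (x * ε)))
      fourth = solve-∀ ℚ-ring
      lemma : ∀ f ε → (f + 1ℚ) * (ε * ε) ≡ f * (ε * ε) + ε * ε
      lemma = solve-∀ ℚ-ring
      e²≤1 : ε * ε ≤ 1ℚ
      e²≤1 = ≤-trans (*-≤1 0≤e e≤1) e≤1
      r≤e² : r ≤ ε * ε
      r≤e² = ≤-trans (*-≤1 (0≤* (0≤² ε) (0≤² ε)) e²≤1) (*-≤1 (0≤² ε) e²≤1)

    2Hs≡1 : 2ℚ * H * scale ≡ 1ℚ
    2Hs≡1 = trans (lemma x ε Δ δ) (trans (cong₂ _*_ Δδ≡1 xe⁶≡1) refl)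
      where
      lemma : ∀ x ε Δ δ → 2ℚ * (Δ * (ε * ε * (ε * ε) * (ε * ε))) * (½ * (x * x * (x * x) * (x * x)) * δ) ≡
        Δ * δ * (x * ε * (x * ε) * (x * ε * (x * ε)) * (x * ε * (x * ε)))
      lemma = solve-∀ ℚ-ring

    0≤κ : 0ℚ ≤ κ
    0≤κ = 0≤* (gap e≤1) 0≤δ

    κ≤δ : κ ≤ δ
    κ≤δ = ≤-from (ε * δ) (0≤* 0≤e 0≤δ) (lemma ε δ)
      where
      lemma : ∀ ε δ → δ ≡ (1ℚ - ε) * δ + ε * δ
      lemma = solve-∀ ℚ-ring

    κΔ≡1-e : κ * Δ ≡ 1ℚ - ε
    κΔ≡1-e = cancel Δδ≡1 (1ℚ - ε) (lemma ε δ Δ)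
      where
      lemma : ∀ ε δ Δ → (1ℚ - ε) * δ * Δ ≡ (1ℚ - ε) * (Δ * δ)
      lemma = solve-∀ ℚ-ring

    2≤x : 2ℚ ≤ x
    2≤x = ≤-trans (from-yes (2ℚ ≤? 1152ℚ + 1ℚ)) 1152+1≤x

    0≤scale : 0ℚ ≤ scale
    0≤scale = 0≤* (0≤* 0≤½ (≤-trans 0≤1 1≤c)) 0≤δ

    setup : Setup
    setup = record
      { n = n ; K = K ; M = M ; m = x ; e₀ = ε ; δ = δ ; κ = κ ; H = H ; scale = scale ; G = G
      ; 2≤m = 2≤x ; 0≤e = 0≤e ; 0≤δ = 0≤δ ; 0≤κ = 0≤κ ; κ≤δ = κ≤δ ; 0≤H = 0≤* 0≤Δ 0≤r ; 0≤scale = 0≤scale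
      ; Δδ≡1 = Δδ≡1 ; em≡1 = em≡1 ; κΔ≡1-e = κΔ≡1-e ; 2Hs≡1 = 2Hs≡1
      ; sparse = sparse ; tight = tight ; bulk = bulk ; β≤½ = β≤½ ; nβ≤¼ = nβ≤¼ ; growth = growth
      }

    -- `η = 1/(4Δ)` makes `2Δη = ½`, so over all `2Δ` moves `1 + η` compounds to at most
    -- `1/(1 - ½) = 2`.
    G-power : G ^ (K ℕ.+ K) ≤ 2ℚ ^ L
    G-power = subst (_≤ 2ℚ ^ L) (sym (trans (^-assocʳ (1ℚ + η) L (K ℕ.+ K))
        (trans (cong ((1ℚ + η) ^_) (ℕ.*-comm L (K ℕ.+ K))) (sym (^-assocʳ (1ℚ + η) (K ℕ.+ K) L)))))
      (^-mono L (^-nonNeg (K ℕ.+ K) 0≤1+η) doubling)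
      where
      0≤η : 0ℚ ≤ η
      0≤η = 0≤* (nonNegative⁻¹ ¼) 0≤δ
      0≤1+η : 0ℚ ≤ 1ℚ + η
      0≤1+η = 0≤+ 0≤1 0≤η
      half : 1ℚ - ι (K ℕ.+ K) * η ≡ ½
      half = trans (cong (λ t → 1ℚ - t * η) (ι-+ K K)) (trans (lemma Δ δ) (cong (λ y → 1ℚ - ½ * y) Δδ≡1))
        where
        lemma : ∀ Δ δ → 1ℚ - (Δ + Δ) * (¼ * δ) ≡ 1ℚ - ½ * (Δ * δ)
        lemma = solve-∀ ℚ-ring
      doubling : (1ℚ + η) ^ (K ℕ.+ K) ≤ 2ℚ
      doubling = *-cancelˡ (positive⁻¹ ½) (subst (_≤ 1ℚ)
        (trans (cong ((1ℚ + η) ^ (K ℕ.+ K) *_) half) (*-comm ((1ℚ + η) ^ (K ℕ.+ K)) ½)) (compound-bound (K ℕ.+ K) 0≤η))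

    objects≤ : 4 ℕ.* (n ℕ.* n) ℕ.* 2 ℕ.≤ 2 ℕ.^ (7 ℕ.* L)
    objects≤ = begin
      4 ℕ.* (n ℕ.* n) ℕ.* 2                        ≡⟨ trans (ℕ.*-comm (4 ℕ.* (n ℕ.* n)) 2) (sym (ℕ.*-assoc 2 4 (n ℕ.* n))) ⟩
      2 ℕ.^ 3 ℕ.* (n ℕ.* n)                        ≤⟨ ℕ.*-mono-≤ (ℕ.^-monoʳ-≤ 2 {3} {3 ℕ.* L} (ℕ.*-monoʳ-≤ 3 1≤L)) (ℕ.*-mono-≤ n≤ n≤) ⟩
      2 ℕ.^ (3 ℕ.* L) ℕ.* (2 ℕ.^ (2 ℕ.* L) ℕ.* 2 ℕ.^ (2 ℕ.* L))
        ≡⟨ cong (2 ℕ.^ (3 ℕ.* L) ℕ.*_) (ℕ.^-distribˡ-+-* 2 (2 ℕ.* L) (2 ℕ.* L)) ⟨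
      2 ℕ.^ (3 ℕ.* L) ℕ.* 2 ℕ.^ (2 ℕ.* L ℕ.+ 2 ℕ.* L)
        ≡⟨ ℕ.^-distribˡ-+-* 2 (3 ℕ.* L) (2 ℕ.* L ℕ.+ 2 ℕ.* L) ⟨
      2 ℕ.^ (3 ℕ.* L ℕ.+ (2 ℕ.* L ℕ.+ 2 ℕ.* L))
        ≡⟨ cong (2 ℕ.^_) (trans (cong (3 ℕ.* L ℕ.+_) (sym (ℕ.*-distribʳ-+ L 2 2))) (sym (ℕ.*-distribʳ-+ L 3 4))) ⟩
      2 ℕ.^ (7 ℕ.* L) ∎
      where
      open ℕ.≤-Reasoning
      n≤ : n ℕ.≤ 2 ℕ.^ (2 ℕ.* L)
      n≤ = ℕ.≤-trans (ℕ.<⇒≤ n<2^) (ℕ.^-monoʳ-≤ 2 (ℕ.+-mono-≤ 1≤L (ℕ.≤-reflexive (sym (ℕ.+-identityʳ L)))))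

    -- The origin of `N = 16L`: there are `4n²` quantities with two powers each, `8n² ≤ 2^(7L)`, the
    -- reserve for growth costs `2^L`, and `2^(8L) ≤ (9/4)^(8L) = (3/2)^(16L)`.
    initial-small : potential initial ≤ (1ℚ + ½) ^ N
    initial-small = begin
      potential initial
        ≡⟨ trans (sum-cong {k = 4 ℕ.* (n ℕ.* n)} (λ i → trans (cong (λ y → term y (K ℕ.+ K)) (*-zeroʳ scale)) (term-zero (K ℕ.+ K))))
             (sum-const (4 ℕ.* (n ℕ.* n)) (2ℚ * G ^ (K ℕ.+ K))) ⟩
      ι (4 ℕ.* (n ℕ.* n)) * (2ℚ * G ^ (K ℕ.+ K))
        ≡⟨ trans (sym (*-assoc (ι (4 ℕ.* (n ℕ.* n))) 2ℚ (G ^ (K ℕ.+ K)))) (cong (_* G ^ (K ℕ.+ K)) (sym (ι-* (4 ℕ.* (n ℕ.* n)) 2))) ⟩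
      ι (4 ℕ.* (n ℕ.* n) ℕ.* 2) * G ^ (K ℕ.+ K)
        ≤⟨ *-mono (ι-nonNeg (4 ℕ.* (n ℕ.* n) ℕ.* 2)) (ι-mono objects≤) (^-nonNeg (K ℕ.+ K) (≤-trans 0≤1 1≤G′)) G-power ⟩
      ι (2 ℕ.^ (7 ℕ.* L)) * 2ℚ ^ L
        ≡⟨ trans (cong (_* 2ℚ ^ L) (ι-^ 2 (7 ℕ.* L))) (sym (^-homo-* 2ℚ (7 ℕ.* L) L)) ⟩
      2ℚ ^ (7 ℕ.* L ℕ.+ L)
        ≡⟨ cong (2ℚ ^_) (trans (ℕ.+-comm (7 ℕ.* L) L) (sym (ℕ.suc-pred (8 ℕ.* L) {{ℕ.>-nonZero (ℕ.≤-trans 1≤L (ℕ.m≤n*m L 8))}}))) ⟩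
      2ℚ ^ suc M
        ≤⟨ ^-mono (suc M) 0≤2 (from-yes (2ℚ ≤? (1ℚ + ½) * (1ℚ + ½))) ⟩
      ((1ℚ + ½) * (1ℚ + ½)) ^ suc M
        ≡⟨ trans (^-distrib-* (1ℚ + ½) (1ℚ + ½) (suc M)) (sym (^-homo-* (1ℚ + ½) (suc M) (suc M))) ⟩
      (1ℚ + ½) ^ N ∎
      where
      open ≤-Reasoning
      open Weighting N G using (term; term-zero)
      1≤G′ : 1ℚ ≤ G
      1≤G′ = 1≤^ L (≤-from η (0≤* (nonNegative⁻¹ ¼) 0≤δ) refl)

-- The algorithm and the two regimes.

module Main where

  open import Data.List using (List; []; _∷_; _++_; length)
  open import Data.List.Relation.Unary.All using (All)
  open import Data.Nat as ℕ using (ℕ)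
  open import Data.Nat.DivMod using (_/_; m*n/n≡m; m/n*n≤m; /-monoˡ-≤)
  import Data.Nat.Properties as ℕ
  open import Data.Nat.Logarithm using (⌊log₂_⌋)
  open import Data.Product using (_×_; _,_; proj₁; proj₂)
  open import Data.Rational as ℚ using (ℚ)
  import Data.Rational.Properties as ℚ
  open import Data.Sum using (_⊎_; inj₁; inj₂)
  open import Relation.Binary.PropositionalEquality
  open RationalTools using (ι; ι-mono; ι-cancel; ι-*; ι-^; 2ℚ; 3ℚ) renaming (_^_ to _^ℚ_)
  open Scales
  open Invariants
  open Settings
  open Runs

  ι-2^* : ∀ k x → ι (2 ℕ.^ k ℕ.* x) ≡ 2ℚ ^ℚ k ℚ.* ι x
  ι-2^* k x = trans (ι-* (2 ℕ.^ k) x) (cong (ℚ._* ι x) (ι-^ 2 k))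

  -- Opaque, so that these numerals are never expanded in unary.
  opaque
    density threshold : ℕ
    density = 2 ℕ.^ 19
    threshold = 2 ℕ.^ 11

    1≤density : 1 ℕ.≤ density
    1≤density = ℕ.m^n>0 2 19

    2≤threshold : 2 ℕ.≤ threshold
    2≤threshold = ℕ.^-monoʳ-≤ 2 {1} {11} (ℕ.s≤s ℕ.z≤n)

    ι-density-* : ∀ x → ι (density ℕ.* x) ≡ 2¹⁹ ℚ.* ι x
    ι-density-* = ι-2^* 19

    ι-threshold : ι threshold ≡ 2ℚ ^ℚ 11
    ι-threshold = ι-^ 2 11

  module Algorithm (n K : ℕ) where
    open Scales.Resolution (resolution density threshold 15 K ⌊log₂ n ⌋ 1≤density 2≤threshold) public
    open Parameters n K ⌊log₂ n ⌋ m public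

  algorithm : OnlineAlgorithm
  algorithm n K h e = colourOf (state h) e
    where open Algorithm n K

  algorithm-proper : ∀ n K es → ProperColouring (run algorithm n K es)
  algorithm-proper n K = Run.proper algorithm (λ _ _ → refl)
    where open Algorithm n K

  module Bound (n K : ℕ) (2≤n : 2 ℕ.≤ n) (1≤K : 1 ℕ.≤ K) {es : List (Edge n)} (simple : SimpleGraph es) (degrees : MaxDegree es K) where
    open Algorithm n K
    open Colours n K N κ B δ scale G

    instance
      m≢0 : ℕ.NonZero m
      m≢0 = ℕ.>-nonZero 1≤m

    u : ℕ
    u = 3 ℕ.* K / m

    ≤u : ∀ {x} → x ℕ.* m ℕ.≤ 3 ℕ.* K → x ℕ.≤ u
    ≤u {x} xm≤ = subst (ℕ._≤ u) (m*n/n≡m x m) (/-monoˡ-≤ m xm≤)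

    bounded-by : (Good : List (Edge n) → State → Set) → (∀ {h st} → Good h st → ∀ x → length (State.extras st x) ℕ.≤ u) →
      (∀ {h e} → Good h (state h) → Arrives h e → Good (h ++ e ∷ []) (step (state h) e)) → Good [] initial →
      All (λ ec → proj₂ ec ℕ.< K ℕ.+ (u ℕ.+ u)) (run algorithm n K es)
    bounded-by Good extras-small advance start =
      colours-bounded algorithm (λ _ _ → refl) Good extras-small advance (arrivals simple degrees) start

    -- For `m = 1` the allowance per vertex is `3Δ`, at least its degree, so it is enough that each
    -- edge adds at most one extra colour at an endpoint.
    bounded-small : m ≡ 1 → All (λ ec → proj₂ ec ℕ.< K ℕ.+ (u ℕ.+ u)) (run algorithm n K es)
    bounded-small m≡1 = bounded-by Trivial
      (λ {h} {st} trivial x → ≤u (ℕ.≤-trans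
        (ℕ.≤-reflexive (trans (cong (length (State.extras st x) ℕ.*_) m≡1) (ℕ.*-identityʳ (length (State.extras st x)))))
        (ℕ.≤-trans (ℕ.≤-trans (proj₁ (trivial x)) (proj₂ (trivial x))) (ℕ.m≤n*m K 3))))
      trivial-advance (λ _ → ℕ.z≤n , ℕ.z≤n)

    module Large (threshold≤m : threshold ℕ.≤ m) (dense : density ℕ.* (⌊log₂ n ⌋ ℕ.* m ℕ.^ 16) ℕ.≤ K) where
      threshold-ℚ : 2ℚ ^ℚ 11 ℚ.≤ ι m
      threshold-ℚ = subst (ℚ._≤ ι m) ι-threshold (ι-mono threshold≤m)

      dense-ℚ : 2¹⁹ ℚ.* ι (⌊log₂ n ⌋ ℕ.* m ℕ.^ 16) ℚ.≤ ι K
      dense-ℚ = subst (ℚ._≤ ι K) (ι-density-* (⌊log₂ n ⌋ ℕ.* m ℕ.^ 16)) (ι-mono dense)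

      open Regime n K ⌊log₂ n ⌋ m 1≤K (1≤log 2≤n) (<2^log n) threshold-ℚ dense-ℚ using (setup; initial-small)
      open Invariants.Analysis setup using (Inv; module Advance; extras-bound; initial-inv)

      Good : List (Edge n) → State → Set
      Good = Inv

      extras-small : ∀ {h st} → Inv h st → ∀ x → length (State.extras st x) ℕ.≤ u
      extras-small {st = st} inv x = ≤u (ι-cancel (subst₂ ℚ._≤_ (sym (ι-* (length (State.extras st x)) m)) (sym (ι-* 3 K)) (extras-bound inv x)))

      advance : ∀ {h e} → Inv h (state h) → Arrives h e → Inv (h ++ e ∷ []) (step (state h) e)
      advance {h} {e} inv arrives = Advance.inv-step inv (proj₁ e) (proj₂ e) (Arrives.loopless arrives) (Arrives.new arrives) (Arrives.room arrives)

      start : Inv [] initial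
      start = initial-inv initial-small

    bounded-large : (threshold≤m : threshold ℕ.≤ m) (dense : density ℕ.* (⌊log₂ n ⌋ ℕ.* m ℕ.^ 16) ℕ.≤ K) →
      All (λ ec → proj₂ ec ℕ.< K ℕ.+ (u ℕ.+ u)) (run algorithm n K es)
    bounded-large threshold≤m dense = bounded-by (Good threshold≤m dense) (extras-small threshold≤m dense) (advance threshold≤m dense) (start threshold≤m dense)
      where open Large

    bounded-in : m ≡ 1 ⊎ (threshold ℕ.≤ m × density ℕ.* (⌊log₂ n ⌋ ℕ.* m ℕ.^ 16) ℕ.≤ K) →
      All (λ ec → proj₂ ec ℕ.< K ℕ.+ (u ℕ.+ u)) (run algorithm n K es)
    bounded-in (inj₁ m≡1) = bounded-small m≡1
    bounded-in (inj₂ (threshold≤m , dense)) = bounded-large threshold≤m dense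

    bounded : All (λ ec → proj₂ ec ℕ.< K ℕ.+ (u ℕ.+ u)) (run algorithm n K es)
    bounded = bounded-in regime

    excess : numColours (run algorithm n K es) ℕ.∸ K ℕ.≤ u ℕ.+ u
    excess = ℕ.m≤n+o⇒m∸n≤o (numColours (run algorithm n K es)) K (numColours-bound (run algorithm n K es) bounded)

    excess*m : (numColours (run algorithm n K es) ℕ.∸ K) ℕ.* m ℕ.≤ 6 ℕ.* K
    excess*m = begin
      (numColours (run algorithm n K es) ℕ.∸ K) ℕ.* m   ≤⟨ ℕ.*-monoˡ-≤ m excess ⟩
      (u ℕ.+ u) ℕ.* m                                   ≡⟨ ℕ.*-distribʳ-+ m u u ⟩
      u ℕ.* m ℕ.+ u ℕ.* m                               ≤⟨ ℕ.+-mono-≤ (m/n*n≤m (3 ℕ.* K) m) (m/n*n≤m (3 ℕ.* K) m) ⟩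
      3 ℕ.* K ℕ.+ 3 ℕ.* K                               ≡⟨ ℕ.*-distribʳ-+ K 3 3 ⟨
      6 ℕ.* K                                           ∎
      where open ℕ.≤-Reasoning

    excess-power-bound : (numColours (run algorithm n K es) ℕ.∸ K) ℕ.^ 16 ℕ.≤
      factor 15 6 density threshold ℕ.* K ℕ.^ 15 ℕ.* ⌊log₂ n ⌋
    excess-power-bound = excess-power 15 {z = numColours (run algorithm n K es) ℕ.∸ K} 1≤m excess*m (coarse (1≤log 2≤n))

open import Data.Nat using (ℕ; _≤_; _*_; _^_; _∸_)
open import Data.Nat.Logarithm using (⌊log₂_⌋)
open import Data.Product using (Σ; _×_; _,_)
open import Data.List using (List)
open Scales using (factor)
open Main using (density; threshold; algorithm; algorithm-proper; module Bound)

-- The bound is raised to the 16th power to stay within the natural numbers. As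
-- `⌊log₂ n⌋ ≤ ln n / ln 2`, taking roots gives the real form with another absolute constant; the
-- truncated difference is 0 when at most `Δ` colours are used.
theorem3p1 : Σ ℕ λ C → Σ OnlineAlgorithm λ A →
    (n Δ : ℕ) → 2 ≤ n → 1 ≤ Δ →
    (es : List (Edge n)) → SimpleGraph es → MaxDegree es Δ →
      ProperColouring (run A n Δ es) ×
      ((numColours (run A n Δ es) ∸ Δ) ^ 16 ≤ C * Δ ^ 15 * ⌊log₂ n ⌋)
theorem3p1 = factor 15 6 density threshold , algorithm , λ n Δ 2≤n 1≤Δ es simple degrees →
  algorithm-proper n Δ es , Bound.excess-power-bound n Δ 2≤n 1≤Δ {es} simple degrees
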